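{- Let $h\in\mathbb{N}$ and let $f\colon\mathbb{N}\to\mathbb{N}$ be a function. There exists an algorithm that, given (i) $r\in\mathbb{N}$ with $r>h$, (ii) an $n$-vertex graph $G$ equipped with a $(1-1/r)$-general cover $\mathcal{C}=\{C_1,C_2,\ldots\}$ of $G$ and, for each $i$, a tree decomposition $\mathcal{T}_i=(T_i,\{X_t\}_{t\in V(T_i)})$ of $G[C_i]$ with $\alpha(\mathcal{T}_i)\le f(r)$, (iii) a finite family $\mathcal{H}=\{H_j\}_{j\in J}$ of connected non-null subgraphs of $G$ with $|V(H_j)|\le h$ for every $j\in J$, (iv) a weight function $w\colon J\to\mathbb{Q}_+$, returns, in time $|\mathcal{C}|\cdot O(n^{h(f(r)+1)}\cdot t)$ where $t=\max_i|V(T_i)|$, an independent $\mathcal{H}$-packing in $G$ whose weight is at least $(1-h/r)$ times the maximum weight of an independent $\mathcal{H}$-packing in $G$.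
   Context: Graphs are finite and simple; $\alpha(H)$ is the independence number. A tree decomposition of $G$ is a pair $(T,\{X_t\}_{t\in V(T)})$ with $T$ a tree and bags $X_t\subseteq V(G)$ such that every vertex lies in some bag, every edge has both ends in some bag, and for each vertex $u$ the nodes whose bags contain $u$ induce a connected subtree; its independence number is $\alpha(\mathcal{T})=\max_t\alpha(G[X_t])$. For $\beta\le1$, a $\beta$-general cover of $G$ is a multiset $\mathcal{C}$ of subsets of $V(G)$ such that each vertex belongs to at least $\beta|\mathcal{C}|$ elements of $\mathcal{C}$. Given a family $\mathcal{H}=\{H_j\}_{j\in J}$ of subgraphs of $G$, an independent $\mathcal{H}$-packing is a subfamily $\{H_i\}_{i\in I}$, $I\subseteq J$, of pairwise vertex-disjoint subgraphs with no edge of $G$ between any two of them; its weight is $\sum_{i\in I}w(i)$.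
   Formalization: The cover is assumed non-empty, and the time bound (not correctness) is claimed for n ≥ 1 and pairwise distinct subgraphs H_j; with unboundedly many repeated H_j, or n = 0, the printed bound, which does not involve |J|, cannot hold. -}

module Defs where

open import Data.Bool using (Bool; true; T; _∧_; if_then_else_)
open import Data.Bool.Properties using (T?)
open import Data.Fin using (Fin; toℕ)
import Data.Fin.Properties as Fin
open import Data.Fin.Subset using (Subset; inside; outside; _∈_; _⊆_; _∩_; ∣_∣; Nonempty; ⊤)
open import Data.Fin.Subset.Properties using (_∈?_; _⊆?_; nonempty?; x∈p∩q⁺; ∈⊤)
open import Data.Integer using (+_)
open import Data.List using (List; []; _∷_; _++_; _∷ʳ_; map; filter; length; foldr; allFin; cartesianProduct)
open import Data.List.Membership.Propositional using () renaming (_∈_ to _∈ˡ_)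
open import Data.List.Relation.Unary.All as All using (All)
open import Data.List.Relation.Unary.Linked using (Linked)
open import Data.List.Relation.Unary.Unique.Propositional using (Unique)
open import Data.Nat using (ℕ; zero; suc)
import Data.Nat as ℕ
import Data.List.Extrema.Nat as MaxNat
open import Data.Product using (∃; _×_; _,_; proj₁; proj₂)
open import Data.Rational using (ℚ; 0ℚ; _/_)
import Data.Rational as ℚ
import Data.Rational.Properties as ℚ
import Data.List.Extrema
import Data.Vec as Vec
open import Relation.Binary.Bundles using (DecTotalOrder)
open import Relation.Binary.Construct.Closure.ReflexiveTransitive using (Star)
open import Relation.Binary.PropositionalEquality using (_≡_; _≢_)
open import Relation.Nullary using (¬_; Dec; yes; does; ¬?; _×-dec_; _→-dec_)

module MaxRat = Data.List.Extrema (DecTotalOrder.totalOrder ℚ.≤-decTotalOrder)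

subsets : ∀ n → List (Subset n)
subsets zero    = Vec.[] ∷ []
subsets (suc n) = map (inside Vec.∷_) (subsets n) ++ map (outside Vec.∷_) (subsets n)

elements : ∀ {n} → Subset n → List (Fin n)
elements {n} S = filter (_∈? S) (allFin n)

maxOver : ∀ {m} → (Fin m → ℕ) → ℕ
maxOver {m} g = MaxNat.max 0 (map g (allFin m))

record Graph (n : ℕ) : Set where
  field
    adj    : Fin n → Fin n → Bool
    sym    : ∀ {u v} → T (adj u v) → T (adj v u)
    irrefl : ∀ {u} → ¬ T (adj u u)

  Adj : Fin n → Fin n → Set
  Adj u v = T (adj u v)

record Subgraph {n : ℕ} (G : Graph n) : Set where
  field
    V     : Subset n
    edge  : Fin n → Fin n → Bool
    sym   : ∀ {u v} → T (edge u v) → T (edge v u)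
    ends  : ∀ {u v} → T (edge u v) → u ∈ V × v ∈ V
    sub   : ∀ {u v} → T (edge u v) → Graph.Adj G u v

  Edge : Fin n → Fin n → Set
  Edge u v = T (edge u v)

open Subgraph using (V; edge; Edge)

private
  T-∧ : ∀ {a b} → T (a ∧ b) → T a × T b
  T-∧ {true} {true} _ = _ , _

  T-does : ∀ {A : Set} (a? : Dec A) → T (does a?) → A
  T-does (yes a) _ = a

  ∧-T : ∀ {a b} → T a → T b → T (a ∧ b)
  ∧-T {true} {true} _ _ = _

module _ {n : ℕ} {G : Graph n} where

  infixl 8 _↾_
  infix 4 _≐_

  -- The subgraph of H induced by X ∩ V(H).
  _↾_ : Subgraph G → Subset n → Subgraph G
  H ↾ X = record
    { V    = V H ∩ X
    ; edge = λ u v → edge H u v ∧ (does (u ∈? X) ∧ does (v ∈? X))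
    ; sym  = λ {u} {v} e →
        let (e′ , uv) = T-∧ e ; (u∈ , v∈) = T-∧ {does (u ∈? X)} uv
        in ∧-T (Subgraph.sym H e′) (∧-T v∈ u∈)
    ; ends = λ {u} {v} e →
        let (e′ , uv) = T-∧ e ; (u∈ , v∈) = T-∧ {does (u ∈? X)} uv
            (a , b) = Subgraph.ends H e′
        in x∈p∩q⁺ (a , T-does (u ∈? X) u∈) , x∈p∩q⁺ (b , T-does (v ∈? X) v∈)
    ; sub  = λ e → Subgraph.sub H (proj₁ (T-∧ e))
    }

  Connected : Subgraph G → Set
  Connected H = ∀ {u v} → u ∈ V H → v ∈ V H → Star (Edge H) u v

  NonNull : Subgraph G → Set
  NonNull H = Nonempty (V H)

  order : Subgraph G → ℕ
  order H = ∣ V H ∣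

  _≐_ : Subgraph G → Subgraph G → Set
  H ≐ K = V H ≡ V K × (∀ u v → edge H u v ≡ edge K u v)

  IsIndependentSet : Subgraph G → Subset n → Set
  IsIndependentSet H S = S ⊆ V H × (∀ u → u ∈ S → ∀ v → v ∈ S → ¬ Edge H u v)

  isIndependentSet? : ∀ H S → Dec (IsIndependentSet H S)
  isIndependentSet? H S =
    (S ⊆? V H) ×-dec Fin.all? (λ u → (u ∈? S) →-dec
      Fin.all? (λ v → (v ∈? S) →-dec ¬? (T? (edge H u v))))

  -- The default value 0 is attained by the empty set.
  α : Subgraph G → ℕ
  α H = MaxNat.max 0 (map ∣_∣ (filter (isIndependentSet? H) (subsets n)))

whole : ∀ {n} (G : Graph n) → Subgraph G
whole G = record
  { V = ⊤ ; edge = Graph.adj G ; sym = Graph.sym G ; ends = λ _ → ∈⊤ , ∈⊤ ; sub = λ e → e }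

induced : ∀ {n} (G : Graph n) → Subset n → Subgraph G
induced G X = whole G ↾ X

-- The cycle x, y, …, z, x is given by x and the list y, …, z.
IsCycle : ∀ {n} → Graph n → Fin n → List (Fin n) → Set
IsCycle G x ys = 2 ℕ.≤ length ys × Unique (x ∷ ys) × Linked (Graph.Adj G) (x ∷ ys ∷ʳ x)

record IsTree {n : ℕ} (G : Graph n) : Set where
  field
    nonNull   : NonNull (whole G)
    connected : Connected (whole G)
    acyclic   : ∀ x ys → ¬ IsCycle G x ys

record TreeDecomposition {n : ℕ} {G : Graph n} (H : Subgraph G) : Set where
  field
    size   : ℕ
    tree   : Graph size
    isTree : IsTree tree
    bag    : Fin size → Subset n
    bag⊆   : ∀ t → bag t ⊆ V H

  nodesOf : Fin n → Subset size
  nodesOf u = Vec.tabulate (λ t → does (u ∈? bag t))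

  field
    vertexCover : ∀ {u} → u ∈ V H → ∃ λ t → u ∈ bag t
    edgeCover   : ∀ {u v} → Edge H u v → ∃ λ t → u ∈ bag t × v ∈ bag t
    subtree     : ∀ {u} → u ∈ V H → Connected (induced tree (nodesOf u))

open TreeDecomposition using (size; tree; bag)

αᵀ : ∀ {n} {G : Graph n} {H : Subgraph G} → TreeDecomposition H → ℕ
αᵀ {H = H} 𝒯 = maxOver (λ t → α (H ↾ bag 𝒯 t))

-- A multiset of subsets is an indexed family; repetitions are allowed.
IsGeneralCover : ∀ {n m} → ℚ → (Fin m → Subset n) → Set
IsGeneralCover {n} {m} β C =
  ∀ (v : Fin n) → β ℚ.* (+ m / 1) ℚ.≤ + length (filter (λ i → v ∈? C i) (allFin m)) / 1

module _ {n q : ℕ} {G : Graph n} (H : Fin q → Subgraph G) where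

  Distinct : Set
  Distinct = ∀ i j → H i ≐ H j → i ≡ j

  VertexDisjoint : Fin q → Fin q → Set
  VertexDisjoint i j = ¬ Nonempty (V (H i) ∩ V (H j))

  NoEdgeBetween : Fin q → Fin q → Set
  NoEdgeBetween i j = ∀ u → u ∈ V (H i) → ∀ v → v ∈ V (H j) → ¬ Graph.Adj G u v

  IsIndependentPacking : Subset q → Set
  IsIndependentPacking I =
    ∀ i → i ∈ I → ∀ j → j ∈ I → i ≢ j → VertexDisjoint i j × NoEdgeBetween i j

  isIndependentPacking? : ∀ I → Dec (IsIndependentPacking I)
  isIndependentPacking? I =
    Fin.all? (λ i → (i ∈? I) →-dec Fin.all? (λ j → (j ∈? I) →-dec ((¬? (i Fin.≟ j)) →-dec
      (¬? (nonempty? (V (H i) ∩ V (H j))) ×-dec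
       Fin.all? (λ u → (u ∈? V (H i)) →-dec Fin.all? (λ v → (v ∈? V (H j)) →-dec
         ¬? (T? (Graph.adj G u v))))))))

weight : ∀ {q} → (Fin q → ℚ) → Subset q → ℚ
weight w I = foldr ℚ._+_ 0ℚ (map w (elements I))

-- The default value 0 is the weight of the empty packing.
maxPackingWeight : ∀ {n q} {G : Graph n} → (Fin q → Subgraph G) → (Fin q → ℚ) → ℚ
maxPackingWeight {q = q} H w =
  MaxRat.max 0ℚ (map (weight w) (filter (isIndependentPacking? H) (subsets q)))

-- Algorithms are closed programs of a typed call-by-value λ-calculus with
-- lists, immutable arrays and bounded iteration, and time is the number of
-- evaluation steps.  Every step takes constant time on a unit-cost random
-- access machine (an environment machine with heap-allocated closures, lists
-- and arrays), so a time bound here is also one, up to a constant factor, on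
-- such a machine.  As usual for weighted problems, rational weights are only
-- added and compared, at unit cost.  There is no unit-cost multiplication.

infixr 6 _⊗_
infixr 5 _⇒_

data Ty : Set where
  bool nat rat : Ty
  _⊗_ _⇒_      : Ty → Ty → Ty
  list arr     : Ty → Ty

Timed : Set → Set
Timed A = A × ℕ

⟦_⟧ : Ty → Set
⟦ bool ⟧   = Bool
⟦ nat ⟧    = ℕ
⟦ rat ⟧    = ℚ
⟦ A ⊗ B ⟧  = ⟦ A ⟧ × ⟦ B ⟧
⟦ A ⇒ B ⟧  = ⟦ A ⟧ → Timed ⟦ B ⟧
⟦ list A ⟧ = List ⟦ A ⟧
⟦ arr A ⟧  = List ⟦ A ⟧

infixl 7 _·_

-- De Bruijn variables: binders extend the context on the left.
data Tm (Γ : List Ty) : Ty → Set where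
  var      : ∀ {A} → A ∈ˡ Γ → Tm Γ A
  lam      : ∀ {A B} → Tm (A ∷ Γ) B → Tm Γ (A ⇒ B)
  _·_      : ∀ {A B} → Tm Γ (A ⇒ B) → Tm Γ A → Tm Γ B
  let′     : ∀ {A B} → Tm Γ A → Tm (A ∷ Γ) B → Tm Γ B
  boolLit  : Bool → Tm Γ bool
  if′      : ∀ {A} → Tm Γ bool → Tm Γ A → Tm Γ A → Tm Γ A
  natLit   : ℕ → Tm Γ nat
  add sub  : Tm Γ nat → Tm Γ nat → Tm Γ nat
  leq      : Tm Γ nat → Tm Γ nat → Tm Γ bool
  iter     : ∀ {A} → Tm Γ nat → Tm Γ A → Tm (A ∷ Γ) A → Tm Γ A
  ratLit   : ℚ → Tm Γ rat
  addℚ     : Tm Γ rat → Tm Γ rat → Tm Γ rat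
  leqℚ     : Tm Γ rat → Tm Γ rat → Tm Γ bool
  pair     : ∀ {A B} → Tm Γ A → Tm Γ B → Tm Γ (A ⊗ B)
  fst      : ∀ {A B} → Tm Γ (A ⊗ B) → Tm Γ A
  snd      : ∀ {A B} → Tm Γ (A ⊗ B) → Tm Γ B
  nil      : ∀ {A} → Tm Γ (list A)
  cons     : ∀ {A} → Tm Γ A → Tm Γ (list A) → Tm Γ (list A)
  caseList : ∀ {A B} → Tm Γ (list A) → Tm Γ B → Tm (A ∷ list A ∷ Γ) B → Tm Γ B
  foldList : ∀ {A B} → Tm Γ (list A) → Tm Γ B → Tm (A ∷ B ∷ Γ) B → Tm Γ B
  array    : ∀ {A} → Tm Γ (list A) → Tm Γ (arr A)
  size′    : ∀ {A} → Tm Γ (arr A) → Tm Γ nat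
  index    : ∀ {A} → Tm Γ (arr A) → Tm Γ nat → Tm Γ A → Tm Γ A

infixl 1 _>>=_

return : ∀ {A : Set} → A → Timed A
return a = a , 0

_>>=_ : ∀ {A B : Set} → Timed A → (A → Timed B) → Timed B
m >>= k = proj₁ (k (proj₁ m)) , proj₂ m ℕ.+ proj₂ (k (proj₁ m))

step : ∀ {A : Set} → Timed A → Timed A
step m = proj₁ m , suc (proj₂ m)

iterateᵀ : ∀ {A : Set} → (A → Timed A) → ℕ → A → Timed A
iterateᵀ s zero    a = return a
iterateᵀ s (suc n) a = s a >>= iterateᵀ s n

foldrᵀ : ∀ {A B : Set} → (A → B → Timed B) → B → List A → Timed B
foldrᵀ s b []       = return b
foldrᵀ s b (x ∷ xs) = foldrᵀ s b xs >>= s x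

nth : ∀ {A : Set} → List A → ℕ → A → A
nth []       _       d = d
nth (x ∷ _)  zero    d = x
nth (_ ∷ xs) (suc i) d = nth xs i d

matchList : ∀ {A B : Set} → List A → B → (A → List A → B) → B
matchList []       b _ = b
matchList (x ∷ xs) _ k = k x xs

-- Every evaluated node of the syntax tree costs one step, once per
-- evaluation; `array` costs in addition the length of the list it copies.
-- An index out of range yields the default value, the last argument.
eval : ∀ {Γ A} → Tm Γ A → All ⟦_⟧ Γ → Timed ⟦ A ⟧
eval (var x) ρ          = step (return (All.lookup ρ x))
eval (lam t) ρ          = step (return (λ a → eval t (a All.∷ ρ)))
eval (t · u) ρ          = step (eval t ρ >>= λ f → eval u ρ >>= f)
eval (let′ t u) ρ       = step (eval t ρ >>= λ a → eval u (a All.∷ ρ))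
eval (boolLit b) ρ      = step (return b)
eval (if′ b t u) ρ      = step (eval b ρ >>= λ c → if c then eval t ρ else eval u ρ)
eval (natLit k) ρ       = step (return k)
eval (add t u) ρ        = step (eval t ρ >>= λ a → eval u ρ >>= λ b → return (a ℕ.+ b))
eval (sub t u) ρ        = step (eval t ρ >>= λ a → eval u ρ >>= λ b → return (a ℕ.∸ b))
eval (leq t u) ρ        = step (eval t ρ >>= λ a → eval u ρ >>= λ b → return (a ℕ.≤ᵇ b))
eval (iter k t s) ρ     = step (eval k ρ >>= λ n → eval t ρ >>= iterateᵀ (λ a → eval s (a All.∷ ρ)) n)
eval (ratLit p) ρ       = step (return p)
eval (addℚ t u) ρ       = step (eval t ρ >>= λ a → eval u ρ >>= λ b → return (a ℚ.+ b))
eval (leqℚ t u) ρ       = step (eval t ρ >>= λ a → eval u ρ >>= λ b → return (a ℚ.≤ᵇ b))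
eval (pair t u) ρ       = step (eval t ρ >>= λ a → eval u ρ >>= λ b → return (a , b))
eval (fst t) ρ          = step (eval t ρ >>= λ p → return (proj₁ p))
eval (snd t) ρ          = step (eval t ρ >>= λ p → return (proj₂ p))
eval nil ρ              = step (return [])
eval (cons t u) ρ       = step (eval t ρ >>= λ a → eval u ρ >>= λ as → return (a ∷ as))
eval (caseList t b u) ρ = step (eval t ρ >>= λ xs →
                            matchList xs (eval b ρ) (λ a as → eval u (a All.∷ as All.∷ ρ)))
eval (foldList t b s) ρ = step (eval t ρ >>= λ xs → eval b ρ >>= λ z →
                            foldrᵀ (λ a c → eval s (a All.∷ c All.∷ ρ)) z xs)
eval (array t) ρ        = step (eval t ρ >>= λ xs → xs , length xs)
eval (size′ t) ρ        = step (eval t ρ >>= λ xs → return (length xs))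
eval (index t i d) ρ    = step (eval t ρ >>= λ xs → eval i ρ >>= λ k → eval d ρ >>= λ e →
                            return (nth xs k e))

Program : Ty → Ty → Set
Program A B = Tm (A ∷ []) B

run : ∀ {A B} → Program A B → ⟦ A ⟧ → Timed ⟦ B ⟧
run P a = eval P (a All.∷ All.[])

output : ∀ {A B} → Program A B → ⟦ A ⟧ → ⟦ B ⟧
output P a = proj₁ (run P a)

time : ∀ {A B} → Program A B → ⟦ A ⟧ → ℕ
time P a = proj₂ (run P a)

-- All inputs are first-order data.  Vertices, nodes and indices are numbers
-- counted from 0.  Subsets are bit vectors, G is an adjacency matrix, the
-- trees are adjacency lists (a matrix would not be readable in time linear in
-- the number of nodes), and each H_j is the list of its vertices and the list
-- of its edges, every edge being listed in both orientations.

SetTy CoverTy MemberTy InputTy OutputTy : Ty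
SetTy    = arr bool
CoverTy  = SetTy ⊗ arr (list nat) ⊗ arr SetTy
MemberTy = list nat ⊗ list (nat ⊗ nat) ⊗ rat
InputTy  = nat ⊗ arr (arr bool) ⊗ arr CoverTy ⊗ arr MemberTy
OutputTy = list nat

encodeSubset : ∀ {n} → Subset n → ⟦ SetTy ⟧
encodeSubset = Vec.toList

encodeMatrix : ∀ {n} → Graph n → ⟦ arr (arr bool) ⟧
encodeMatrix {n} G = map (λ u → map (Graph.adj G u) (allFin n)) (allFin n)

encodeLists : ∀ {n} → Graph n → ⟦ arr (list nat) ⟧
encodeLists {n} G =
  map (λ u → map toℕ (filter (λ v → T? (Graph.adj G u v)) (allFin n))) (allFin n)

encodeCover : ∀ {n} {G : Graph n} (C : Subset n) → TreeDecomposition (induced G C) → ⟦ CoverTy ⟧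
encodeCover C 𝒯 =
  encodeSubset C , encodeLists (tree 𝒯) , map (λ t → encodeSubset (bag 𝒯 t)) (allFin (size 𝒯))

encodeMember : ∀ {n} {G : Graph n} → Subgraph G → ℚ → ⟦ MemberTy ⟧
encodeMember {n} H w =
  map toℕ (elements (V H)) ,
  map (λ (u , v) → toℕ u , toℕ v)
    (filter (λ (u , v) → T? (edge H u v)) (cartesianProduct (allFin n) (allFin n))) ,
  w

encodeInput : ∀ {n m q} (r : ℕ) (G : Graph n) (C : Fin m → Subset n)
  (𝒯 : ∀ i → TreeDecomposition (induced G (C i))) (H : Fin q → Subgraph G) (w : Fin q → ℚ) →
  ⟦ InputTy ⟧
encodeInput {m = m} {q = q} r G C 𝒯 H w =
  r , encodeMatrix G ,
  map (λ i → encodeCover (C i) (𝒯 i)) (allFin m) ,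
  map (λ j → encodeMember (H j) (w j)) (allFin q)

encodeOutput : ∀ {q} → Subset q → ⟦ OutputTy ⟧
encodeOutput I = map toℕ (elements I)

{-# OPTIONS --safe #-}

-- Let k = f(r).  For a member C of the cover, call two of the subgraphs H_j ⊆ G[C] compatible if they
-- are disjoint and not joined by an edge.  The H_j meeting a given bag and pairwise compatible yield an
-- independent set of that bag, so at most k of them fit together; and since each H_j is connected, the
-- nodes whose bags it meets form a subtree, and incompatible subgraphs meet a common bag.  A heaviest
-- packing in G[C] is therefore found by dynamic programming over the tree: the table of a node maps the
-- chosen subgraphs meeting both its bag and the bag of its parent to a best completion below it.
--
-- A table is a trie, built as a closure while the sets of compatible subgraphs meeting the bag are
-- enumerated; a lookup walks through the O(n^h) subgraphs in order.  With q = O(n^h) distinct subgraphs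
-- the number of these sets is at most Σ_{i ≤ k} (q choose i) ≤ x^k (1 + 1/x)^q with x = n^h, which is
-- O(x^k) with a constant that depends on h only.  So every node costs O(x · x^k) per tree edge.
--
-- A vertex is missed by at most |𝒞|/r members of the cover, so H_j by at most h |𝒞|/r.  Averaging over
-- the cover, some G[C] contains a (1 - h/r) fraction of the weight of an optimal packing.

module Submission where

open import Data.Bool using (Bool; true; false; T; _∧_; if_then_else_; not)
open import Data.Bool.Properties using (T?; T-∧)
open import Data.Empty using (⊥-elim; ⊥)
import Data.Fin.Properties as Fin
open import Data.List using (List; []; _∷_; length; lookup; foldr; map; filterᵇ; _++_; upTo; applyUpTo; allFin;
      tabulate; _∷ʳ_; filter)
import Data.List.Extrema.Nat as MaxNat
open import Data.List.Membership.Propositional using (_∈_; _∉_; find; lose)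
open import Data.List.Relation.Unary.All as All using (All; []; _∷_)
import Data.List.Relation.Unary.All.Properties as All
open import Data.List.Relation.Unary.AllPairs as AllPairs using (AllPairs; []; _∷_)
import Data.List.Relation.Unary.AllPairs.Properties as AllPairs
open import Data.List.Relation.Unary.Any as Any using (here; there; Any)
import Data.List.Relation.Unary.Any.Properties as Any
open import Data.List.Relation.Unary.Unique.Propositional using (Unique)
import Data.List.Relation.Unary.Unique.Propositional.Properties as Unique
open import Data.Product using (_×_; _,_; proj₁; proj₂; ∃; Σ-syntax)
open import Data.Sum using (_⊎_; inj₁; inj₂; [_,_]′)
open import Defs
open import Function using (_∘_; id; Equivalence)
open import Relation.Binary.PropositionalEquality hiding (J)
open import Relation.Nullary using (¬_; yes; no; ¬?; Dec; contradiction; does; _×-dec_)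

-- The exponent `h (f(r) + 1)` leaves no room, and the constant may depend on `h` only. This forces
-- care in three places. With q ≤ c x, the estimate q^k would bring in a factor c^k that depends on
-- `f(r)`; the counting through (1 + 1/x)^(c x) ≤ 8^c avoids it. At a node, the members meeting the
-- parent's bag and the others are enumerated one after the other, so the two enumerations must
-- share one budget k and one list of length q. And a node with d children costs d + 1 units, so
-- linearity in the number of nodes needs amortisation: every subtree saves a credit that pays for
-- its edge to the parent. There is no mutable memory and no unit-cost multiplication, so a table is
-- not an array indexed by the rank of a set. A closure branching on the bits of the query replaces
-- it; its lookup time O(q) is no more than the price of setting up one state. The compatibility
-- matrix costs q^2. It fits below x^(k + 1) because k ≥ 1 once h ≥ 1: then r ≥ 2, so each vertex
-- lies in some element of the cover, and a bag containing a vertex has independence number at least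
-- 1.

-- The algorithm as a program.

module Programs where
  open import Data.Fin using (Fin; #_)
  open import Data.List.Membership.Propositional.Properties using (∈-lookup)
  open import Data.Rational using (0ℚ)

  Env : List Ty → Set
  Env = All ⟦_⟧

  `_ : ∀ {Γ} (i : Fin (length Γ)) → Tm Γ (lookup Γ i)
  `_ {Γ} i = var (∈-lookup i)

  infix 9 `_

  -- A state records for every member whether it is chosen and whether it is compatible with all chosen
  -- members; a value is a packing with its weight; a table is looked up with the state of the parent node.
  MatTy StTy ValTy TabTy : Ty
  MatTy = arr (arr bool)
  StTy  = arr (bool ⊗ bool)
  ValTy = rat ⊗ list nat
  TabTy = StTy ⇒ ValTy

  noMember : ∀ {Γ} → Tm Γ MemberTy
  noMember = pair nil (pair nil (ratLit 0ℚ))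

  noCover : ∀ {Γ} → Tm Γ CoverTy
  noCover = pair (array nil) (pair (array nil) (array nil))

  noVal : ∀ {Γ} → Tm Γ ValTy
  noVal = pair (ratLit 0ℚ) nil

  noSt : ∀ {Γ} → Tm Γ (bool ⊗ bool)
  noSt = pair (boolLit false) (boolLit false)

  -- The counter runs downwards, so that `cons` leaves the list in ascending order.
  upToT : ∀ {Γ} → Tm (nat ∷ Γ) (list nat)
  upToT = snd (iter (` # 0) (pair (` # 0) nil)
    (let′ (sub (fst (` # 0)) (natLit 1)) (pair (` # 0) (cons (` # 0) (snd (` # 1))))))

  eqT : ∀ {Γ} → Tm (nat ∷ nat ∷ Γ) bool
  eqT = if′ (leq (` # 0) (` # 1)) (leq (` # 1) (` # 0)) (boolLit false)

  meetsT insideT : ∀ {Γ} → Tm (SetTy ∷ list nat ∷ Γ) bool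
  meetsT = foldList (` # 1) (boolLit false)
    (if′ (index (` # 2) (` # 0) (boolLit false)) (boolLit true) (` # 1))
  insideT = foldList (` # 1) (boolLit true)
    (if′ (index (` # 2) (` # 0) (boolLit false)) (` # 1) (boolLit false))

  apartT : ∀ {Γ} → Tm (list nat ∷ list nat ∷ MatTy ∷ Γ) bool
  apartT = foldList (` # 1) (boolLit true) (foldList (` # 2) (` # 1)
    (if′ (let′ (` # 0) (let′ (` # 3) eqT)) (boolLit false)
      (if′ (index (index (` # 6) (` # 2) (array nil)) (` # 0) (boolLit false))
        (boolLit false) (` # 1))))

  rowT : ∀ {Γ A} → Tm (nat ∷ A ∷ list nat ∷ arr MemberTy ∷ InputTy ∷ Γ) (list bool)
  rowT = foldList (` # 2) nil (cons
    (let′ (fst (snd (` # 6)))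
      (let′ (fst (index (` # 6) (` # 3) noMember))
        (let′ (fst (index (` # 7) (` # 2) noMember)) apartT)))
    (` # 1))

  matT : ∀ {Γ} → Tm (list nat ∷ arr MemberTy ∷ InputTy ∷ Γ) MatTy
  matT = array (foldList (` # 0) nil (cons (array rowT) (` # 1)))

  -- From the left, `ΓC` holds the current element of the cover, its index, the best packing so far,
  -- the compatibility matrix, the indices of all members, the members and the input. `Γ₀` adds the
  -- members inside the current element, the function computing tables of smaller depth, and the
  -- pair of node and parent. `Γ₂` adds the tables of the children, the bag of the node and,
  -- leftmost, the bag of the parent; `Γ₃` adds the lists `jsT` and, leftmost, `ksT`.
  ΓC Γ₀ Γ₂ Γ₃ : List Ty
  ΓC = CoverTy ∷ nat ∷ ValTy ∷ MatTy ∷ list nat ∷ arr MemberTy ∷ InputTy ∷ []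
  Γ₀ = (nat ⊗ nat) ∷ (nat ⊗ nat ⇒ TabTy) ∷ list nat ∷ ΓC
  Γ₂ = SetTy ∷ SetTy ∷ list TabTy ∷ Γ₀
  Γ₃ = list nat ∷ list nat ∷ Γ₂

  isParentT : Tm (nat ∷ list TabTy ∷ Γ₀) bool
  isParentT = let′ (` # 0) (let′ (snd (` # 3)) eqT)

  kidT : Tm (nat ∷ list TabTy ∷ Γ₀) (list TabTy)
  kidT = if′ isParentT (` # 1)
    (cons ((` # 3) · pair (` # 0) (fst (` # 2))) (` # 1))

  kidsT : Tm Γ₀ (list TabTy)
  kidsT = foldList (index (fst (snd (` # 3))) (fst (` # 0)) nil) nil kidT

  -- The members meeting the bag and the parent's bag, and below those meeting only the bag.
  jsT : Tm Γ₂ (list nat)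
  jsT = foldList (` # 5) nil
    (if′ (let′ (fst (index (` # 13) (` # 0) noMember)) (let′ (` # 4) meetsT))
      (if′ (let′ (fst (index (` # 13) (` # 0) noMember)) (let′ (` # 3) meetsT))
        (cons (` # 0) (` # 1)) (` # 1))
      (` # 1))

  ksT : Tm (list nat ∷ Γ₂) (list nat)
  ksT = foldList (` # 6) nil
    (if′ (let′ (fst (index (` # 14) (` # 0) noMember)) (let′ (` # 5) meetsT))
      (if′ (let′ (fst (index (` # 14) (` # 0) noMember)) (let′ (` # 4) meetsT))
        (` # 1) (cons (` # 0) (` # 1)))
      (` # 1))

  joinT : Tm (TabTy ∷ ValTy ∷ StTy ∷ Γ₃) ValTy
  joinT = let′ ((` # 0) · (` # 2))
    (pair (addℚ (fst (` # 0)) (fst (` # 2)))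
      (foldList (snd (` # 0)) (snd (` # 2)) (cons (` # 0) (` # 1))))

  leafT : Tm Γ₃ TabTy
  leafT = lam (foldList (` # 5) noVal joinT)

  module _ {R : Ty} where
    Γₑ : List Ty
    Γₑ = R ∷ StTy ∷ nat ∷ (StTy ⇒ R) ∷ Γ₃

    addT : Tm Γₑ StTy
    addT = array (foldList (` # 16) nil (cons
      (pair (if′ (let′ (` # 0) (let′ (` # 5) eqT)) (boolLit true) (fst (index (` # 3) (` # 0) noSt)))
        (if′ (index (index (` # 17) (` # 4) (array nil)) (` # 0) (boolLit false))
          (snd (index (` # 3) (` # 0) noSt)) (boolLit false)))
      (` # 1)))

    -- The fold over the members builds a function of the state: states are passed down while
    -- results are combined on the way up. A member that is not allowed causes no second call, so
    -- only independent sets are ever generated.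
    branchT : Tm (R ∷ Γₑ) R → Tm (StTy ∷ nat ∷ (StTy ⇒ R) ∷ Γ₃) R
    branchT combine = let′ ((` # 2) · (` # 0))
      (if′ (snd (index (` # 1) (` # 2) noSt)) (let′ ((` # 3) · addT) combine) (` # 0))

  trieT : Tm (TabTy ∷ Γₑ {TabTy}) TabTy
  trieT = lam (if′ (fst (index (` # 0) (` # 4) noSt)) ((` # 1) · (` # 0)) ((` # 2) · (` # 0)))

  bestT : Tm (ValTy ∷ Γₑ {ValTy}) ValTy
  bestT = let′ (pair (addℚ (snd (snd (index (` # 18) (` # 3) noMember))) (fst (` # 0)))
                     (cons (` # 3) (snd (` # 0))))
    (if′ (leqℚ (fst (` # 2)) (fst (` # 0))) (` # 0) (` # 2))

  extendT : Tm Γ₃ TabTy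
  extendT = foldList (` # 0) leafT (lam (branchT bestT))

  -- The strict `let′` computes the best extension once, while the table is being built, and the
  -- closure returned merely holds the result. Otherwise every lookup would repeat the enumeration
  -- of the extensions.
  holdT : Tm (StTy ∷ TabTy ∷ Γ₃) TabTy
  holdT = let′ ((` # 1) · (` # 0)) (lam (` # 1))

  constT : Tm Γ₃ (StTy ⇒ TabTy)
  constT = let′ extendT (lam holdT)

  interfaceT : Tm Γ₃ (StTy ⇒ TabTy)
  interfaceT = foldList (` # 1) constT (lam (branchT trieT))

  initT : Tm Γ₃ StTy
  initT = array (foldList (` # 12) nil (cons (pair (boolLit false) (boolLit true)) (` # 1)))

  tableT : Tm (list TabTy ∷ Γ₀) TabTy
  tableT =
    let′ (index (snd (snd (` # 4))) (fst (` # 1)) (array nil))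
    (let′ (index (snd (snd (` # 5))) (snd (` # 2)) (array nil))
    (let′ jsT
    (let′ ksT
    (interfaceT · initT))))

  membersT : Tm ΓC (list nat)
  membersT = foldList (` # 4) nil
    (if′ (let′ (fst (index (` # 7) (` # 0) noMember)) (let′ (fst (` # 3)) insideT))
      (cons (` # 0) (` # 1)) (` # 1))

  -- There is no recursion: solveT iterates the step from the tables of depth k to those of depth k + 1.
  -- The parent of the root 0 is given as the number of nodes, an index out of range whose bag is empty.
  startT : Tm (list nat ∷ ΓC) (nat ⊗ nat ⇒ TabTy)
  startT = lam (lam noVal)

  solveT : Tm ΓC ValTy
  solveT =
    let′ membersT
    (let′ (iter (size′ (fst (snd (` # 1)))) startT (lam (let′ kidsT tableT)))
    (((` # 0) · pair (natLit 0) (size′ (fst (snd (` # 2))))) · array nil))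

  -- The solver is a parameter, because the loop over the cover is analysed for an arbitrary term
  -- with a known result and cost.
  improveT : Tm ΓC ValTy → Tm (nat ∷ ValTy ∷ MatTy ∷ list nat ∷ arr MemberTy ∷ InputTy ∷ []) ValTy
  improveT solve =
    let′ (index (fst (snd (snd (` # 5)))) (` # 0) noCover)
    (let′ solve
    (if′ (leqℚ (fst (` # 3)) (fst (` # 0))) (` # 0) (` # 3)))

  searchT : Tm ΓC ValTy → Program InputTy OutputTy
  searchT solve =
    let′ (snd (snd (snd (` # 0))))
    (let′ (let′ (size′ (` # 0)) upToT)
    (let′ matT
    (snd (foldList (let′ (size′ (fst (snd (snd (` # 3))))) upToT) noVal (improveT solve)))))

-- A calculus for the step counts and values of terms.

module CostCalculus where
  open Programs
  open import Data.Nat using (ℕ; zero; suc; _+_; _*_; _≤_; z≤n; s≤s; _≤ᵇ_)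
  open import Data.Nat.Properties

  -- Straight-line terms, whose cost is bounded independently of the environment.
  flat : ∀ {Γ A} → Tm Γ A → Bool
  flat (var x)      = true
  flat (lam t)      = true
  flat (let′ t u)   = flat t ∧ flat u
  flat (boolLit b)  = true
  flat (if′ b t u)  = flat b ∧ flat t ∧ flat u
  flat (natLit k)   = true
  flat (add t u)    = flat t ∧ flat u
  flat (sub t u)    = flat t ∧ flat u
  flat (leq t u)    = flat t ∧ flat u
  flat (ratLit p)   = true
  flat (addℚ t u)   = flat t ∧ flat u
  flat (leqℚ t u)   = flat t ∧ flat u
  flat (pair t u)   = flat t ∧ flat u
  flat (fst t)      = flat t
  flat (snd t)      = flat t
  flat nil          = true
  flat (cons t u)   = flat t ∧ flat u
  flat (array nil)  = true
  flat (size′ t)    = flat t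
  flat (index t i d) = flat t ∧ flat i ∧ flat d
  flat _            = false

  flatCost : ∀ {Γ A} → Tm Γ A → ℕ
  flatCost (let′ t u)    = suc (flatCost t + flatCost u)
  flatCost (if′ b t u)   = suc (flatCost b + (flatCost t + flatCost u))
  flatCost (add t u)     = suc (flatCost t + flatCost u)
  flatCost (sub t u)     = suc (flatCost t + flatCost u)
  flatCost (leq t u)     = suc (flatCost t + flatCost u)
  flatCost (addℚ t u)    = suc (flatCost t + flatCost u)
  flatCost (leqℚ t u)    = suc (flatCost t + flatCost u)
  flatCost (pair t u)    = suc (flatCost t + flatCost u)
  flatCost (fst t)       = suc (flatCost t)
  flatCost (snd t)       = suc (flatCost t)
  flatCost (cons t u)    = suc (flatCost t + flatCost u)
  flatCost (array t)     = 2
  flatCost (size′ t)     = suc (flatCost t)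
  flatCost (index t i d) = suc (flatCost t + (flatCost i + flatCost d))
  flatCost _             = 1

  private
    ∧ˡ : ∀ {a b} → T (a ∧ b) → T a
    ∧ˡ {true} _ = _

    ∧ʳ : ∀ {a b} → T (a ∧ b) → T b
    ∧ʳ {true} p = p

    +-mono-≤0 : ∀ {a b c d} → a ≤ c → b ≤ d → a + (b + 0) ≤ c + d
    +-mono-≤0 {b = b} p q rewrite +-identityʳ b = +-mono-≤ p q

    suc≤ : ∀ {a b} → a ≤ b → suc (a + 0) ≤ suc b
    suc≤ {a} p rewrite +-identityʳ a = s≤s p

  flatCost-sound : ∀ {Γ A} (t : Tm Γ A) (ρ : Env Γ) → T (flat t) → proj₂ (eval t ρ) ≤ flatCost t
  flatCost-sound (var x) ρ p     = ≤-refl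
  flatCost-sound (lam t) ρ p     = ≤-refl
  flatCost-sound (let′ t u) ρ p  =
    s≤s (+-mono-≤ (flatCost-sound t ρ (∧ˡ p)) (flatCost-sound u _ (∧ʳ {flat t} p)))
  flatCost-sound (boolLit b) ρ p = ≤-refl
  flatCost-sound (if′ b t u) ρ p with proj₁ (eval b ρ)
  ... | true  = s≤s (+-mono-≤ (flatCost-sound b ρ (∧ˡ p))
                  (≤-trans (flatCost-sound t ρ (∧ˡ (∧ʳ {flat b} p))) (m≤m+n _ _)))
  ... | false = s≤s (+-mono-≤ (flatCost-sound b ρ (∧ˡ p))
                  (≤-trans (flatCost-sound u ρ (∧ʳ {flat t} (∧ʳ {flat b} p))) (m≤n+m _ _)))
  flatCost-sound (natLit k) ρ p  = ≤-refl
  flatCost-sound (add t u) ρ p   = s≤s (+-mono-≤0 (flatCost-sound t ρ (∧ˡ p)) (flatCost-sound u ρ (∧ʳ {flat t} p)))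
  flatCost-sound (sub t u) ρ p   = s≤s (+-mono-≤0 (flatCost-sound t ρ (∧ˡ p)) (flatCost-sound u ρ (∧ʳ {flat t} p)))
  flatCost-sound (leq t u) ρ p   = s≤s (+-mono-≤0 (flatCost-sound t ρ (∧ˡ p)) (flatCost-sound u ρ (∧ʳ {flat t} p)))
  flatCost-sound (ratLit q) ρ p  = ≤-refl
  flatCost-sound (addℚ t u) ρ p  = s≤s (+-mono-≤0 (flatCost-sound t ρ (∧ˡ p)) (flatCost-sound u ρ (∧ʳ {flat t} p)))
  flatCost-sound (leqℚ t u) ρ p  = s≤s (+-mono-≤0 (flatCost-sound t ρ (∧ˡ p)) (flatCost-sound u ρ (∧ʳ {flat t} p)))
  flatCost-sound (pair t u) ρ p  = s≤s (+-mono-≤0 (flatCost-sound t ρ (∧ˡ p)) (flatCost-sound u ρ (∧ʳ {flat t} p)))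
  flatCost-sound (fst t) ρ p     = suc≤ (flatCost-sound t ρ p)
  flatCost-sound (snd t) ρ p     = suc≤ (flatCost-sound t ρ p)
  flatCost-sound nil ρ p         = ≤-refl
  flatCost-sound (cons t u) ρ p  = s≤s (+-mono-≤0 (flatCost-sound t ρ (∧ˡ p)) (flatCost-sound u ρ (∧ʳ {flat t} p)))
  flatCost-sound (array nil) ρ p = ≤-refl
  flatCost-sound (size′ t) ρ p   = suc≤ (flatCost-sound t ρ p)
  flatCost-sound (index t i d) ρ p =
    s≤s (+-mono-≤ (flatCost-sound t ρ (∧ˡ p))
      (+-mono-≤0 (flatCost-sound i ρ (∧ˡ (∧ʳ {flat t} p))) (flatCost-sound d ρ (∧ʳ {flat i} (∧ʳ {flat t} p)))))

  -- Evaluating t costs at most c (x + 1) steps: x is the scale and c a constant.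
  record Cost (x : ℕ) {Γ : List Ty} {A : Ty} (t : Tm Γ A) (ρ : Env Γ) (c : ℕ) : Set where
    constructor cost
    field bound : proj₂ (eval t ρ) ≤ c * suc x
  open Cost public

  c≤c*sx : ∀ c x → c ≤ c * suc x
  c≤c*sx c x = m≤m*n c (suc x)

  private
    variable
      x : ℕ
      Γ : List Ty
      A B : Ty
      ρ : Env Γ

    suc-mono : ∀ x c {m} → m ≤ c * suc x → suc m ≤ suc c * suc x
    suc-mono x c p = +-mono-≤ (s≤s z≤n) p

    +-mono : ∀ x a b {m n} → m ≤ a * suc x → n ≤ b * suc x → m + n ≤ (a + b) * suc x
    +-mono x a b {m} {n} p q = subst (m + n ≤_) (sym (*-distribʳ-+ (suc x) a b)) (+-mono-≤ p q)

    suc+-mono : ∀ x a b {m n} → m ≤ a * suc x → n ≤ b * suc x → suc (m + n) ≤ suc (a + b) * suc x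
    suc+-mono x a b p q = suc-mono x (a + b) (+-mono x a b p q)

    +0 : ∀ {m b} → m ≤ b → m + 0 ≤ b
    +0 {m} p rewrite +-identityʳ m = p

  c-flat : ∀ {t : Tm Γ A} {p : T (flat t)} → Cost x t ρ (flatCost t)
  c-flat {x = x} {ρ = ρ} {t} {p} = cost (≤-trans (flatCost-sound t ρ p) (c≤c*sx _ x))

  c-≤ : ∀ {t : Tm Γ A} {c d} {p : T (c ≤ᵇ d)} → Cost x t ρ c → Cost x t ρ d
  c-≤ {x = x} {c = c} {d} {p} (cost q) = cost (≤-trans q (*-monoˡ-≤ (suc x) (≤ᵇ⇒≤ c d p)))

  -- At scale 0 the factor `suc x` is 1, so the constant itself is a number of steps. Enumerations
  -- are counted at this scale, since the times of their recursive calls must enter with coefficient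
  -- one.
  c-rescale : ∀ {t : Tm Γ A} {c} → Cost x t ρ c → Cost 0 t ρ (c * suc x)
  c-rescale (cost q) = cost (≤-trans q (≤-reflexive (sym (*-identityʳ _))))

  c-scale : ∀ {t : Tm Γ A} {c y} → x ≤ y → Cost x t ρ c → Cost y t ρ c
  c-scale {c = c} x≤y (cost q) = cost (≤-trans q (*-monoʳ-≤ c (s≤s x≤y)))

  c-let : ∀ {t : Tm Γ A} {u : Tm (A ∷ Γ) B} {a b} →
    Cost x t ρ a → Cost x u (proj₁ (eval t ρ) All.∷ ρ) b → Cost x (let′ t u) ρ (suc (a + b))
  c-let {x = x} {a = a} {b} (cost p) (cost q) = cost (suc+-mono x a b p q)

  -- Each branch may assume the outcome of the test, so a branch known not to be taken is bounded by
  -- contradiction.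
  c-if : ∀ {b : Tm Γ bool} {t u : Tm Γ A} {c d} → Cost x b ρ c →
    (proj₁ (eval b ρ) ≡ true → Cost x t ρ d) → (proj₁ (eval b ρ) ≡ false → Cost x u ρ d) →
    Cost x (if′ b t u) ρ (suc (c + d))
  c-if {x = x} {ρ = ρ} {b = b} {t} {u} {c} {d} (cost p) onTrue onFalse = cost (suc+-mono x c d p branch)
    where
    branch : proj₂ (if proj₁ (eval b ρ) then eval t ρ else eval u ρ) ≤ d * suc x
    branch with proj₁ (eval b ρ)
    ... | true  = bound (onTrue refl)
    ... | false = bound (onFalse refl)

  c-if+ : ∀ {b : Tm Γ bool} {t u : Tm Γ A} {c d e} → Cost x b ρ c →
    Cost x t ρ d → Cost x u ρ e → Cost x (if′ b t u) ρ (suc (c + (d + e)))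
  c-if+ {x = x} {d = d} {e} p (cost q) (cost r) = c-if p
    (λ _ → cost (≤-trans q (*-monoˡ-≤ (suc x) (m≤m+n d e))))
    (λ _ → cost (≤-trans r (*-monoˡ-≤ (suc x) (m≤n+m e d))))

  c-app : ∀ {t : Tm Γ (A ⇒ B)} {u : Tm Γ A} {a b} c → Cost x t ρ a → Cost x u ρ b →
    proj₂ (proj₁ (eval t ρ) (proj₁ (eval u ρ))) ≤ c * suc x → Cost x (t · u) ρ (suc (a + (b + c)))
  c-app {x = x} {a = a} {b} c (cost p) (cost q) r =
    cost (suc+-mono x a (b + c) p (+-mono x b c q r))

  c-pair : ∀ {t : Tm Γ A} {u : Tm Γ B} {a b} →
    Cost x t ρ a → Cost x u ρ b → Cost x (pair t u) ρ (suc (a + b))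
  c-pair {x = x} {a = a} {b} (cost p) (cost q) = cost (suc+-mono x a b p (+0 q))

  c-cons : ∀ {t : Tm Γ A} {u : Tm Γ (list A)} {a b} →
    Cost x t ρ a → Cost x u ρ b → Cost x (cons t u) ρ (suc (a + b))
  c-cons {x = x} {a = a} {b} (cost p) (cost q) = cost (suc+-mono x a b p (+0 q))

  c-snd : ∀ {t : Tm Γ (A ⊗ B)} {a} → Cost x t ρ a → Cost x (snd t) ρ (suc a)
  c-snd {x = x} {a = a} (cost p) = cost (suc-mono x a (+0 p))

  c-array : ∀ {t : Tm Γ (list A)} {a} b → Cost x t ρ a →
    length (proj₁ (eval t ρ)) ≤ b * suc x → Cost x (array t) ρ (suc (a + b))
  c-array {x = x} {a = a} b (cost p) q = cost (suc+-mono x a b p q)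

  foldrᵀ-time : ∀ {A B : Set} (s : A → B → Timed B) (b : B) (xs : List A) {k} →
    (∀ {a} c → a ∈ xs → proj₂ (s a c) ≤ k) → proj₂ (foldrᵀ s b xs) ≤ length xs * k
  foldrᵀ-time s b []       p = z≤n
  foldrᵀ-time s b (a ∷ xs) {k} p = ≤-trans
    (+-mono-≤ (foldrᵀ-time s b xs (λ c a∈ → p c (there a∈))) (p _ (here refl)))
    (≤-reflexive (+-comm (length xs * k) k))

  iterateᵀ-time : ∀ {A : Set} (s : A → Timed A) n a {k} →
    (∀ a → proj₂ (s a) ≤ k) → proj₂ (iterateᵀ s n a) ≤ n * k
  iterateᵀ-time s zero    a p = z≤n
  iterateᵀ-time s (suc n) a p = +-mono-≤ (p a) (iterateᵀ-time s n _ p)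

  private
    loop-bound : ∀ l k y d x → l * suc y ≤ d * suc x → l * (k * suc y) ≤ (d * k) * suc x
    loop-bound l k y d x p = begin
      l * (k * suc y)       ≡⟨ cong (l *_) (*-comm k (suc y)) ⟩
      l * (suc y * k)       ≡⟨ *-assoc l (suc y) k ⟨
      (l * suc y) * k       ≤⟨ *-monoˡ-≤ k p ⟩
      (d * suc x) * k       ≡⟨ *-assoc d (suc x) k ⟩
      d * (suc x * k)       ≡⟨ cong (d *_) (*-comm (suc x) k) ⟩
      d * (k * suc x)       ≡⟨ *-assoc d k (suc x) ⟨
      (d * k) * suc x       ∎
      where open ≤-Reasoning

  -- The body of a loop may be bounded at a scale y of its own.
  c-fold∈ : ∀ {t : Tm Γ (list A)} {u : Tm Γ B} {s : Tm (A ∷ B ∷ Γ) B} {a b k y} d →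
    Cost x t ρ a → Cost x u ρ b →
    (∀ {e} c → e ∈ proj₁ (eval t ρ) → Cost y s (e All.∷ c All.∷ ρ) k) →
    length (proj₁ (eval t ρ)) * suc y ≤ d * suc x →
    Cost x (foldList t u s) ρ (suc (a + (b + d * k)))
  c-fold∈ {x = x} {ρ = ρ} {t = t} {u} {s} {a} {b} {k} {y} d (cost p) (cost q) r l =
    cost (suc+-mono x a (b + d * k) p (+-mono x b (d * k) q
      (≤-trans (foldrᵀ-time _ _ (proj₁ (eval t ρ)) (λ c e∈ → bound (r c e∈)))
        (loop-bound (length (proj₁ (eval t ρ))) k y d x l))))

  c-fold : ∀ {t : Tm Γ (list A)} {u : Tm Γ B} {s : Tm (A ∷ B ∷ Γ) B} {a b k y} d →
    Cost x t ρ a → Cost x u ρ b → (∀ e c → Cost y s (e All.∷ c All.∷ ρ) k) →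
    length (proj₁ (eval t ρ)) * suc y ≤ d * suc x →
    Cost x (foldList t u s) ρ (suc (a + (b + d * k)))
  c-fold d p q r = c-fold∈ d p q (λ {e} c _ → r e c)

  c-iter : ∀ {t : Tm Γ nat} {u : Tm Γ A} {s : Tm (A ∷ Γ) A} {a b k y} d →
    Cost x t ρ a → Cost x u ρ b → (∀ e → Cost y s (e All.∷ ρ) k) →
    proj₁ (eval t ρ) * suc y ≤ d * suc x →
    Cost x (iter t u s) ρ (suc (a + (b + d * k)))
  c-iter {x = x} {ρ = ρ} {t = t} {u} {s} {a} {b} {k} {y} d (cost p) (cost q) r l =
    cost (suc+-mono x a (b + d * k) p (+-mono x b (d * k) q
      (≤-trans (iterateᵀ-time _ (proj₁ (eval t ρ)) _ (λ e → bound (r e)))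
        (loop-bound (proj₁ (eval t ρ)) k y d x l))))

  record Val {Γ : List Ty} {A : Ty} (t : Tm Γ A) (ρ : Env Γ) (v : ⟦ A ⟧) : Set where
    constructor val
    field value : proj₁ (eval t ρ) ≡ v
  open Val public

  if-proj₁ : ∀ {A B : Set} b {m n : A × B} →
    proj₁ (if b then m else n) ≡ (if b then proj₁ m else proj₁ n)
  if-proj₁ true  = refl
  if-proj₁ false = refl

  c-let≡ : ∀ {t : Tm Γ A} {u : Tm (A ∷ Γ) B} {y a b} →
    Val t ρ y → Cost x t ρ a → Cost x u (y All.∷ ρ) b → Cost x (let′ t u) ρ (suc (a + b))
  c-let≡ (val refl) = c-let

  c-fold≡ : ∀ {t : Tm Γ (list A)} {u : Tm Γ B} {s : Tm (A ∷ B ∷ Γ) B} {xs a b k y} d →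
    Val t ρ xs → Cost x t ρ a → Cost x u ρ b → (∀ {e} c → e ∈ xs → Cost y s (e All.∷ c All.∷ ρ) k) →
    length xs * suc y ≤ d * suc x → Cost x (foldList t u s) ρ (suc (a + (b + d * k)))
  c-fold≡ d (val refl) = c-fold∈ d

  e-eval : ∀ {t : Tm Γ A} → Val t ρ (proj₁ (eval t ρ))
  e-eval = val refl

  e-≡ : ∀ {t : Tm Γ A} {v w} → v ≡ w → Val t ρ v → Val t ρ w
  e-≡ refl p = p

  e-if : ∀ {b : Tm Γ bool} {t u : Tm Γ A} {p y z} →
    Val b ρ p → Val t ρ y → Val u ρ z → Val (if′ b t u) ρ (if p then y else z)
  e-if {ρ = ρ} {b = b} (val refl) (val refl) (val refl) = val (if-proj₁ (proj₁ (eval b ρ)))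

  e-let : ∀ {t : Tm Γ A} {u : Tm (A ∷ Γ) B} {y z} →
    Val t ρ y → Val u (y All.∷ ρ) z → Val (let′ t u) ρ z
  e-let (val refl) (val p) = val p

  e-app : ∀ {t : Tm Γ (A ⇒ B)} {u : Tm Γ A} {f y} →
    Val t ρ f → Val u ρ y → Val (t · u) ρ (proj₁ (f y))
  e-app (val refl) (val refl) = val refl

  e-cons : ∀ {t : Tm Γ A} {u : Tm Γ (list A)} {y z} →
    Val t ρ y → Val u ρ z → Val (cons t u) ρ (y ∷ z)
  e-cons (val refl) (val refl) = val refl

  e-pair : ∀ {t : Tm Γ A} {u : Tm Γ B} {y z} →
    Val t ρ y → Val u ρ z → Val (pair t u) ρ (y , z)
  e-pair (val refl) (val refl) = val refl

  e-array : ∀ {t : Tm Γ (list A)} {y} → Val t ρ y → Val (array t) ρ y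
  e-array (val refl) = val refl

  e-fold : ∀ {t : Tm Γ (list A)} {u : Tm Γ B} {s : Tm (A ∷ B ∷ Γ) B} {xs b} g →
    Val t ρ xs → Val u ρ b → (∀ e c → Val s (e All.∷ c All.∷ ρ) (g e c)) →
    Val (foldList t u s) ρ (foldr g b xs)
  e-fold {ρ = ρ} {t = t} {u} {s} g (val refl) (val refl) p = val (loop (proj₁ (eval t ρ)))
    where
    loop : ∀ xs → proj₁ (foldrᵀ (λ e c → eval s (e All.∷ c All.∷ ρ)) (proj₁ (eval u ρ)) xs)
                ≡ foldr g (proj₁ (eval u ρ)) xs
    loop []       = refl
    loop (e ∷ xs) = trans (value (p e _)) (cong (g e) (loop xs))

  e-foldᵀ : ∀ {t : Tm Γ (list A)} {u : Tm Γ B} {s : Tm (A ∷ B ∷ Γ) B} {xs b} →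
    Val t ρ xs → Val u ρ b → Val (foldList t u s) ρ (proj₁ (foldrᵀ (λ e c → eval s (e All.∷ c All.∷ ρ)) b xs))
  e-foldᵀ (val refl) (val refl) = val refl

  e-snd : ∀ {t : Tm Γ (A ⊗ B)} {y} → Val t ρ y → Val (snd t) ρ (proj₂ y)
  e-snd (val refl) = val refl

  foldr-cons : ∀ {A B : Set} (g : A → B) xs → foldr (λ a c → g a ∷ c) [] xs ≡ map g xs
  foldr-cons g []       = refl
  foldr-cons g (a ∷ xs) = cong (g a ∷_) (foldr-cons g xs)

  foldr-if : ∀ {A : Set} (f : A → Bool) xs →
    foldr (λ a c → if f a then a ∷ c else c) [] xs ≡ filterᵇ f xs
  foldr-if f []       = refl
  foldr-if f (a ∷ xs) with f a
  ... | true  = cong (a ∷_) (foldr-if f xs)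
  ... | false = foldr-if f xs

  e-map : ∀ {t : Tm Γ (list A)} {s : Tm (A ∷ list B ∷ Γ) B} {xs} g →
    Val t ρ xs → (∀ e c → Val s (e All.∷ c All.∷ ρ) (g e)) →
    Val (foldList t nil (cons s (var (there (here refl))))) ρ (map g xs)
  e-map {xs = xs} g p q = e-≡ (foldr-cons g xs) (e-fold (λ e c → g e ∷ c) p e-eval
    (λ e c → e-cons (q e c) e-eval))

  e-filter : ∀ {t : Tm Γ (list A)} {s : Tm (A ∷ list A ∷ Γ) (list A)} {xs} f →
    Val t ρ xs → (∀ e c → Val s (e All.∷ c All.∷ ρ) (if f e then e ∷ c else c)) →
    Val (foldList t nil s) ρ (filterᵇ f xs)
  e-filter {xs = xs} f p q = e-≡ (foldr-if f xs)
    (e-fold (λ e c → if f e then e ∷ c else c) p e-eval q)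

-- Values and costs of the basic subprograms.

module Fragments where
  open Programs
  open CostCalculus
  open import Data.Fin using (Fin; toℕ; zero; suc)
  open import Data.Fin.Subset using (Subset)
  open import Data.List.Properties using (++-assoc; applyUpTo-∷ʳ; map-applyUpTo; map-tabulate)
  open import Data.Nat using (ℕ; zero; suc; _≤_; _<_; z≤n; s≤s; _≤ᵇ_)
  open import Data.Nat.Properties
  import Data.Vec as Vec

  nth-tabulate : ∀ {A : Set} {n} (g : Fin n → A) i {d} → nth (tabulate g) (toℕ i) d ≡ g i
  nth-tabulate g zero    = refl
  nth-tabulate g (suc i) = nth-tabulate (g ∘ suc) i

  nth-allFin : ∀ {A : Set} {n} (g : Fin n → A) i {d} → nth (map g (allFin n)) (toℕ i) d ≡ g i
  nth-allFin {n = n} g i {d} =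
    trans (cong (λ l → nth l (toℕ i) d) (map-tabulate id g)) (nth-tabulate g i)

  nth-applyUpTo : ∀ {A : Set} (g : ℕ → A) {n i d} → i < n → nth (applyUpTo g n) i d ≡ g i
  nth-applyUpTo g {i = zero}  (s≤s _) = refl
  nth-applyUpTo g {i = suc i} (s≤s p) = nth-applyUpTo (g ∘ suc) p

  nth-upTo : ∀ {A : Set} (g : ℕ → A) {n i d} → i < n → nth (map g (upTo n)) i d ≡ g i
  nth-upTo g {n} {i} {d} p =
    trans (cong (λ l → nth l i d) (map-applyUpTo id g n)) (nth-applyUpTo g p)

  nth-toList : ∀ {A : Set} {n} (xs : Vec.Vec A n) i {d} → nth (Vec.toList xs) (toℕ i) d ≡ Vec.lookup xs i
  nth-toList (x Vec.∷ xs) zero    = refl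
  nth-toList (x Vec.∷ xs) (suc i) = nth-toList xs i

  nth-overflow : ∀ {A : Set} (xs : List A) i {d} → length xs ≤ i → nth xs i d ≡ d
  nth-overflow []       i       p       = refl
  nth-overflow (x ∷ xs) (suc i) (s≤s p) = nth-overflow xs i p

  nth-All : ∀ {A : Set} {P : A → Set} (xs : List A) i {d} → All P xs → P d → P (nth xs i d)
  nth-All []       i       _        p = p
  nth-All (x ∷ xs) zero    (px ∷ _) _ = px
  nth-All (x ∷ xs) (suc i) (_ ∷ ps) p = nth-All xs i ps p

  module _ {Γ : List Ty} {ρ : Env Γ} where

    private
      countdown : ℕ × List ℕ → Timed (ℕ × List ℕ)
      countdown p = eval (let′ (sub (fst (` zero)) (natLit 1))
                           (pair (` zero) (cons (` zero) (snd (` suc zero))))) (p ∷ 0 ∷ ρ)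

      countdown-value : ∀ n l → proj₁ (iterateᵀ countdown n (n , l)) ≡ (0 , upTo n ++ l)
      countdown-value zero    l = refl
      countdown-value (suc n) l = trans (countdown-value n (n ∷ l)) (cong (0 ,_)
        (trans (sym (++-assoc (upTo n) (n ∷ []) l)) (cong (_++ l) (applyUpTo-∷ʳ id n))))

    upToT-value : ∀ n → Val upToT (n ∷ ρ) (upTo n)
    upToT-value n = val (cong proj₂ (trans (countdown-value n [])
      (cong (0 ,_) (Data.List.Properties.++-identityʳ (upTo n)))))

  upToT-cost : ∃ λ c → ∀ {Γ} {ρ : Env Γ} {x n} → n ≤ suc x → Cost x upToT (n ∷ ρ) c
  upToT-cost = _ , λ {_} {_} {x} {n} n≤ → c-snd (c-iter {y = 0} 1 c-flat c-flat (λ _ → c-flat)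
      (≤-trans (≤-reflexive (*-identityʳ n)) (≤-trans n≤ (≤-reflexive (sym (*-identityˡ (suc x)))))))

  eqᵇ : ℕ → ℕ → Bool
  eqᵇ a b = if b ≤ᵇ a then a ≤ᵇ b else false

  eqᵇ⇒≡ : ∀ {a b} → T (eqᵇ a b) → a ≡ b
  eqᵇ⇒≡ {a} {b} p with b ≤ᵇ a in eq
  ... | true = ≤-antisym (≤ᵇ⇒≤ a b p) (≤ᵇ⇒≤ b a (subst T (sym eq) _))

  eqᵇ-refl : ∀ a → eqᵇ a a ≡ true
  eqᵇ-refl a with a ≤ᵇ a | ≤⇒≤ᵇ (≤-refl {a})
  ... | true | _ = refl

  eqᵇ-≢ : ∀ {a b} → a ≢ b → eqᵇ a b ≡ false
  eqᵇ-≢ {a} {b} a≢b with eqᵇ a b in eq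
  ... | true  = ⊥-elim (a≢b (eqᵇ⇒≡ (subst T (sym eq) _)))
  ... | false = refl

  meetsᵇ insideᵇ : List Bool → List ℕ → Bool
  meetsᵇ  X vs = foldr (λ u c → if nth X u false then true else c) false vs
  insideᵇ X vs = foldr (λ u c → if nth X u false then c else false) true vs

  apartᵇ : List (List Bool) → List ℕ → List ℕ → Bool
  apartᵇ A us vs = foldr (λ u c → foldr (λ v c → if eqᵇ v u then false else
    (if nth (nth A u []) v false then false else c)) c vs) true us

  module _ {Γ : List Ty} {ρ : Env Γ} where

    eqT-value : ∀ {a b} → Val eqT (b ∷ a ∷ ρ) (eqᵇ a b)
    eqT-value = e-if e-eval e-eval e-eval

    meetsT-value : ∀ {X vs} → Val meetsT (X ∷ vs ∷ ρ) (meetsᵇ X vs)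
    meetsT-value = e-fold _ e-eval e-eval (λ _ _ → e-if e-eval e-eval e-eval)

    insideT-value : ∀ {X vs} → Val insideT (X ∷ vs ∷ ρ) (insideᵇ X vs)
    insideT-value = e-fold _ e-eval e-eval (λ _ _ → e-if e-eval e-eval e-eval)

  module _ {Γ : List Ty} {ρ : Env Γ} where

    apartT-value : ∀ {A us vs} → Val apartT (vs ∷ us ∷ A ∷ ρ) (apartᵇ A us vs)
    apartT-value = e-fold _ e-eval e-eval λ _ _ → e-fold _ e-eval e-eval λ _ _ →
      e-if (e-let e-eval (e-let e-eval eqT-value)) e-eval (e-if e-eval e-eval e-eval)

  meetsT-cost : ∀ h → ∃ λ c → ∀ {Γ} {ρ : Env Γ} {x X vs} → length vs ≤ h → Cost x meetsT (X ∷ vs ∷ ρ) c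
  meetsT-cost h = _ , λ l → c-fold {y = 0} h c-flat c-flat (λ _ _ → c-flat) (*-mono-≤ l (s≤s z≤n))

  insideT-cost : ∀ h → ∃ λ c → ∀ {Γ} {ρ : Env Γ} {x X vs} → length vs ≤ h → Cost x insideT (X ∷ vs ∷ ρ) c
  insideT-cost h = _ , λ l → c-fold {y = 0} h c-flat c-flat (λ _ _ → c-flat) (*-mono-≤ l (s≤s z≤n))

  apartT-cost : ∀ h → ∃ λ c → ∀ {Γ} {ρ : Env Γ} {x A us vs} → length us ≤ h → length vs ≤ h →
    Cost x apartT (vs ∷ us ∷ A ∷ ρ) c
  apartT-cost h = _ , λ l l′ → c-fold {y = 0} h c-flat c-flat
    (λ _ _ → c-fold {y = 0} h c-flat c-flat (λ _ _ → c-flat) (*-mono-≤ l′ (s≤s z≤n)))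
    (*-mono-≤ l (s≤s z≤n))

  meetsᵇ⇒ : ∀ X vs → T (meetsᵇ X vs) → Any (λ u → T (nth X u false)) vs
  meetsᵇ⇒ X (u ∷ vs) p with nth X u false in eq
  ... | true  = here (subst T (sym eq) _)
  ... | false = there (meetsᵇ⇒ X vs p)

  meetsᵇ⇐ : ∀ X {vs} → Any (λ u → T (nth X u false)) vs → T (meetsᵇ X vs)
  meetsᵇ⇐ X {u ∷ vs} p with nth X u false in eq
  meetsᵇ⇐ X {u ∷ vs} p         | true  = _
  meetsᵇ⇐ X {u ∷ vs} (here p)  | false = ⊥-elim (subst T eq p)
  meetsᵇ⇐ X {u ∷ vs} (there p) | false = meetsᵇ⇐ X p

  insideᵇ⇒ : ∀ X vs → T (insideᵇ X vs) → All (λ u → T (nth X u false)) vs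
  insideᵇ⇒ X []       p = []
  insideᵇ⇒ X (u ∷ vs) p with nth X u false in eq
  ... | true = subst T (sym eq) _ ∷ insideᵇ⇒ X vs p

  insideᵇ⇐ : ∀ X {vs} → All (λ u → T (nth X u false)) vs → T (insideᵇ X vs)
  insideᵇ⇐ X []                = _
  insideᵇ⇐ X {u ∷ vs} (p ∷ ps) with nth X u false
  ... | true = insideᵇ⇐ X ps

  module _ (A : List (List Bool)) where

    Apart : ℕ → ℕ → Set
    Apart u v = u ≢ v × ¬ T (nth (nth A u []) v false)

    private
      row : ℕ → Bool → List ℕ → Bool
      row u c vs = foldr (λ v c → if eqᵇ v u then false else
        (if nth (nth A u []) v false then false else c)) c vs

      row⇒ : ∀ u c vs → T (row u c vs) → All (Apart u) vs × T c
      row⇒ u c []       p = [] , p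
      row⇒ u c (v ∷ vs) p with eqᵇ v u in e
      ... | false with nth (nth A u []) v false in a
      ... | false = ((λ { refl → subst T e (subst T (sym (eqᵇ-refl u)) _) }) , subst T a)
                      ∷ proj₁ (row⇒ u c vs p) , proj₂ (row⇒ u c vs p)

      row⇐ : ∀ u c {vs} → All (Apart u) vs → T c → T (row u c vs)
      row⇐ u c []                   p = p
      row⇐ u c {v ∷ _} ((n , a) ∷ ps) p rewrite eqᵇ-≢ (n ∘ sym) with nth (nth A u []) v false
      ... | true  = ⊥-elim (a _)
      ... | false = row⇐ u c ps p

    apartᵇ⇒ : ∀ us vs → T (apartᵇ A us vs) → All (λ u → All (Apart u) vs) us
    apartᵇ⇒ []       vs p = []
    apartᵇ⇒ (u ∷ us) vs p = proj₁ (row⇒ u _ vs p) ∷ apartᵇ⇒ us vs (proj₂ (row⇒ u (apartᵇ A us vs) vs p))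

    apartᵇ⇐ : ∀ {us vs} → All (λ u → All (Apart u) vs) us → T (apartᵇ A us vs)
    apartᵇ⇐ []       = _
    apartᵇ⇐ (p ∷ ps) = row⇐ _ _ p (apartᵇ⇐ ps)

-- Lists without repetitions.

module UniqueLists where
  open import Data.Fin using (Fin)
  open import Data.List.Membership.Propositional.Properties using (∈-∃++; ∈-allFin; ∈-upTo⁺)
  open import Data.List.Properties using (length-tabulate; length-upTo)
  open import Data.List.Relation.Binary.Permutation.Propositional using (_↭_; ↭⇒↭ₛ; ↭-refl; ↭-sym; ↭-trans; prep)
  open import Data.List.Relation.Binary.Permutation.Propositional.Properties using (shift; ↭-length; ∈-resp-↭)
  open import Data.Nat using (ℕ; _≤_; _<_; z≤n; s≤s)
  open import Data.Nat.Properties using (≤-trans; ≤-reflexive)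

  module _ {A : Set} where
    open import Data.List.Relation.Binary.Permutation.Setoid.Properties (setoid A) using (Unique-resp-↭)

    ∈⇒↭ : ∀ {x : A} {ys} → x ∈ ys → ∃ λ zs → ys ↭ x ∷ zs
    ∈⇒↭ {x} x∈ with ∈-∃++ x∈
    ... | as , bs , refl = as ++ bs , shift x as bs

    private
      drop-∷ : ∀ {x : A} {xs ys zs} → Unique (x ∷ xs) → (∀ {y} → y ∈ x ∷ xs → y ∈ ys) →
        ys ↭ x ∷ zs → ∀ {y} → y ∈ xs → y ∈ zs
      drop-∷ (x∉ ∷ _) incl π y∈ with ∈-resp-↭ π (incl (there y∈))
      ... | here refl = ⊥-elim (All.lookup x∉ y∈ refl)
      ... | there y∈′ = y∈′

    unique-length : ∀ {xs ys : List A} → Unique xs → (∀ {y} → y ∈ xs → y ∈ ys) → length xs ≤ length ys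
    unique-length {[]}     _             _   = z≤n
    unique-length {x ∷ xs} u@(_ ∷ u′) incl with ∈⇒↭ (incl (here refl))
    ... | zs , π = ≤-trans (s≤s (unique-length u′ (drop-∷ u incl π))) (≤-reflexive (sym (↭-length π)))

    unique-↭ : ∀ {xs ys : List A} → Unique xs → Unique ys →
      (∀ {y} → y ∈ xs → y ∈ ys) → (∀ {y} → y ∈ ys → y ∈ xs) → xs ↭ ys
    unique-↭ {[]} {[]}     _ _ _ _   = ↭-refl
    unique-↭ {[]} {y ∷ ys} _ _ _ incl′ with () ← incl′ (here refl)
    unique-↭ {x ∷ xs} {ys} u@(x∉ ∷ u′) v incl incl′ with ∈⇒↭ (incl (here refl))
    ... | zs , π = let zs-unique = Unique-resp-↭ (↭⇒↭ₛ π) v in ↭-trans (prep x (unique-↭ u′ (AllPairs.tail zs-unique)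
        (drop-∷ u incl π) (drop-∷ zs-unique (λ y∈ → incl′ (∈-resp-↭ (↭-sym π) y∈)) ↭-refl))) (↭-sym π)

  pairwise : ∀ {A : Set} {R : A → A → Set} → (∀ {x y} → R x y → R y x) → ∀ {xs} → AllPairs R xs →
    ∀ {x y} → x ∈ xs → y ∈ xs → x ≢ y → R x y
  pairwise s _        (here refl) (here refl) x≢y = ⊥-elim (x≢y refl)
  pairwise s (p ∷ _)  (here refl) (there y∈)  _   = All.lookup p y∈
  pairwise s (p ∷ _)  (there x∈)  (here refl) _   = s (All.lookup p x∈)
  pairwise s (_ ∷ ps) (there x∈)  (there y∈)  x≢y = pairwise s ps x∈ y∈ x≢y

  length-unique-Fin : ∀ {n} {xs : List (Fin n)} → Unique xs → length xs ≤ n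
  length-unique-Fin {n} u =
    ≤-trans (unique-length u (λ {y} _ → ∈-allFin y)) (≤-reflexive (length-tabulate {n = n} (λ i → i)))

  length-unique-< : ∀ {n} {xs : List ℕ} → Unique xs → All (_< n) xs → length xs ≤ n
  length-unique-< {n} u p =
    ≤-trans (unique-length u (λ y∈ → ∈-upTo⁺ (All.lookup p y∈))) (≤-reflexive (length-upTo n))

-- Rooting a tree, and walks that avoid a node.

module Trees where
  open UniqueLists
  open import Data.Fin using (Fin; toℕ)
  open import Data.Fin.Properties using (toℕ-injective; toℕ<n)
  open import Data.Fin.Subset.Properties using (∈⊤)
  open import Data.List.Membership.Propositional.Properties using (∈-filter⁺; ∈-filter⁻; ∈-allFin; ∈-++⁺ˡ; ∈-++⁺ʳ; ∈-++⁻)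
  open import Data.List.Relation.Binary.Disjoint.Propositional using (Disjoint)
  open import Data.List.Relation.Unary.All.Properties using (¬Any⇒All¬; ++⁺)
  open import Data.List.Relation.Unary.Linked using (Linked; []; [-]; _∷_)
  open import Data.Nat using (ℕ; zero; suc; _+_; _≤_; z≤n; s≤s)
  open import Data.Nat.Properties
  open import Relation.Binary.Construct.Closure.ReflexiveTransitive using (Star; ε; _◅_; _◅◅_; reverse)

  module RootedTree {s : ℕ} (𝑇 : Graph s) (isTree : IsTree 𝑇) where
    open Graph 𝑇 using (Adj; irrefl) renaming (sym to Adj-sym)
    open IsTree isTree

    nbrs : Fin s → List (Fin s)
    nbrs v = filter (λ u → T? (Graph.adj 𝑇 v u)) (allFin s)

    kidsOf : ℕ → Fin s → List (Fin s)
    kidsOf p v = filter (λ c → ¬? (toℕ c ≟ p)) (nbrs v)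

    -- Rooted k p v us: the part of the tree hanging at v, away from p, has depth
    -- at most k and nodes us.  The root of the whole tree has p = s, which is not a node.
    data Rooted : ℕ → ℕ → Fin s → List (Fin s) → Set
    data Forest (k p : ℕ) : List (Fin s) → List (Fin s) → Set

    data Rooted where
      node : ∀ {k p v us} → Forest k (toℕ v) (kidsOf p v) us → Rooted (suc k) p v (v ∷ us)

    data Forest k p where
      []  : Forest k p [] []
      _∷_ : ∀ {c us cs us′} → Rooted k p c us → Forest k p cs us′ → Forest k p (c ∷ cs) (us ++ us′)

    -- Vacuous if `p` is not the number of a node; this is what allows `s` to serve as the parent of
    -- the root.
    Parent : ℕ → Fin s → Set
    Parent p v = ∀ y → toℕ y ≡ p → Adj v y

    Off : ℕ → Fin s → Set
    Off p x = toℕ x ≢ p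

    -- An edge of the tree with the node `p` deleted. Walks made of such steps describe the
    -- components left after the deletion.
    Step : ℕ → Fin s → Fin s → Set
    Step p a b = Adj a b × Off p a × Off p b

    Walk : ℕ → Fin s → Fin s → Set
    Walk p a b = Off p a × Star (Step p) a b

    ∈-kidsOf⁻ : ∀ {p v c} → c ∈ kidsOf p v → Adj v c × Off p c
    ∈-kidsOf⁻ {p} {v} c∈ with ∈-filter⁻ _ {xs = nbrs v} c∈
    ... | c∈′ , c≢p = proj₂ (∈-filter⁻ _ {xs = allFin s} c∈′) , c≢p

    ∈-kidsOf⁺ : ∀ {p v c} → Adj v c → Off p c → c ∈ kidsOf p v
    ∈-kidsOf⁺ {c = c} vc = ∈-filter⁺ _ (∈-filter⁺ _ (∈-allFin c) vc)

    kid-off : ∀ {v c} → Adj v c → Off (toℕ v) c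
    kid-off vc c≡v with refl ← toℕ-injective c≡v = irrefl vc

    private
      data Path (p : ℕ) : Fin s → Fin s → List (Fin s) → Set where
        stop : ∀ {b} → Off p b → Path p b b (b ∷ [])
        go   : ∀ {a b c xs} → Off p a → Adj a c → a ∉ xs → Path p c b xs → Path p a b (a ∷ xs)

      suffix : ∀ {p a b c xs} → Path p c b xs → a ∈ xs → ∃ (Path p a b)
      suffix P@(stop _)     (here refl) = _ , P
      suffix P@(go _ _ _ _) (here refl) = _ , P
      suffix (go _ _ _ P)   (there a∈)  = suffix P a∈

      -- Loop erasure: if `a` already occurs on the simple path found from `c`, the part of that
      -- path starting at `a` is taken instead.
      path : ∀ {p a b} → Off p a → Star (Step p) a b → ∃ (Path p a b)
      path a≢p ε = _ , stop a≢p
      path {a = a} a≢p ((ac , _ , c≢p) ◅ w) with path c≢p w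
      ... | xs , P with Any.any? (a Fin.≟_) xs
      ... | yes a∈ = suffix P a∈
      ... | no a∉  = _ , go a≢p ac a∉ P

      path-unique : ∀ {p a b xs} → Path p a b xs → Unique xs
      path-unique (stop _)      = [] ∷ []
      path-unique (go _ _ a∉ P) = ¬Any⇒All¬ _ a∉ ∷ path-unique P

      path-off : ∀ {p a b xs} → Path p a b xs → All (Off p) xs
      path-off (stop b≢)     = b≢ ∷ []
      path-off (go a≢ _ _ P) = a≢ ∷ path-off P

      path-linked : ∀ {p u v a b xs} → Adj u a → Path p a b xs → Adj b v → Linked Adj (u ∷ xs ∷ʳ v)
      path-linked ua (stop _)      bv = ua ∷ bv ∷ [-]
      path-linked ua (go _ ac _ P) bv = ua ∷ path-linked ac P bv

      path-nonempty : ∀ {p a b xs} → Path p a b xs → 1 ≤ length xs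
      path-nonempty (stop _)     = s≤s z≤n
      path-nonempty (go _ _ _ _) = s≤s z≤n

      path-long : ∀ {p a b xs} → a ≢ b → Path p a b xs → 2 ≤ length xs
      path-long a≢b (stop _)     = ⊥-elim (a≢b refl)
      path-long a≢b (go _ _ _ P) = s≤s (path-nonempty P)

    -- A simple path between two different neighbours of `v` that avoids `v` closes up through `v`
    -- to a cycle; it has at least two vertices since `a ≢ b`, as `IsCycle` requires.
    no-bypass : ∀ {v a b} → Adj v a → Adj v b → a ≢ b → ¬ Walk (toℕ v) a b
    no-bypass {v} va vb a≢b (a≢v , w) with path a≢v w
    ... | xs , P = acyclic v xs
      ( path-long a≢b P
      , All.map (λ x≢v v≡x → x≢v (cong toℕ (sym v≡x))) (path-off P) ∷ path-unique P
      , path-linked va P (Adj-sym vb))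

    walk-end : ∀ {p a b} → Walk p a b → Off p b
    walk-end (a≢p , w) = end a≢p w
      where
      end : ∀ {p a b} → Off p a → Star (Step p) a b → Off p b
      end a≢p ε                   = a≢p
      end _   ((_ , _ , c≢p) ◅ w) = end c≢p w

    walk-trans : ∀ {p a b c} → Walk p a b → Walk p b c → Walk p a c
    walk-trans (a≢p , w) (_ , w′) = a≢p , w ◅◅ w′

    walk-sym : ∀ {p a b} → Walk p a b → Walk p b a
    walk-sym W@(_ , w) = walk-end W , reverse (λ (ab , a≢ , b≢) → Adj-sym ab , b≢ , a≢) w

    root∈ : ∀ {k p v us} → Rooted k p v us → v ∈ us
    root∈ (node _) = here refl

    roots∈ : ∀ {k p cs us c} → Forest k p cs us → c ∈ cs → c ∈ us
    roots∈ (R ∷ F) (here refl) = ∈-++⁺ˡ (root∈ R)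
    roots∈ (R ∷ F) (there c∈)  = ∈-++⁺ʳ _ (roots∈ F c∈)

    reach : ∀ {k p v us} → Rooted k p v us → Parent p v → Off p v → ∀ {x} → x ∈ us → Walk p v x
    reach-forest : ∀ {k v cs us} → Forest k (toℕ v) cs us → All (Adj v) cs →
      ∀ {x} → x ∈ us → ∃ λ c → c ∈ cs × Walk (toℕ v) c x

    reach (node F) par v≢p (here refl) = v≢p , ε
    reach {p = p} {v} (node F) par v≢p {x} (there x∈)
      with reach-forest F (All.tabulate (proj₁ ∘ ∈-kidsOf⁻)) x∈
    ... | c , c∈ , c≢v , w = v≢p , (vc , v≢p , c≢p) ◅ lift (c≢v , ε) w
      where
      vc = proj₁ (∈-kidsOf⁻ c∈)
      c≢p = proj₂ (∈-kidsOf⁻ c∈)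
      -- The parent and the child `c` are both neighbours of `v`, so a walk from `c` to the parent
      -- avoiding `v` would be a bypass. Applied to every initial segment, this shows that the whole
      -- walk avoids `p`.
      off : ∀ {y} → Walk (toℕ v) c y → Off p y
      off {y} W y≡p = no-bypass vc (par y y≡p) (λ { refl → c≢p y≡p }) W
      lift : ∀ {a} → Walk (toℕ v) c a → Star (Step (toℕ v)) a x → Star (Step p) a x
      lift W ε = ε
      lift W (st@(ab , _) ◅ w) =
        let W′ = walk-trans W (walk-end W , st ◅ ε) in (ab , off W , off W′) ◅ lift W′ w
    reach-forest {v = v} (_∷_ {c} {us} R F) (vc ∷ vcs) x∈ with ∈-++⁻ us x∈
    ... | inj₁ x∈us = c , here refl , reach R par (kid-off vc) x∈us
      where
      par : Parent (toℕ v) c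
      par y y≡v with refl ← toℕ-injective y≡v = Adj-sym vc
    ... | inj₂ x∈us′ with reach-forest F vcs x∈us′
    ... | c′ , c′∈ , w = c′ , there c′∈ , w

    rooted-off : ∀ {k p v us} → Rooted k p v us → Parent p v → ∀ {x} → x ∈ us → Off p x
    rooted-off R par x∈ = walk-end (reach R par (λ v≡p → irrefl (par _ v≡p)) x∈)

    -- Inductively, an edge leaving the part of a child can only lead to `v`, and every neighbour of
    -- `v` other than `p` is a child.
    closed : ∀ {k p v us} → Rooted k p v us → ∀ {x y} → x ∈ us → Adj x y →
      y ∈ us ⊎ (x ≡ v × toℕ y ≡ p)
    closed-forest : ∀ {k v cs us} → Forest k (toℕ v) cs us → ∀ {x y} → x ∈ us → Adj x y →
      y ∈ v ∷ us

    closed {p = p} (node F) {y = y} (here refl) xy with toℕ y ≟ p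
    ... | yes y≡p = inj₂ (refl , y≡p)
    ... | no y≢p  = inj₁ (there (roots∈ F (∈-kidsOf⁺ xy y≢p)))
    closed (node F) (there x∈) xy = inj₁ (closed-forest F x∈ xy)
    closed-forest (_∷_ {us = us} R F) x∈ xy with ∈-++⁻ us x∈
    closed-forest (R ∷ F) x∈ xy | inj₁ x∈us with closed R x∈us xy
    ... | inj₁ y∈         = there (∈-++⁺ˡ y∈)
    ... | inj₂ (_ , y≡v)  = here (toℕ-injective y≡v)
    closed-forest (R ∷ F) x∈ xy | inj₂ x∈us′ with closed-forest F x∈us′ xy
    ... | here y≡v = here y≡v
    ... | there y∈ = there (∈-++⁺ʳ _ y∈)

    rooted-unique : ∀ {k p v us} → Rooted k p v us → Unique us
    forest-unique : ∀ {k v cs us} → Forest k (toℕ v) cs us → All (Adj v) cs → Unique cs → Unique us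

    rooted-unique {p = p} {v} (node F) =
      All.tabulate (λ x∈ v≡x → walk-end (proj₂ (proj₂ (reach-forest F vs x∈))) (cong toℕ (sym v≡x)))
        ∷ forest-unique F vs (Unique.filter⁺ _ (Unique.filter⁺ _ (Unique.allFin⁺ s)))
      where vs = All.tabulate (proj₁ ∘ ∈-kidsOf⁻)
    forest-unique []      _          _        = []
    forest-unique {v = v} (_∷_ {c} R F) (vc ∷ vcs) (c∉ ∷ u) =
      Unique.++⁺ (rooted-unique R) (forest-unique F vcs u) disjoint
      where
      -- A common node would join two different children by a walk that bypasses `v`.
      disjoint : Disjoint _ _
      disjoint (x∈ , x∈′) with reach-forest (R ∷ []) (vc ∷ []) (∈-++⁺ˡ x∈) | reach-forest F vcs x∈′
      ... | _ , here refl , w | c′ , c′∈ , w′ =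
        no-bypass vc (All.lookup vcs c′∈) (All.lookup c∉ c′∈) (walk-trans w (walk-sym w′))

    parentOf : List (Fin s) → ℕ
    parentOf []      = s
    parentOf (p ∷ _) = toℕ p

    -- The ancestors of a node are distinct, so the depth is at most s.
    build : ∀ k v anc → Unique (v ∷ anc) → Linked Adj (v ∷ anc) → s ≤ length anc + k →
      ∃ (Rooted k (parentOf anc) v)
    -- Here `v` and its ancestors would be more than `s` distinct nodes.
    build zero v anc u l s≤ = ⊥-elim (<-irrefl refl (≤-trans (s≤s s≤′) (length-unique-Fin u)))
      where s≤′ = subst (s ≤_) (+-identityʳ _) s≤
    build (suc k) v anc u l s≤ = _ , node (proj₂ (forest (kidsOf (parentOf anc) v) ∈-kidsOf⁻))
      where
      ancestor-walk : ∀ {p anc c} → Unique (v ∷ p ∷ anc) → Linked Adj (p ∷ anc) → c ∈ p ∷ anc →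
        Walk (toℕ v) p c
      ancestor-walk ((v≢p ∷ _) ∷ _) _ (here refl) = (λ p≡v → v≢p (sym (toℕ-injective p≡v))) , ε
      ancestor-walk ((v≢p ∷ v∉@(v≢p′ ∷ _)) ∷ _ ∷ u) (pp′ ∷ l) (there c∈) =
        let p≢v = λ p≡v → v≢p (sym (toℕ-injective p≡v))
            (p′≢v , w) = ancestor-walk (v∉ ∷ u) l c∈
        in p≢v , (pp′ , p≢v , p′≢v) ◅ w

      -- The ancestors form a walk starting at the parent and avoiding `v`; a new neighbour among
      -- them would be reached from the parent around `v`.
      fresh : ∀ {anc c} → Unique (v ∷ anc) → Linked Adj (v ∷ anc) → Adj v c → Off (parentOf anc) c →
        c ∉ v ∷ anc
      fresh u l vc c≢p (here refl) = irrefl vc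
      fresh {p ∷ anc} u (vp ∷ l) vc c≢p (there c∈) =
        no-bypass vp vc (λ { refl → c≢p refl }) (ancestor-walk u l c∈)

      forest : ∀ cs → (∀ {c} → c ∈ cs → Adj v c × Off (parentOf anc) c) → ∃ (Forest k (toℕ v) cs)
      forest []       _ = _ , []
      forest (c ∷ cs) p =
        let (vc , c≢p) = p (here refl)
        in _ , proj₂ (build k c (v ∷ anc) (¬Any⇒All¬ _ (fresh u l vc c≢p) ∷ u) (Adj-sym vc ∷ l)
                  (subst (s ≤_) (+-suc (length anc) k) s≤))
               ∷ proj₂ (forest cs (p ∘ there))

    build-root : ∀ v → ∃ (Rooted s s v)
    build-root v = build s v [] ([] ∷ []) [-] ≤-refl

    root-parent : ∀ v → Parent s v
    root-parent v y y≡s = ⊥-elim (<-irrefl y≡s (toℕ<n y))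

    rooted-all : ∀ {k v us} → Rooted k s v us → ∀ x → x ∈ us
    rooted-all R x = walk (connected ∈⊤ ∈⊤) (root∈ R)
      where
      walk : ∀ {a} → Star Adj a x → a ∈ _ → x ∈ _
      walk ε        a∈ = a∈
      walk (ab ◅ w) a∈ with closed R a∈ ab
      ... | inj₁ b∈        = walk w b∈
      ... | inj₂ (_ , b≡s) = ⊥-elim (<-irrefl b≡s (toℕ<n _))

    -- A set of nodes with connected trace meeting us and its complement meets both ends
    -- of the only edge leaving us.
    crossing : ∀ {k p v us} → Rooted k p v us → (M : Fin s → Set) → ∀ {x y} → x ∈ us → y ∉ us →
      M x → Star (λ a b → Adj a b × M b) x y → M v × ∃ λ z → toℕ z ≡ p × M z
    crossing R M x∈ y∉ Mx ε = ⊥-elim (y∉ x∈)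
    crossing R M x∈ y∉ Mx ((ab , Mb) ◅ w) with closed R x∈ ab
    ... | inj₁ b∈           = crossing R M b∈ y∉ Mb w
    ... | inj₂ (refl , b≡p) = Mx , _ , b≡p , Mb

-- The number of small subsets and the cost of enumerating them.

module Counting where
  open import Data.Nat
  open import Data.Nat.Properties
  open import Data.Nat.Tactic.RingSolver using (solve-∀)

  open ≤-Reasoning

  -- The number of sets of at most k out of N elements.
  cnt : ℕ → ℕ → ℕ
  cnt zero    k       = 1
  cnt (suc N) zero    = 1
  cnt (suc N) (suc k) = cnt N (suc k) + cnt N k

  cnt≥1 : ∀ N k → 1 ≤ cnt N k
  cnt≥1 zero    k       = ≤-refl
  cnt≥1 (suc N) zero    = ≤-refl
  cnt≥1 (suc N) (suc k) = ≤-trans (cnt≥1 N (suc k)) (m≤m+n _ _)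

  cnt-suc : ∀ N k → cnt N k ≤ cnt (suc N) k
  cnt-suc zero    zero    = ≤-refl
  cnt-suc (suc N) zero    = ≤-refl
  cnt-suc N       (suc k) = m≤m+n _ _

  cnt-mono : ∀ {M N} k → M ≤ N → cnt M k ≤ cnt N k
  cnt-mono k p = go k (≤⇒≤′ p)
    where
    go : ∀ {M N} k → M ≤′ N → cnt M k ≤ cnt N k
    go k (≤′-reflexive refl) = ≤-refl
    go {N = suc N} k (≤′-step p) = ≤-trans (go k p) (cnt-suc N k)

  -- The term x ^ (k - i) of the binomial expansion of x ^ k (1 + 1 / x) ^ N is at least 1 for i ≤ k.
  cnt-power : ∀ x .{{_ : NonZero x}} N k → cnt N k * x ^ N ≤ x ^ k * suc x ^ N
  cnt-power x zero k = begin
    1 * 1           ≤⟨ *-monoˡ-≤ 1 (m^n>0 x k) ⟩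
    x ^ k * 1       ∎
  cnt-power x (suc N) zero = begin
    1 * x ^ suc N     ≤⟨ *-monoʳ-≤ 1 (^-monoˡ-≤ (suc N) (n≤1+n x)) ⟩
    1 * suc x ^ suc N ∎
  cnt-power x (suc N) (suc k) = begin
    (cnt N (suc k) + cnt N k) * (x * x ^ N)               ≡⟨ lemma (cnt N (suc k)) (cnt N k) x (x ^ N) ⟩
    x * (cnt N (suc k) * x ^ N) + x * (cnt N k * x ^ N)
      ≤⟨ +-mono-≤ (*-monoʳ-≤ x (cnt-power x N (suc k))) (*-monoʳ-≤ x (cnt-power x N k)) ⟩
    x * (x * x ^ k * suc x ^ N) + x * (x ^ k * suc x ^ N) ≡⟨ lemma′ x (x ^ k) (suc x ^ N) ⟩
    x * x ^ k * (suc x * suc x ^ N)                       ∎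
    where
    lemma : ∀ a b x y → (a + b) * (x * y) ≡ x * (a * y) + x * (b * y)
    lemma = solve-∀
    lemma′ : ∀ x y z → x * (x * y * z) + x * (y * z) ≡ x * y * (suc x * z)
    lemma′ = solve-∀

  private
    -- (1 + 1 / x) ^ i ≤ 1 / (1 - i / x)
    bernoulli : ∀ x i d → i + d ≡ x → suc x ^ i * d ≤ x ^ i * x
    bernoulli x zero d refl = ≤-refl
    bernoulli x (suc i) d eq = begin
      suc x * suc x ^ i * d       ≡⟨ lemma (suc x) (suc x ^ i) d ⟩
      suc x ^ i * (d + x * d)     ≤⟨ *-monoʳ-≤ (suc x ^ i) (+-monoˡ-≤ (x * d) d≤x) ⟩
      suc x ^ i * (x + x * d)     ≡⟨ lemma′ (suc x ^ i) x d ⟩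
      suc x ^ i * suc d * x       ≤⟨ *-monoˡ-≤ x (bernoulli x i (suc d) (trans (+-suc i d) eq)) ⟩
      x ^ i * x * x               ≡⟨ cong (_* x) (*-comm (x ^ i) x) ⟩
      x * x ^ i * x ∎
      where
      d≤x : d ≤ x
      d≤x = subst (d ≤_) eq (m≤n+m d (suc i))
      lemma : ∀ s y d → s * y * d ≡ y * (s * d)
      lemma = solve-∀
      lemma′ : ∀ y x d → y * (x + x * d) ≡ y * suc d * x
      lemma′ = solve-∀

    half : ∀ x → ∃ λ m → x ≡ m + m ⊎ x ≡ m + suc m
    half zero = 0 , inj₁ refl
    half (suc x) with half x
    ... | m , inj₁ refl = m , inj₂ (sym (+-suc m m))
    ... | m , inj₂ refl = suc m , inj₁ refl

    -- With x = m + d, `bernoulli` gives (1 + 1/x)^m ≤ x/d, and x/d ≤ 2 because m ≤ d.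
    half-power : ∀ m d .{{_ : NonZero d}} → m ≤ d → suc (m + d) ^ m ≤ 2 * (m + d) ^ m
    half-power m d m≤d = *-cancelʳ-≤ _ _ d (begin
      suc (m + d) ^ m * d       ≤⟨ bernoulli (m + d) m d refl ⟩
      (m + d) ^ m * (m + d)     ≤⟨ *-monoʳ-≤ ((m + d) ^ m) (+-monoˡ-≤ d m≤d) ⟩
      (m + d) ^ m * (d + d)     ≡⟨ lemma ((m + d) ^ m) d ⟩
      2 * (m + d) ^ m * d       ∎)
      where
      lemma : ∀ y d → y * (d + d) ≡ 2 * y * d
      lemma = solve-∀

  -- The sequence (1 + 1/x)^x increases to Euler's number, but any constant will do. Each half of
  -- the exponent contributes a factor of at most 2 by `half-power`, and for odd x the remaining
  -- factor 1 + 1/x is again at most 2.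
  power-bound : ∀ x → suc x ^ x ≤ 8 * x ^ x
  power-bound x with half x
  ... | zero , inj₁ refl = s≤s z≤n
  ... | suc m′ , inj₁ refl = begin
    suc (m + m) ^ (m + m)                   ≡⟨ ^-distribˡ-+-* (suc (m + m)) m m ⟩
    suc (m + m) ^ m * suc (m + m) ^ m       ≤⟨ *-mono-≤ H H ⟩
    (2 * (m + m) ^ m) * (2 * (m + m) ^ m)   ≡⟨ lemma ((m + m) ^ m) ⟩
    4 * ((m + m) ^ m * (m + m) ^ m)         ≡⟨ cong (4 *_) (^-distribˡ-+-* (m + m) m m) ⟨
    4 * (m + m) ^ (m + m)                   ≤⟨ *-monoˡ-≤ ((m + m) ^ (m + m)) (m≤m+n 4 4) ⟩
    8 * (m + m) ^ (m + m) ∎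
    where
    m = suc m′
    H = half-power m m ≤-refl
    lemma : ∀ y → (2 * y) * (2 * y) ≡ 4 * (y * y)
    lemma = solve-∀
  ... | m , inj₂ refl = begin
    suc y ^ (m + suc m)                     ≡⟨ ^-distribˡ-+-* (suc y) m (suc m) ⟩
    suc y ^ m * (suc y * suc y ^ m)         ≤⟨ *-mono-≤ H (*-mono-≤ y≤ H) ⟩
    (2 * y ^ m) * ((2 * y) * (2 * y ^ m))   ≡⟨ lemma (y ^ m) y ⟩
    8 * (y ^ m * (y * y ^ m))               ≡⟨ cong (8 *_) (^-distribˡ-+-* y m (suc m)) ⟨
    8 * y ^ (m + suc m) ∎
    where
    y = m + suc m
    H = half-power m (suc m) (n≤1+n m)
    y≤ : suc y ≤ 2 * y
    y≤ = begin
      suc y       ≡⟨ +-comm 1 y ⟩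
      y + 1       ≤⟨ +-monoʳ-≤ y (≤-trans (s≤s z≤n) (m≤n+m (suc m) m)) ⟩
      y + y       ≡⟨ cong (y +_) (+-identityʳ y) ⟨
      2 * y       ∎
    lemma : ∀ z y → (2 * z) * ((2 * y) * (2 * z)) ≡ 8 * (z * (y * z))
    lemma = solve-∀

  -- `cnt-power` with N = c x leaves the factor (1 + 1/x)^(c x), which is at most 8^c. The point is
  -- that this factor does not depend on `k`.
  cnt-bound : ∀ x .{{_ : NonZero x}} c k {N} → N ≤ c * x → cnt N k ≤ 8 ^ c * x ^ k
  cnt-bound x c k {N} N≤ = ≤-trans (cnt-mono k N≤) (*-cancelʳ-≤ _ _ (x ^ (c * x)) {{m^n≢0 x (c * x)}} (begin
    cnt (c * x) k * x ^ (c * x)   ≤⟨ cnt-power x (c * x) k ⟩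
    x ^ k * suc x ^ (c * x)       ≤⟨ *-monoʳ-≤ (x ^ k) (powers c) ⟩
    x ^ k * (8 ^ c * x ^ (c * x)) ≡⟨ lemma (x ^ k) (8 ^ c) (x ^ (c * x)) ⟩
    8 ^ c * x ^ k * x ^ (c * x)   ∎))
    where
    lemma : ∀ a b d → a * (b * d) ≡ b * a * d
    lemma = solve-∀
    lemma′ : ∀ a b d → (8 * a) * (b * d) ≡ 8 * b * (a * d)
    lemma′ = solve-∀
    powers : ∀ c → suc x ^ (c * x) ≤ 8 ^ c * x ^ (c * x)
    powers zero    = ≤-refl
    powers (suc c) = begin
      suc x ^ (x + c * x)                 ≡⟨ ^-distribˡ-+-* (suc x) x (c * x) ⟩
      suc x ^ x * suc x ^ (c * x)         ≤⟨ *-mono-≤ (power-bound x) (powers c) ⟩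
      (8 * x ^ x) * (8 ^ c * x ^ (c * x)) ≡⟨ lemma′ (x ^ x) (8 ^ c) (x ^ (c * x)) ⟩
      8 ^ suc c * (x ^ x * x ^ (c * x))   ≡⟨ cong (8 ^ suc c *_) (^-distribˡ-+-* x x (c * x)) ⟨
      8 ^ suc c * x ^ (x + c * x)         ∎

  -- The cost of enumerating the sets of at most k out of N elements, when a skipped element
  -- costs a, a chosen one a + b, and every set found at most B - b.
  module Enumeration (a b B : ℕ) where

    total : ℕ → ℕ → ℕ
    total N k = (a * N + B) * cnt N k

    skip : ∀ N k {t} → t + b ≤ total N k → (a + t) + b ≤ total (suc N) k
    skip N k {t} p = begin
      a + t + b                                     ≡⟨ +-assoc a t b ⟩
      a + (t + b)                                   ≤⟨ +-mono-≤ (m≤m*n a (cnt N k) {{>-nonZero (cnt≥1 N k)}}) p ⟩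
      a * cnt N k + (a * N + B) * cnt N k           ≡⟨ lemma a N B (cnt N k) ⟩
      (a * suc N + B) * cnt N k                     ≤⟨ *-monoʳ-≤ (a * suc N + B) (cnt-suc N k) ⟩
      total (suc N) k                               ∎
      where
      lemma : ∀ a N B c → a * c + (a * N + B) * c ≡ (a * suc N + B) * c
      lemma = solve-∀

    -- The invariant carries a surplus `b` for every call. Of the two surpluses provided by the
    -- recursive calls, one pays for the new state of the chosen element and the other is handed on.
    branch : ∀ N k {t u} → t + b ≤ total N (suc k) → u + b ≤ total N k →
      (a + t + (b + u)) + b ≤ total (suc N) (suc k)
    branch N k {t} {u} p q = begin
      a + t + (b + u) + b                               ≡⟨ lemma a t b u ⟩
      a + (t + b) + (u + b)                             ≤⟨ +-mono-≤ (+-mono-≤ (m≤m*n a C {{>-nonZero (cnt≥1 (suc N)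
            (suc k))}}) p) q ⟩
      a * C + (a * N + B) * cnt N (suc k) + (a * N + B) * cnt N k
                                                        ≡⟨ lemma′ a N B (cnt N (suc k)) (cnt N k) ⟩
      total (suc N) (suc k)                             ∎
      where
      C = cnt (suc N) (suc k)
      lemma : ∀ a t b u → a + t + (b + u) + b ≡ a + (t + b) + (u + b)
      lemma = solve-∀
      lemma′ : ∀ a N B c d → a * (c + d) + (a * N + B) * c + (a * N + B) * d ≡ (a * suc N + B) * (c + d)
      lemma′ = solve-∀

-- Heaviest independent sets and the recursions they satisfy.

module Optima where
  open UniqueLists
  open import Data.List.Relation.Binary.Permutation.Propositional using (_↭_; prep; swap; ↭⇒↭ₛ)
  import Data.List.Relation.Binary.Permutation.Propositional as ↭
  open import Data.List.Relation.Binary.Permutation.Propositional.Properties using (All-resp-↭)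
  open import Data.List.Relation.Binary.Permutation.Setoid.Properties using (AllPairs-resp-↭)
  open import Data.Nat using (ℕ)
  import Data.Nat as ℕ
  open import Data.Rational using (ℚ; 0ℚ; _+_; _≤_; _≤ᵇ_)
  open import Data.Rational.Properties
  open import Relation.Unary using (Decidable)
  import Data.Nat.Properties as ℕ

  module _ {A : Set} (w : A → ℚ) where

    sumOf : List A → ℚ
    sumOf xs = foldr _+_ 0ℚ (map w xs)

    sumOf-++ : ∀ xs ys → sumOf (xs ++ ys) ≡ sumOf xs + sumOf ys
    sumOf-++ []       ys = sym (+-identityˡ _)
    sumOf-++ (x ∷ xs) ys = trans (cong (w x +_) (sumOf-++ xs ys)) (sym (+-assoc (w x) _ _))

    sumOf-↭ : ∀ {xs ys} → xs ↭ ys → sumOf xs ≡ sumOf ys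
    sumOf-↭ ↭.refl         = refl
    sumOf-↭ (prep x π)     = cong (w x +_) (sumOf-↭ π)
    sumOf-↭ (swap {xs} {ys} x y π) = begin
      w x + (w y + sumOf xs)   ≡⟨ +-assoc (w x) (w y) _ ⟨
      w x + w y + sumOf xs     ≡⟨ cong₂ _+_ (+-comm (w x) (w y)) (sumOf-↭ π) ⟩
      w y + w x + sumOf ys     ≡⟨ +-assoc (w y) (w x) _ ⟩
      w y + (w x + sumOf ys)   ∎
      where open ≡-Reasoning
    sumOf-↭ (↭.trans π σ)  = trans (sumOf-↭ π) (sumOf-↭ σ)

    sumOf-partition : ∀ {P : A → Set} (P? : Decidable P) xs →
      sumOf xs ≡ sumOf (filter P? xs) + sumOf (filter (¬? ∘ P?) xs)
    sumOf-partition P? [] = sym (+-identityˡ 0ℚ)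
    sumOf-partition P? (x ∷ xs) with P? x
    ... | yes _ = trans (cong (w x +_) (sumOf-partition P? xs)) (sym (+-assoc (w x) _ _))
    ... | no _  = begin
      w x + sumOf xs     ≡⟨ cong (w x +_) (sumOf-partition P? xs) ⟩
      w x + (a + b)      ≡⟨ +-assoc (w x) a b ⟨
      w x + a + b        ≡⟨ cong (_+ b) (+-comm (w x) a) ⟩
      a + w x + b        ≡⟨ +-assoc a (w x) b ⟩
      a + (w x + b)      ∎
      where
      open ≡-Reasoning
      a = sumOf (filter P? xs)
      b = sumOf (filter (¬? ∘ P?) xs)

  module Optimum (Comp : ℕ → ℕ → Set) (Comp-sym : ∀ {j l} → Comp j l → Comp l j)
                 (Comp-irrefl : ∀ {j} → ¬ Comp j j) (w : ℕ → ℚ) where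

    Indep : List ℕ → Set
    Indep = AllPairs Comp

    CompatibleWith : (ℕ → Set) → ℕ → Set
    CompatibleWith S j = ∀ l → S l → Comp l j

    -- The value v consists of the weight and the list of a heaviest independent
    -- set of elements of U compatible with S.
    record Best (U S : ℕ → Set) (v : ℚ × List ℕ) : Set where
      field
        indep  : Indep (proj₂ v)
        inU    : All U (proj₂ v)
        compat : All (CompatibleWith S) (proj₂ v)
        weighs : proj₁ v ≡ sumOf w (proj₂ v)
        opt    : ∀ {Q} → Indep Q → All U Q → All (CompatibleWith S) Q → sumOf w Q ≤ proj₁ v
    open Best public

    indep⇒unique : ∀ {Q} → Indep Q → Unique Q
    indep⇒unique = AllPairs.map (λ { c refl → Comp-irrefl c })

    best-cong : ∀ {U U′ S S′ v} → (∀ {j} → U j → U′ j) → (∀ {j} → U′ j → U j) →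
      (∀ {j} → S j → S′ j) → (∀ {j} → S′ j → S j) → Best U S v → Best U′ S′ v
    best-cong u u′ s s′ b = record
      { indep  = indep b
      ; inU    = All.map u (inU b)
      ; compat = All.map (λ c l → c l ∘ s′) (compat b)
      ; weighs = weighs b
      ; opt    = λ i q c → opt b i (All.map u′ q) (All.map (λ d l → d l ∘ s) c)
      }

    best-empty : ∀ {U S} → (∀ {j} → ¬ U j) → Best U S (0ℚ , [])
    best-empty {U} none = record { indep = [] ; inU = [] ; compat = [] ; weighs = refl ; opt = opt′ }
      where
      opt′ : ∀ {Q} → Indep Q → All U Q → All _ Q → sumOf w Q ≤ 0ℚ
      opt′ []      _       _ = ≤-refl
      opt′ (_ ∷ _) (u ∷ _) _ = ⊥-elim (none u)

    best-skip : ∀ {U S v} k → ¬ CompatibleWith S k → Best U S v → Best (λ j → j ≡ k ⊎ U j) S v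
    best-skip k k∉ b = record
      { indep  = indep b
      ; inU    = All.map inj₂ (inU b)
      ; compat = compat b
      ; weighs = weighs b
      ; opt    = λ i q c → opt b i (All.zipWith (λ { (inj₁ refl , d) → ⊥-elim (k∉ d) ; (inj₂ u , _) → u }) (q , c)) c
      }

    better : ℚ × List ℕ → ℚ × List ℕ → ℚ × List ℕ
    better v v′ = if proj₁ v ≤ᵇ proj₁ v′ then v′ else v

    -- A competitor without `k` lies in `U` and is beaten by `v`. In one containing `k`, this
    -- element can be moved to the front; the rest is then compatible with `k` as well and competes
    -- with `v′`.
    best-branch : ∀ {U S v v′} k → CompatibleWith S k →
      Best U S v → Best U (λ l → l ≡ k ⊎ S l) v′ →
      Best (λ j → j ≡ k ⊎ U j) S (better v (w k + proj₁ v′ , k ∷ proj₂ v′))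
    best-branch {U} {S} {v} {v′} k k∈ b b′ = choose
      where
      taken : ℚ × List ℕ
      taken = w k + proj₁ v′ , k ∷ proj₂ v′

      bound : ∀ {Q} → Indep Q → All (λ j → j ≡ k ⊎ U j) Q → All (CompatibleWith S) Q →
        sumOf w Q ≤ proj₁ v ⊎ sumOf w Q ≤ proj₁ taken
      bound {Q} i q c with Any.any? (k ℕ.≟_) Q
      ... | no k∉ = inj₁ (opt b i (All.zipWith (λ { (inj₁ refl , k≢k) → ⊥-elim (k≢k refl) ; (inj₂ u , _) → u })
                                   (q , All.¬Any⇒All¬ Q k∉)) c)
      ... | yes k∈Q with ∈⇒↭ k∈Q
      ... | Q′ , π with AllPairs-resp-↭ (setoid ℕ) Comp-sym ((λ { refl x → x }) , (λ { refl x → x })) (↭⇒↭ₛ π) i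
                      | All-resp-↭ π q | All-resp-↭ π c
      ... | kQ′ ∷ i′ | _ ∷ q′ | _ ∷ c′ = inj₂ (subst (_≤ proj₁ taken) (sym (sumOf-↭ w π))
        (+-monoʳ-≤ (w k) (opt b′ i′
          (All.zipWith (λ { (inj₁ refl , kk) → ⊥-elim (Comp-irrefl kk) ; (inj₂ u , _) → u }) (q′ , kQ′))
          (All.zipWith (λ { (d , kj) l (inj₁ refl) → kj ; (d , kj) l (inj₂ s) → d l s }) (c′ , kQ′)))))

      choose : Best (λ j → j ≡ k ⊎ U j) S (better v taken)
      choose with proj₁ v ≤ᵇ proj₁ taken in eq
      ... | true  = record
        { indep  = All.map (λ d → d k (inj₁ refl)) (compat b′) ∷ indep b′
        ; inU    = inj₁ refl ∷ All.map inj₂ (inU b′)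
        ; compat = k∈ ∷ All.map (λ d l → d l ∘ inj₂) (compat b′)
        ; weighs = cong (w k +_) (weighs b′)
        ; opt    = λ i q c → case′ (bound i q c)
        }
        where
        case′ : ∀ {x} → x ≤ proj₁ v ⊎ x ≤ proj₁ taken → x ≤ proj₁ taken
        case′ (inj₁ p) = ≤-trans p (≤ᵇ⇒≤ (subst T (sym eq) _))
        case′ (inj₂ p) = p
      ... | false = record
        { indep  = indep b
        ; inU    = All.map inj₂ (inU b)
        ; compat = compat b
        ; weighs = weighs b
        ; opt    = λ i q c → case′ (bound i q c)
        }
        where
        v≰ : ¬ proj₁ v ≤ proj₁ taken
        v≰ p = subst T eq (≤⇒≤ᵇ p)
        case′ : ∀ {x} → x ≤ proj₁ v ⊎ x ≤ proj₁ taken → x ≤ proj₁ v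
        case′ (inj₁ p) = p
        case′ (inj₂ p) = ≤-trans p (<⇒≤ (≰⇒> v≰))

    -- This is the separation step of the dynamic program, with `U₁` living below one child and `U₂`
    -- below the remaining ones. A competitor splits along `P`. Only the part `S₁` of `S` seen at
    -- the interface is passed to the child, since compatibility with `S₁` already forces
    -- compatibility with `S`.
    best-join : ∀ {U U₁ U₂ S S₁ P v₁ v₂} (P? : Decidable P) →
      (∀ {j} → U₁ j → U j) → (∀ {j} → U₂ j → U j) →
      (∀ {j} → U j → P j → U₁ j) → (∀ {j} → U j → ¬ P j → U₂ j) →
      (∀ {l} → S₁ l → S l) →
      (∀ {j} → U₁ j → CompatibleWith S₁ j → CompatibleWith S j) →
      (∀ {j l} → U₁ j → U₂ l → Comp j l) →
      Best U₁ S₁ v₁ → Best U₂ S v₂ →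
      Best U S (proj₁ v₁ + proj₁ v₂ , proj₂ v₁ ++ proj₂ v₂)
    best-join {v₁ = v₁} {v₂} P? u₁ u₂ p₁ p₂ s c x b₁ b₂ = record
      { indep  = AllPairs.++⁺ (indep b₁) (indep b₂) (All.map (λ uj → All.map (x uj) (inU b₂)) (inU b₁))
      ; inU    = All.++⁺ (All.map u₁ (inU b₁)) (All.map u₂ (inU b₂))
      ; compat = All.++⁺ (All.zipWith (λ (uj , cj) → c uj cj) (inU b₁ , compat b₁)) (compat b₂)
      ; weighs = trans (cong₂ _+_ (weighs b₁) (weighs b₂)) (sym (sumOf-++ w (proj₂ v₁) (proj₂ v₂)))
      ; opt    = λ {Q} i q d → subst (_≤ proj₁ v₁ + proj₁ v₂) (sym (sumOf-partition w P? Q))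
          (+-mono-≤
            (opt b₁ (AllPairs.filter⁺ P? i)
              (All.zipWith (λ (uj , pj) → p₁ uj pj) (All.filter⁺ P? q , All.all-filter P? Q))
              (All.map (λ e l → e l ∘ s) (All.filter⁺ P? d)))
            (opt b₂ (AllPairs.filter⁺ (¬? ∘ P?) i)
              (All.zipWith (λ (uj , pj) → p₂ uj pj) (All.filter⁺ (¬? ∘ P?) q , All.all-filter (¬? ∘ P?) Q))
              (All.filter⁺ (¬? ∘ P?) d)))
      }

-- Uniform cost bounds for the parts of the program.

module Costs where
  open Programs
  open CostCalculus
  open Fragments
  import Data.Fin
  open import Data.List.Properties using (length-upTo)
  open import Data.Nat using (ℕ; suc; _+_; _*_; _≤_; s≤s)
  open import Data.Nat.Properties
  open import Data.Rational using (ℚ; 0ℚ)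

  member : List ⟦ MemberTy ⟧ → ℕ → ⟦ MemberTy ⟧
  member ms j = nth ms j ([] , [] , 0ℚ)

  vertices : List ⟦ MemberTy ⟧ → ℕ → List ℕ
  vertices ms j = proj₁ (member ms j)

  weightOf : List ⟦ MemberTy ⟧ → ℕ → ℚ
  weightOf ms j = proj₂ (proj₂ (member ms j))

  private
    linear : ∀ {l x} → l ≤ suc x → l * 1 ≤ 1 * suc x
    linear {l} {x} p = ≤-trans (≤-reflexive (*-identityʳ l)) (≤-trans p (≤-reflexive (sym (*-identityˡ (suc x)))))

    upTo≤ : ∀ q → length (upTo q) ≤ suc q
    upTo≤ q = ≤-trans (≤-reflexive (length-upTo q)) (n≤1+n q)

  c-map : ∀ {Γ A B x} {ρ : Env Γ} {t : Tm Γ (list A)} {s : Tm (A ∷ list B ∷ Γ) (list B)} {a k} →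
    Cost x t ρ a → (∀ e c → Cost 0 s (e ∷ c ∷ ρ) k) → length (proj₁ (eval t ρ)) ≤ suc x →
    Cost x (foldList t nil s) ρ (suc (a + (1 + 1 * k)))
  c-map p q l = c-fold {y = 0} 1 p c-flat q (linear l)

  length-map′ : ∀ {Γ A B} {ρ : Env Γ} (t : Tm Γ (list A)) (s : Tm (A ∷ list B ∷ Γ) B) →
    length (proj₁ (eval (foldList t nil (cons s (` Data.Fin.# 1))) ρ)) ≡ length (proj₁ (eval t ρ))
  length-map′ {ρ = ρ} t s = loop (proj₁ (eval t ρ))
    where
    loop : ∀ xs → length (proj₁ (foldrᵀ (λ e c → eval (cons s (` Data.Fin.# 1)) (e ∷ c ∷ ρ)) [] xs)) ≡ length xs
    loop []       = refl
    loop (_ ∷ xs) = cong suc (loop xs)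

  c-mapArray : ∀ {Γ A B x} {ρ : Env Γ} {t : Tm Γ (list A)} {s : Tm (A ∷ list B ∷ Γ) B} {a k y} d →
    Cost x t ρ a → (∀ e c → Cost y s (e ∷ c ∷ ρ) k) → length (proj₁ (eval t ρ)) * suc y ≤ d * suc x →
    Cost x (array (foldList t nil (cons s (` Data.Fin.# 1)))) ρ (suc (suc (a + (1 + d * suc (k + 1))) + d))
  c-mapArray {ρ = ρ} {t} {s} {y = y} d p q l = c-array d
    (c-fold {y = y} d p c-flat (λ e c → c-cons (q e c) c-flat) l)
    (≤-trans (≤-reflexive (length-map′ t s)) (≤-trans (m≤m*n _ (suc y)) l))

  initial : ℕ → List (Bool × Bool)
  initial q = map (λ _ → false , true) (upTo q)

  module _ {Xp Xv : List Bool} {kids : List ⟦ TabTy ⟧} {vp : ℕ × ℕ}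
    {F : ⟦ nat ⊗ nat ⇒ TabTy ⟧} {J : List ℕ} {cov : ⟦ CoverTy ⟧} {i : ℕ} {acc : ⟦ ValTy ⟧}
    {mat : ⟦ MatTy ⟧} {ms : List ⟦ MemberTy ⟧} {input : ⟦ InputTy ⟧} where

    initT-value : ∀ {ks js} q → Val initT
      (ks ∷ js ∷ Xp ∷ Xv ∷ kids ∷ vp ∷ F ∷ J ∷ cov ∷ i ∷ acc ∷ mat ∷ upTo q ∷ ms ∷ input ∷ []) (initial q)
    initT-value q = e-array (e-map _ e-eval λ _ _ → e-eval)

    jsT-value : ∀ {idx} → Val jsT
      (Xp ∷ Xv ∷ kids ∷ vp ∷ F ∷ J ∷ cov ∷ i ∷ acc ∷ mat ∷ idx ∷ ms ∷ input ∷ [])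
      (filterᵇ (λ j → meetsᵇ Xv (vertices ms j) ∧ meetsᵇ Xp (vertices ms j)) J)
    jsT-value = e-filter _ e-eval (λ j _ → e-≡ (if-∧ (meetsᵇ Xv (vertices ms j)))
      (e-if (e-let e-eval (e-let e-eval meetsT-value))
        (e-if (e-let e-eval (e-let e-eval meetsT-value)) e-eval e-eval) e-eval))
      where
      if-∧ : ∀ b {b′} {x y : List ℕ} → (if b then (if b′ then x else y) else y) ≡ (if b ∧ b′ then x else y)
      if-∧ true  = refl
      if-∧ false = refl

    ksT-value : ∀ {js idx} → Val ksT
      (js ∷ Xp ∷ Xv ∷ kids ∷ vp ∷ F ∷ J ∷ cov ∷ i ∷ acc ∷ mat ∷ idx ∷ ms ∷ input ∷ [])
      (filterᵇ (λ j → meetsᵇ Xv (vertices ms j) ∧ not (meetsᵇ Xp (vertices ms j))) J)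
    ksT-value = e-filter _ e-eval (λ j _ → e-≡ (if-∧-not (meetsᵇ Xv (vertices ms j)) (meetsᵇ Xp (vertices ms j)))
      (e-if (e-let e-eval (e-let e-eval meetsT-value))
        (e-if (e-let e-eval (e-let e-eval meetsT-value)) e-eval e-eval) e-eval))
      where
      if-∧-not : ∀ b b′ {x y : List ℕ} →
        (if b then (if b′ then y else x) else y) ≡ (if b ∧ not b′ then x else y)
      if-∧-not true  true  = refl
      if-∧-not true  false = refl
      if-∧-not false _     = refl

  membersT-value : ∀ {cov i acc mat ms input idx} →
    Val membersT (cov ∷ i ∷ acc ∷ mat ∷ idx ∷ ms ∷ input ∷ [])
      (filterᵇ (λ j → insideᵇ (proj₁ cov) (vertices ms j)) idx)
  membersT-value = e-filter _ e-eval (λ _ _ →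
    e-if (e-let e-eval (e-let e-eval insideT-value)) e-eval e-eval)

  compatible : ⟦ InputTy ⟧ → List ⟦ MemberTy ⟧ → ℕ → ℕ → Bool
  compatible input ms j i = apartᵇ (proj₁ (proj₂ input)) (vertices ms j) (vertices ms i)

  rowT-value : ∀ {Γ A} {ρ : Env Γ} {j} {c : ⟦ A ⟧} q ms input →
    Val {A = list bool} (rowT {A = A}) (j ∷ c ∷ upTo q ∷ ms ∷ input ∷ ρ) (map (compatible input ms j) (upTo q))
  rowT-value q ms input = e-map _ e-eval λ i _ →
    e-let e-eval (e-let e-eval (e-let e-eval apartT-value))

  matT-value : ∀ {Γ} {ρ : Env Γ} q ms input → Val matT (upTo q ∷ ms ∷ input ∷ ρ)
    (map (λ j → map (compatible input ms j) (upTo q)) (upTo q))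
  matT-value q ms input = e-array (e-map _ e-eval λ j _ → e-array (rowT-value q ms input))

  module _ (h : ℕ) where

    private
      Small : List ⟦ MemberTy ⟧ → Set
      Small ms = ∀ j → length (vertices ms j) ≤ h

    -- Each constant is chosen before the input, so it depends only on `h` and on the constants
    -- passed in. That uniformity is all that is used later; the numbers themselves stay hidden.
    abstract
      jsT-cost : ∃ λ c → ∀ {x Xp Xv kids vp F J cov i acc mat idx ms input} → Small ms → length J ≤ suc x →
        Cost x jsT (Xp ∷ Xv ∷ kids ∷ vp ∷ F ∷ J ∷ cov ∷ i ∷ acc ∷ mat ∷ idx ∷ ms ∷ input ∷ []) c
      jsT-cost = _ , λ small l → c-map c-flat
        (λ j _ → c-if+ (c-let c-flat (c-let c-flat (proj₂ (meetsT-cost h) (small j))))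
          (c-if+ (c-let c-flat (c-let c-flat (proj₂ (meetsT-cost h) (small j)))) c-flat c-flat)
          c-flat) l

      ksT-cost : ∃ λ c → ∀ {x js Xp Xv kids vp F J cov i acc mat idx ms input} → Small ms → length J ≤ suc x →
        Cost x ksT (js ∷ Xp ∷ Xv ∷ kids ∷ vp ∷ F ∷ J ∷ cov ∷ i ∷ acc ∷ mat ∷ idx ∷ ms ∷ input ∷ []) c
      ksT-cost = _ , λ small l → c-map c-flat
        (λ j _ → c-if+ (c-let c-flat (c-let c-flat (proj₂ (meetsT-cost h) (small j))))
          (c-if+ (c-let c-flat (c-let c-flat (proj₂ (meetsT-cost h) (small j)))) c-flat c-flat)
          c-flat) l

      membersT-cost : ∃ λ c → ∀ {x cov i acc mat ms input} q → Small ms → q ≤ x →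
        Cost x membersT (cov ∷ i ∷ acc ∷ mat ∷ upTo q ∷ ms ∷ input ∷ []) c
      membersT-cost = _ , λ q small l → c-map c-flat
        (λ j _ → c-if+ (c-let c-flat (c-let c-flat (proj₂ (insideT-cost h) (small j)))) c-flat c-flat)
        (≤-trans (upTo≤ q) (s≤s l))

      matT-cost : ∃ λ c → ∀ {Γ} {ρ : Env Γ} q ms input → Small ms →
        Cost (q + q * suc q) matT (upTo q ∷ ms ∷ input ∷ ρ) c
      matT-cost = _ , λ q ms input small →
        c-mapArray {y = q} 1 c-flat (λ j _ →
          c-mapArray {y = 0} 1 c-flat (λ i _ → c-let c-flat (c-let c-flat (c-let c-flat
            (proj₂ (apartT-cost h) (small j) (small i))))) (linear (upTo≤ q)))
          (≤-trans (*-monoˡ-≤ (suc q) (upTo≤ q)) (≤-reflexive (sym (*-identityˡ (suc q * suc q)))))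

      tableT-cost : ∀ a → ∃ λ c → ∀ {x kids v p F J cov i acc mat ms input js ks} q →
        let ρ₂ = nth (proj₂ (proj₂ cov)) p [] ∷ nth (proj₂ (proj₂ cov)) v [] ∷ kids ∷ (v , p) ∷ F ∷ J ∷ cov ∷
                   i ∷ acc ∷ mat ∷ upTo q ∷ ms ∷ input ∷ []
            ρ₃ = ks ∷ js ∷ ρ₂
        in Val jsT ρ₂ js → Val ksT (js ∷ ρ₂) ks →
        Small ms → length J ≤ suc x → q ≤ x → length js ≤ suc x → length ks ≤ suc x →
        proj₂ (proj₁ (eval interfaceT ρ₃) (proj₁ (eval initT ρ₃))) ≤ a * suc x →
        Cost x tableT (kids ∷ (v , p) ∷ F ∷ J ∷ cov ∷ i ∷ acc ∷ mat ∷ upTo q ∷ ms ∷ input ∷ []) c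
      tableT-cost a = _ , λ { q (val refl) (val refl) small lJ q≤ ljs lks p →
        c-let c-flat (c-let c-flat (c-let (proj₂ jsT-cost small lJ) (c-let (proj₂ ksT-cost small lJ)
          (c-app a
            (c-fold {y = 0} 1 c-flat (c-let (c-fold {y = 0} 1 c-flat c-flat (λ _ _ → c-flat) (linear lks)) c-flat)
              (λ _ _ → c-flat) (linear ljs))
            (c-mapArray {y = 0} 1 c-flat (λ _ _ → c-flat) (linear (≤-trans (upTo≤ q) (s≤s q≤))))
            p)))) }

      -- Iterating the step merely creates one closure per level, which takes constant time each.
      -- The real work is the single call at the root, assumed to cost at most `a * suc x`; the 20
      -- is the constant of `lookup-time`, for the final query.
      solveT-cost : ∀ a → ∃ λ c → ∀ {x cov i acc mat ms input J} q →
        let ρC = cov ∷ i ∷ acc ∷ mat ∷ upTo q ∷ ms ∷ input ∷ []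
            s  = length (proj₁ (proj₂ cov))
            F  = proj₁ (iterateᵀ (λ F → eval (lam (let′ kidsT tableT)) (F ∷ J ∷ ρC)) s (proj₁ (eval startT (J ∷ ρC))))
        in Val membersT ρC J → Small ms → q ≤ x → s ≤ suc x → proj₂ (F (0 , s)) ≤ a * suc x →
        proj₂ (proj₁ (F (0 , s)) []) ≤ 20 * suc x → Cost x solveT ρC c
      solveT-cost a = _ , λ { q (val refl) small q≤ s≤ p p′ →
        c-let (proj₂ membersT-cost q small q≤) (c-let (c-iter {y = 0} 1 c-flat c-flat (λ _ → c-flat) (linear s≤))
          (c-app 20 (c-app a c-flat c-flat p) c-flat p′)) }

      -- There are two scales: `y` for solving one element of the cover and `x` for the whole run,
      -- which covers `m` solutions as well as the compatibility matrix.
      searchT-cost : ∀ a → ∃ λ c → ∀ {x y} (solve : Tm ΓC ValTy) (input : ⟦ InputTy ⟧) q m →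
        let ms = proj₂ (proj₂ (proj₂ input))
            covers = proj₁ (proj₂ (proj₂ input))
            mat = map (λ j → map (compatible input ms j) (upTo q)) (upTo q)
        in length ms ≡ q → length covers ≡ m →
        Small ms → q + q * suc q ≤ x → m ≤ suc x → m * suc y ≤ 1 * suc x →
        (∀ {i} acc → i ∈ upTo m →
          Cost y solve (nth covers i ([] , [] , []) ∷ i ∷ acc ∷ mat ∷ upTo q ∷ ms ∷ input ∷ []) a) →
        Cost x (searchT solve) (input ∷ []) c
      searchT-cost a = _ , λ { {x} {y} solve input q m refl refl small q² m≤ my≤ solveCost →
        c-let c-flat
          (c-let≡ (e-let e-eval (upToT-value q))
            (c-let c-flat (proj₂ upToT-cost (≤-trans (m≤m+n q (q * suc q)) (m≤n⇒m≤1+n q²))))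
          (c-let≡ (matT-value q (proj₂ (proj₂ (proj₂ input))) input)
            (c-scale q² (proj₂ matT-cost q (proj₂ (proj₂ (proj₂ input))) input small))
          (c-snd (c-fold≡ 1 (e-let e-eval (upToT-value m)) (c-let c-flat (proj₂ upToT-cost m≤)) c-flat
            (λ acc i∈ → c-let c-flat (c-let (solveCost acc i∈) c-flat))
            (subst (λ l → l * suc y ≤ 1 * suc x) (sym (length-upTo m)) my≤))))) }

-- Enumerating compatible sets through states.

module Enumerations where
  open Programs
  open CostCalculus
  open Fragments
  open Costs
  open Counting
  open Optima
  import Data.Fin
  open import Data.List.Properties using (length-upTo)
  open import Data.Nat using (ℕ; zero; suc; _+_; _*_; _≤_; _<_)
  open import Data.Nat.Properties
  open import Data.Nat.Tactic.RingSolver using (solve-∀)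
  import Data.Rational

  St : Set
  St = List (Bool × Bool)

  -- A case distinction that does not normalise the goal.
  bool-case : ∀ {A : Set} (b : Bool) → (b ≡ true → A) → (b ≡ false → A) → A
  bool-case true  t f = t refl
  bool-case false t f = f refl

  chosen allowed : St → ℕ → Bool
  chosen  st i = proj₁ (nth st i (false , false))
  allowed st i = proj₂ (nth st i (false , false))

  module Enumerate (q : ℕ) (mat : ⟦ MatTy ⟧) (ms : List ⟦ MemberTy ⟧)
    (ks js : List ℕ) (Xp Xv : List Bool) (kids : List ⟦ TabTy ⟧) (vp : ℕ × ℕ) (F : ⟦ nat ⊗ nat ⇒ TabTy ⟧)
    (J : List ℕ) (cov : ⟦ CoverTy ⟧) (i₀ : ℕ) (acc₀ : ⟦ ValTy ⟧) (input : ⟦ InputTy ⟧) where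

    ρ₃ : Env Γ₃
    ρ₃ = ks ∷ js ∷ Xp ∷ Xv ∷ kids ∷ vp ∷ F ∷ J ∷ cov ∷ i₀ ∷ acc₀ ∷ mat ∷ upTo q ∷ ms ∷ input ∷ []

    addSt : ℕ → St → St
    addSt j st = map (λ i → (if eqᵇ i j then true else chosen st i) ,
                            (if nth (nth mat j []) i false then allowed st i else false)) (upTo q)

    initSt : St
    initSt = initial q

    addT-value : ∀ {R} {L : ⟦ R ⟧} {st j k} → Val (addT {R}) (L ∷ st ∷ j ∷ k ∷ ρ₃) (addSt j st)
    addT-value = e-array (e-map _ e-eval λ i _ →
      e-pair (e-if (e-let e-eval (e-let e-eval eqT-value)) e-eval e-eval) (e-if e-eval e-eval e-eval))

    -- A round number above the constant that the calculus produces; the comparison demanded by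
    -- `c-≤` is settled by evaluation. `joinCost` arises in the same way.
    addCost : ℕ
    addCost = 100

    private
      upTo≤ : length (upTo q) ≤ suc q
      upTo≤ = ≤-trans (≤-reflexive (length-upTo q)) (n≤1+n q)

      ≤1* : ∀ {a b} → a ≤ b → a ≤ 1 * b
      ≤1* {b = b} p = ≤-trans p (≤-reflexive (sym (*-identityˡ b)))

    addT-cost : ∀ {R} {L : ⟦ R ⟧} {st j k} → Cost q (addT {R}) (L ∷ st ∷ j ∷ k ∷ ρ₃) addCost
    addT-cost = c-≤ (c-mapArray {y = 0} 1 c-flat (λ _ _ → c-flat)
      (≤-trans (≤-reflexive (*-identityʳ _)) (≤1* upTo≤)))

    module _ {R : Ty} (comb : Tm (R ∷ Γₑ {R}) R) where

      branch : ℕ → ⟦ StTy ⇒ R ⟧ → ⟦ StTy ⇒ R ⟧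
      branch j k st = eval (branchT comb) (st ∷ j ∷ k ∷ ρ₃)

      enum : ⟦ StTy ⇒ R ⟧ → List ℕ → ⟦ StTy ⇒ R ⟧
      enum base []      = base
      enum base (j ∷ l) = branch j (enum base l)

      enum-value : ∀ base l → proj₁ (foldrᵀ (λ j k → eval (lam (branchT comb)) (j ∷ k ∷ ρ₃)) base l) ≡ enum base l
      enum-value base []      = refl
      enum-value base (j ∷ l) = cong (branch j) (enum-value base l)

      branch-skip : ∀ {j k st} → allowed st j ≡ false → proj₁ (branch j k st) ≡ proj₁ (k st)
      branch-skip eq rewrite eq = refl

      branch-take : ∀ {j k st} → allowed st j ≡ true → proj₁ (branch j k st) ≡
        proj₁ (eval comb (proj₁ (k (addSt j st)) ∷ proj₁ (k st) ∷ st ∷ j ∷ k ∷ ρ₃))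
      branch-take {j} {k} {st} eq rewrite eq =
        cong (λ s → proj₁ (eval comb (proj₁ (k s) ∷ proj₁ (k st) ∷ st ∷ j ∷ k ∷ ρ₃)))
          (value (addT-value {R} {proj₁ (k st)} {st} {j} {k}))

      private
        skip-cost : ∀ t → suc (suc (1 + (1 + t)) + suc (7 + 1)) * 1 ≡ 13 + t
        skip-cost = solve-∀

        take-cost : ∀ t u A c → suc (suc (1 + (1 + t)) + suc (7 + suc (suc (1 + (A + u)) + c))) * 1 ≡
          15 + c + t + (A + u)
        take-cost = solve-∀

      -- The 60 is dictated by the other case: 15 steps of `branchT` itself and at most 45 for the
      -- combining term. It is the parameter `a` of `Enumeration`, and the cost of one new state is
      -- the parameter `b`.
      branch-skip-time : ∀ {j k st} → allowed st j ≡ false → proj₂ (branch j k st) ≤ 60 + proj₂ (k st)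
      branch-skip-time {j} {k} {st} eq = ≤-trans (≤-trans (bound C) (≤-reflexive (skip-cost t))) (+-monoˡ-≤ t (m≤m+n 13 47))
        where
        t = proj₂ (k st)
        C : Cost 0 (branchT comb) (st ∷ j ∷ k ∷ ρ₃) _
        C = c-let (c-app t c-flat c-flat (≤-reflexive (sym (*-identityʳ t))))
          (c-if c-flat (λ eq′ → ⊥-elim (subst T (trans (sym eq′) eq) _)) (λ _ → c-flat))

      branch-take-time : T (flat comb) → flatCost comb ≤ 45 → ∀ {j k st} → allowed st j ≡ true →
        proj₂ (branch j k st) ≤ 60 + proj₂ (k st) + (addCost * suc q + proj₂ (k (addSt j st)))
      branch-take-time fl f≤ {j} {k} {st} eq = ≤-trans (bound C) (≤-trans
        (≤-reflexive (take-cost t u (addCost * suc q) (flatCost comb)))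
        (+-monoˡ-≤ (addCost * suc q + u) (+-monoˡ-≤ t (+-monoʳ-≤ 15 f≤))))
        where
        t = proj₂ (k st)
        u = proj₂ (k (addSt j st))
        C : Cost 0 (branchT comb) (st ∷ j ∷ k ∷ ρ₃) _
        C = c-let (c-app t c-flat c-flat (≤-reflexive (sym (*-identityʳ t))))
          (c-if {d = suc (suc (1 + (addCost * suc q + u)) + flatCost comb)} c-flat
            (λ _ → c-let (c-app u c-flat (c-rescale addT-cost)
              (≤-reflexive (trans (cong (proj₂ ∘ k) (value (addT-value {R} {proj₁ (k st)} {st} {j} {k}))) (sym (*-identityʳ u)))))
              (c-flat {p = fl}))
            (λ eq′ → ⊥-elim (subst T (trans (sym eq) eq′) _)))

    trie-case : ∀ (P : ⟦ ValTy ⟧ → Set) j k st χ →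
      (allowed st j ≡ true → chosen χ j ≡ true → P (proj₁ (proj₁ (k (addSt j st)) χ))) →
      (allowed st j ≡ true → chosen χ j ≡ false → P (proj₁ (proj₁ (k st) χ))) →
      (allowed st j ≡ false → P (proj₁ (proj₁ (k st) χ))) →
      P (proj₁ (proj₁ (branch trieT j k st) χ))
    trie-case P j k st χ tt tf f = bool-case (allowed st j)
      (λ eq → subst (λ t → P (proj₁ (t χ))) (sym (branch-take trieT {j} {k} {st} eq))
        (subst P (sym (if-proj₁ (chosen χ j))) (bool-case (chosen χ j)
          (λ eq′ → subst P (sym (if-true eq′)) (tt eq eq′))
          (λ eq′ → subst P (sym (if-false eq′)) (tf eq eq′)))))
      (λ eq → subst (λ t → P (proj₁ (t χ))) (sym (branch-skip trieT {j} {k} {st} eq)) (f eq))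
      where
      if-true : ∀ {b} {x y : ⟦ ValTy ⟧} → b ≡ true → (if b then x else y) ≡ x
      if-true refl = refl
      if-false : ∀ {b} {x y : ⟦ ValTy ⟧} → b ≡ false → (if b then x else y) ≡ y
      if-false refl = refl

    Comp : ℕ → ℕ → Set
    Comp j l = T (nth (nth mat j []) l false)

    module Theory (Comp-sym : ∀ {j l} → Comp j l → Comp l j) (Comp-irrefl : ∀ {j} → ¬ Comp j j)
      (Cand : ℕ → Set) (cand<q : ∀ {j} → Cand j → j < q)
      (kk : ℕ) (budget : ∀ {S} → AllPairs Comp S → All Cand S → length S ≤ kk) where

      open Optimum Comp Comp-sym Comp-irrefl (weightOf ms)

      record Represents (st : St) (S : ℕ → Set) : Set where
        field
          chosen⇒  : ∀ {i} → i < q → T (chosen st i) → S i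
          chosen⇐  : ∀ {i} → i < q → S i → T (chosen st i)
          allowed⇒ : ∀ {i} → i < q → T (allowed st i) → CompatibleWith S i
          allowed⇐ : ∀ {i} → i < q → CompatibleWith S i → T (allowed st i)
      open Represents public

      State : St → List ℕ → Set
      State st S = Represents st (_∈ S) × Indep S × All Cand S

      init-represents : Represents initSt (_∈ [])
      init-represents = record
        { chosen⇒  = λ i<q p → ⊥-elim (subst (T ∘ proj₁) (nth-upTo _ i<q) p)
        ; chosen⇐  = λ _ ()
        ; allowed⇒ = λ _ _ _ ()
        ; allowed⇐ = λ i<q _ → subst (T ∘ proj₂) (sym (nth-upTo _ i<q)) _
        }

      add-represents : ∀ {st S} j → Represents st (_∈ S) → Represents (addSt j st) (_∈ j ∷ S)
      add-represents {st} {S} j r = record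
        { chosen⇒  = λ i<q p → c⇒ i<q (subst (T ∘ proj₁) (nth-upTo _ i<q) p)
        ; chosen⇐  = λ i<q p → subst (T ∘ proj₁) (sym (nth-upTo _ i<q)) (c⇐ i<q p)
        ; allowed⇒ = λ i<q p → a⇒ i<q (subst (T ∘ proj₂) (nth-upTo _ i<q) p)
        ; allowed⇐ = λ i<q p → subst (T ∘ proj₂) (sym (nth-upTo _ i<q)) (a⇐ i<q p)
        }
        where
        c⇒ : ∀ {i} → i < q → T (if eqᵇ i j then true else chosen st i) → i ∈ j ∷ S
        c⇒ {i} i<q p with eqᵇ i j in eq
        ... | true  = here (eqᵇ⇒≡ (subst T (sym eq) _))
        ... | false = there (chosen⇒ r i<q p)
        c⇐ : ∀ {i} → i < q → i ∈ j ∷ S → T (if eqᵇ i j then true else chosen st i)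
        c⇐ {i} i<q (here refl) rewrite eqᵇ-refl i = _
        c⇐ {i} i<q (there p) with eqᵇ i j
        ... | true  = _
        ... | false = chosen⇐ r i<q p
        a⇒ : ∀ {i} → i < q → T (if nth (nth mat j []) i false then allowed st i else false) →
          CompatibleWith (_∈ j ∷ S) i
        a⇒ {i} i<q p with nth (nth mat j []) i false in eq
        ... | true  = λ { l (here refl) → subst T (sym eq) _ ; l (there l∈) → allowed⇒ r i<q p l l∈ }
        a⇐ : ∀ {i} → i < q → CompatibleWith (_∈ j ∷ S) i →
          T (if nth (nth mat j []) i false then allowed st i else false)
        a⇐ {i} i<q p with nth (nth mat j []) i false | p j (here refl)
        ... | true  | _ = allowed⇐ r i<q (λ l → p l ∘ there)

      add-state : ∀ {st S j} → State st S → Cand j → T (allowed st j) → State (addSt j st) (j ∷ S)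
      add-state {j = j} (r , i , c) cj a = add-represents j r ,
        All.tabulate (λ {l} l∈ → Comp-sym (allowed⇒ r (cand<q cj) a l l∈)) ∷ i , cj ∷ c

      -- Only k candidates can still be added to S when kk ≤ length S + k.
      module _ {R : Ty} (comb : Tm (R ∷ Γₑ {R}) R) (fl : T (flat comb)) (f≤ : flatCost comb ≤ 45)
        (base : ⟦ StTy ⇒ R ⟧) (N B : ℕ) where
        open Enumeration 60 (addCost * suc q) B renaming (branch to branch-total; skip to skip-total)

        enum-time :
          (∀ {S st k} → State st S → kk ≤ length S + k → proj₂ (base st) + addCost * suc q ≤ total N k) →
          ∀ {l} → All Cand l → ∀ {S st k} → State st S → kk ≤ length S + k →
          proj₂ (enum comb base l st) + addCost * suc q ≤ total (length l + N) k
        enum-time p []       s k≤ = p s k≤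
        enum-time p {j ∷ l} (cj ∷ cl) {S} {st} {k} s k≤ = bool-case (allowed st j) (take k k≤)
          (λ eq → ≤-trans (+-monoˡ-≤ (addCost * suc q) (branch-skip-time comb {j} {enum comb base l} {st} eq))
                (skip-total (length l + N) k {proj₂ (enum comb base l st)} (enum-time p cl s k≤)))
          where
          take : ∀ k → kk ≤ length S + k → allowed st j ≡ true →
            proj₂ (branch comb j (enum comb base l) st) + addCost * suc q ≤ total (suc (length l + N)) k
          -- The budget is used up: choosing `j` would give an independent set of more than `kk`
          -- candidates.
          take zero k≤ eq =
            let _ , i , c = add-state s cj (subst T (sym eq) _)
            in ⊥-elim (<-irrefl refl (≤-trans (budget i c) (subst (kk ≤_) (+-identityʳ (length S)) k≤)))
          take (suc k) k≤ eq = ≤-trans (+-monoˡ-≤ (addCost * suc q) (branch-take-time comb fl f≤ {j} {enum comb base l} {st} eq))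
            (branch-total (length l + N) k {proj₂ (enum comb base l st)} {proj₂ (enum comb base l (addSt j st))}
                  (enum-time p cl s k≤)
              (enum-time p cl (add-state s cj (subst T (sym eq) _)) (subst (kk ≤_) (+-suc (length S) k) k≤)))

      best-value : ∀ {L R st j k} → Val bestT (R ∷ L ∷ st ∷ j ∷ k ∷ ρ₃)
        (better L (weightOf ms j Data.Rational.+ proj₁ R , j ∷ proj₂ R))
      best-value = e-let e-eval (e-if e-eval e-eval e-eval)

      extend-best : ∀ {U} (base : ⟦ TabTy ⟧) → (∀ {st S} → State st S → Best U (_∈ S) (proj₁ (base st))) →
        ∀ {l} → All Cand l → ∀ {st S} → State st S →
        Best (λ j → j ∈ l ⊎ U j) (_∈ S) (proj₁ (enum bestT base l st))
      extend-best base b [] s = best-cong inj₂ (λ { (inj₂ u) → u }) id id (b s)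
      extend-best {U} base b {k ∷ l} (ck ∷ cl) {st} {S} s = bool-case (allowed st k)
        (λ eq → let a = subst T (sym eq) _ in
          subst Target (sym (trans (branch-take bestT {k} {enum bestT base l} {st} eq)
              (value (best-value {proj₁ (enum bestT base l st)} {proj₁ (enum bestT base l
                    (addSt k st))} {st} {k} {enum bestT base l}))))
            (best-cong to from id id (best-branch k (allowed⇒ (proj₁ s) (cand<q ck) a) (extend-best base b cl s)
              (best-cong id id uncons recons (extend-best base b cl (add-state s ck a))))))
        (λ eq → subst Target (sym (branch-skip bestT {k} {enum bestT base l} {st} eq))
          (best-cong to from id id (best-skip k
            (λ c → subst T eq (allowed⇐ (proj₁ s) (cand<q ck) c)) (extend-best base b cl s))))
        where
        Target : ⟦ ValTy ⟧ → Set
        Target = Best (λ j → j ∈ k ∷ l ⊎ U j) (_∈ S)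
        to : ∀ {j} → j ≡ k ⊎ (j ∈ l ⊎ U j) → j ∈ k ∷ l ⊎ U j
        to = [ inj₁ ∘ here , [ inj₁ ∘ there , inj₂ ]′ ]′
        from : ∀ {j} → j ∈ k ∷ l ⊎ U j → j ≡ k ⊎ (j ∈ l ⊎ U j)
        from (inj₁ (here p))  = inj₁ p
        from (inj₁ (there p)) = inj₂ (inj₁ p)
        from (inj₂ u)         = inj₂ (inj₂ u)
        uncons : ∀ {i} → i ∈ k ∷ S → i ≡ k ⊎ i ∈ S
        uncons (here p)  = inj₁ p
        uncons (there p) = inj₂ p
        recons : ∀ {i} → i ≡ k ⊎ i ∈ S → i ∈ k ∷ S
        recons = [ here , there ]′

      -- The table found by enumerating the interface is a trie, followed along the chosen elements.
      lookup-best : ∀ {U} (base : ⟦ StTy ⇒ TabTy ⟧) →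
        (∀ {st S} χ → State st S → Best U (_∈ S) (proj₁ (proj₁ (base st) χ))) →
        ∀ {l} → Unique l → All Cand l → ∀ {st S χ} {X : ℕ → Set} → State st S →
        (∀ {i} → i < q → T (chosen χ i) → X i) → (∀ {i} → i < q → X i → T (chosen χ i)) →
        (∀ {i j} → X i → X j → i ≢ j → Comp i j) →
        (∀ {i j} → i ∈ S → X j → j ∈ l → Comp i j) →
        Best U (λ j → j ∈ S ⊎ (j ∈ l × X j)) (proj₁ (proj₁ (enum trieT base l st) χ))
      lookup-best base b [] [] {χ = χ} s _ _ _ _ = best-cong id id inj₁ (λ { (inj₁ p) → p }) (b χ s)
      lookup-best {U} base b {j ∷ l} (j∉ ∷ u) (cj ∷ cl) {st} {S} {χ} {X} s c⇒ c⇐ indX indS =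
        trie-case Target j (enum trieT base l) st χ take
          (λ _ eq′ → skip (λ x → subst T eq′ (c⇐ (cand<q cj) x)))
          -- The trie has no branch at a member that is incompatible with the current set. Such a
          -- member cannot belong to `X`, which by `indS` is compatible with that set, so the query
          -- loses nothing.
          (λ eq → skip (λ x → subst T eq (allowed⇐ (proj₁ s) (cand<q cj) (λ i i∈ → indS i∈ x (here refl)))))
        where
        L R : ⟦ ValTy ⟧
        L = proj₁ (proj₁ (enum trieT base l st) χ)
        R = proj₁ (proj₁ (enum trieT base l (addSt j st)) χ)

        Target : ⟦ ValTy ⟧ → Set
        Target = Best U (λ i → i ∈ S ⊎ (i ∈ j ∷ l × X i))

        skip : ¬ X j → Target L
        skip ¬xj = best-cong id id to from
          (lookup-best base b u cl {χ = χ} s c⇒ c⇐ indX (λ i x p → indS i x (there p)))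
          where
          to : ∀ {i} → i ∈ S ⊎ (i ∈ l × X i) → i ∈ S ⊎ (i ∈ j ∷ l × X i)
          to = [ inj₁ , (λ (p , x) → inj₂ (there p , x)) ]′
          from : ∀ {i} → i ∈ S ⊎ (i ∈ j ∷ l × X i) → i ∈ S ⊎ (i ∈ l × X i)
          from (inj₁ p)               = inj₁ p
          from (inj₂ (here refl , x)) = ⊥-elim (¬xj x)
          from (inj₂ (there p , x))   = inj₂ (p , x)

        take : allowed st j ≡ true → chosen χ j ≡ true → Target R
        take eq eq′ = best-cong id id to from
          (lookup-best base b u cl {χ = χ} (add-state s cj (subst T (sym eq) _)) c⇒ c⇐ indX ind′)
          where
          xj : X j
          xj = c⇒ (cand<q cj) (subst T (sym eq′) _)
          ind′ : ∀ {i k} → i ∈ j ∷ S → X k → k ∈ l → Comp i k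
          ind′ (here refl) x p = indX xj x (λ { refl → All.lookup j∉ p refl })
          ind′ (there i∈)  x p = indS i∈ x (there p)
          to : ∀ {i} → i ∈ j ∷ S ⊎ (i ∈ l × X i) → i ∈ S ⊎ (i ∈ j ∷ l × X i)
          to (inj₁ (here refl)) = inj₂ (here refl , xj)
          to (inj₁ (there p))   = inj₁ p
          to (inj₂ (p , x))     = inj₂ (there p , x)
          from : ∀ {i} → i ∈ S ⊎ (i ∈ j ∷ l × X i) → i ∈ j ∷ S ⊎ (i ∈ l × X i)
          from (inj₁ p)               = inj₁ (there p)
          from (inj₂ (here refl , x)) = inj₁ (here refl)
          from (inj₂ (there p , x))   = inj₂ (p , x)

    trie-time : ∀ {R L : ⟦ TabTy ⟧} {st j k χ} D → proj₂ (R χ) ≤ D → proj₂ (L χ) ≤ D →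
      proj₂ (proj₁ (eval trieT (R ∷ L ∷ st ∷ j ∷ k ∷ ρ₃)) χ) ≤ 20 + D
    trie-time {R} {L} {st} {j} {k} {χ} D p p′ = ≤-trans (bound C)
      (≤-trans (≤-reflexive (lemma D)) (+-monoˡ-≤ D (m≤m+n 11 9)))
      where
      ρ : Env (StTy ∷ TabTy ∷ Γₑ {TabTy})
      ρ = χ ∷ R ∷ L ∷ st ∷ j ∷ k ∷ ρ₃
      lemma : ∀ D → suc (7 + suc (1 + (1 + D))) * 1 ≡ 11 + D
      lemma = solve-∀
      D≤ : D ≤ D * 1
      D≤ = ≤-reflexive (sym (*-identityʳ D))
      C : Cost 0 (if′ (fst (index (` Data.Fin.# 0) (` Data.Fin.# 4) noSt)) ((` Data.Fin.# 1) · (` Data.Fin.# 0))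
                   ((` Data.Fin.# 2) · (` Data.Fin.# 0))) ρ (suc (7 + suc (1 + (1 + D))))
      C = c-if {ρ = ρ} {c = 7} (c-flat {ρ = ρ})
        (λ _ → c-app {ρ = ρ} D (c-flat {ρ = ρ}) (c-flat {ρ = ρ}) (≤-trans p D≤))
        (λ _ → c-app {ρ = ρ} D (c-flat {ρ = ρ}) (c-flat {ρ = ρ}) (≤-trans p′ D≤))

    -- A query follows a single branch of the trie, with at most one test for each member of the
    -- list, however many sets the trie stores.
    lookup-time : ∀ (base : ⟦ StTy ⇒ TabTy ⟧) → (∀ st χ → proj₂ (proj₁ (base st) χ) ≤ 20) →
      ∀ l st χ → proj₂ (proj₁ (enum trieT base l st) χ) ≤ 20 * suc (length l)
    lookup-time base p []      st χ = p st χ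
    lookup-time base p (j ∷ l) st χ = bool-case (allowed st j)
      (λ eq → subst Target (sym (branch-take trieT {j} {enum trieT base l} {st} eq))
        (≤-trans (trie-time {proj₁ (enum trieT base l (addSt j st))} {proj₁
              (enum trieT base l st)} {st} {j} {enum trieT base l} {χ} D (lookup-time base p l (addSt j st) χ)
                    (lookup-time base p l st χ))
          (≤-reflexive (sym (*-suc 20 (suc (length l)))))))
      (λ eq → subst Target (sym (branch-skip trieT {j} {enum trieT base l} {st} eq))
        (≤-trans (lookup-time base p l st χ) (*-monoʳ-≤ 20 (n≤1+n (suc (length l))))))
      where
      D = 20 * suc (length l)
      Target : ⟦ TabTy ⟧ → Set
      Target t = proj₂ (t χ) ≤ 20 * suc (suc (length l))

-- Dynamic programming over the rooted tree.

module TreeDP where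
  open Programs
  open CostCalculus
  open Fragments
  open UniqueLists
  open Trees
  open Costs
  open Counting
  open Optima
  open Enumerations
  open import Data.Fin using (Fin; toℕ)
  import Data.Fin as Fin
  open import Data.List.Properties using (length-map; length-++; length-tabulate; filter-accept; filter-reject; filter-all)
  open import Data.List.Membership.Propositional.Properties using (∈-filter⁺; ∈-filter⁻; ∈-++⁺ʳ)
  open import Data.Nat using (ℕ; zero; suc; pred; _+_; _*_; _≤_; _<_; z≤n; s≤s; s≤s⁻¹)
  open import Data.Nat.Properties
  import Data.Nat
  open import Data.Nat.Tactic.RingSolver using (solve-∀)
  open import Data.Rational using (0ℚ)
  import Data.Rational
  open import Relation.Nullary.Decidable using (decidable-stable)

  joinCost tabCost : ℕ
  joinCost = 100
  tabCost  = 170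

  unique-++ : ∀ {A : Set} (xs : List A) {ys} → Unique (xs ++ ys) → Unique ys × (∀ {y} → y ∈ ys → y ∉ xs)
  unique-++ []       u        = u , λ _ ()
  unique-++ (x ∷ xs) (x∉ ∷ u) with unique-++ xs u
  ... | u′ , d = u′ , λ { y∈ (here refl) → All.lookup x∉ (∈-++⁺ʳ xs y∈) refl ; y∈ (there y∈′) → d y∈ y∈′ }

  -- It keeps the interface and the extension of a node together within one list of length at most
  -- `q`; bounding them separately would double the number of elements in the count of subsets.
  length-disjoint-filters : ∀ {A : Set} (f g : A → Bool) xs →
    length (filterᵇ (λ x → f x ∧ g x) xs) + length (filterᵇ (λ x → f x ∧ not (g x)) xs) ≤ length xs
  length-disjoint-filters f g [] = z≤n
  length-disjoint-filters f g (x ∷ xs) with f x | g x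
  ... | true  | true  = s≤s (length-disjoint-filters f g xs)
  ... | true  | false = subst (_≤ suc (length xs)) (sym (+-suc _ _)) (s≤s (length-disjoint-filters f g xs))
  ... | false | _     = m≤n⇒m≤1+n (length-disjoint-filters f g xs)

  -- The amortisation. The cost `x` of a node grows with its number `d` of children, but each
  -- child's subtree has left a credit `K` unspent. These d credits absorb all but one of the d + 1
  -- units; the new allowance `2 * K` pays for the last unit and for the credit passed upwards. The
  -- 40 covers the 25 steps per neighbour and the 10 steps around the loop.
  node-arith : ∀ c q d n u l x K → 1 ≤ q * n → K ≡ (40 + c) * (q * n) →
    l + K * d ≤ 25 * suc d + 2 * K * u → x ≤ c * (q * suc d * n) → suc (9 + l + x) + K ≤ 2 * K * suc u
  node-arith c q d n u l x K z≥1 refl l≤ x≤ = +-cancelʳ-≤ (K * d) _ _ (begin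
    10 + l + x + K + K * d                            ≡⟨ lemma l x K (K * d) ⟩
    (l + K * d) + (10 + x + K)                        ≤⟨ +-mono-≤ l≤ (+-monoˡ-≤ K (+-mono-≤ (m≤m*n 10 (suc d)) x≤)) ⟩
    25 * suc d + 2 * K * u + (10 * suc d + c * (q * suc d * n) + K)
                                                      ≡⟨ lemma′ c q d n u K ⟩
    35 * suc d + (c * z * suc d + K + 2 * K * u)
      ≤⟨ +-monoˡ-≤ (c * z * suc d + K + 2 * K * u) (*-mono-≤ (m≤m+n 35 5) (m≤n*m (suc d) z {{Data.Nat.>-nonZero z≥1}})) ⟩
    40 * (z * suc d) + (c * z * suc d + K + 2 * K * u) ≡⟨ lemma″ c z d u ⟩
    2 * K * suc u + K * d ∎)
    where
    open ≤-Reasoning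
    z = q * n
    lemma : ∀ l t K m → 10 + l + t + K + m ≡ (l + m) + (10 + t + K)
    lemma = solve-∀
    lemma′ : ∀ c q d n u K → 25 * suc d + 2 * K * u + (10 * suc d + c * (q * suc d * n) + K) ≡
      35 * suc d + (c * (q * n) * suc d + K + 2 * K * u)
    lemma′ = solve-∀
    lemma″ : ∀ c z d u → 40 * (z * suc d) + (c * z * suc d + (40 + c) * z + 2 * ((40 + c) * z) * u) ≡
      2 * ((40 + c) * z) * suc u + (40 + c) * z * d
    lemma″ = solve-∀

  module DP (h q : ℕ) (mat : ⟦ MatTy ⟧) (ms : List ⟦ MemberTy ⟧) (input : ⟦ InputTy ⟧) (i₀ : ℕ) (acc₀ : ⟦ ValTy ⟧)
    (C : List Bool) (bags : List (List Bool)) (J : List ℕ) {s : ℕ} (𝑇 : Graph s) (isTree : IsTree 𝑇) where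

    open RootedTree 𝑇 isTree

    cov : ⟦ CoverTy ⟧
    cov = C , encodeLists 𝑇 , bags

    meets : ℕ → ℕ → Bool
    meets a j = meetsᵇ (nth bags a []) (vertices ms j)

    Meets : ℕ → ℕ → Set
    Meets a j = T (meets a j)

    Comp : ℕ → ℕ → Set
    Comp j l = T (nth (nth mat j []) l false)

    nodeEnv : ℕ → Fin s → ⟦ nat ⊗ nat ⇒ TabTy ⟧ → Env Γ₀
    nodeEnv p v F = (toℕ v , p) ∷ F ∷ J ∷ cov ∷ i₀ ∷ acc₀ ∷ mat ∷ upTo q ∷ ms ∷ input ∷ []

    -- These hypotheses are the whole interface to the graph, so that the dynamic program deals with
    -- numbers and bits only. `budget` comes from the independence number of the bags, `separated`
    -- from the connectedness of the subgraphs and their subtrees, `covered` from the vertices and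
    -- edges lying in bags, and `isNode` from the empty default bag.
    module Correct
      (small : ∀ j → length (vertices ms j) ≤ h)
      (J<q : All (_< q) J) (J-unique : Unique J)
      (Comp-sym : ∀ {j l} → Comp j l → Comp l j) (Comp-irrefl : ∀ {j} → ¬ Comp j j)
      (kk : ℕ)
      (budget : ∀ (v : Fin s) {S} → AllPairs Comp S → All (λ j → j ∈ J × Meets (toℕ v) j) S → length S ≤ kk)
      (separated : ∀ {k p v us} → Rooted k p v us → ∀ {j x y} → j ∈ J → x ∈ us → y ∉ us →
        Meets (toℕ x) j → Meets (toℕ y) j → Meets (toℕ v) j × Meets p j)
      (covered : ∀ {j l} → j ∈ J → l ∈ J → ¬ Comp j l → ∃ λ (x : Fin s) → Meets (toℕ x) j × Meets (toℕ x) l)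
      (isNode : ∀ {p j} → Meets p j → ∃ λ (y : Fin s) → toℕ y ≡ p)
      where

      open Optimum Comp (λ {j} {l} → Comp-sym {j} {l}) (λ {j} → Comp-irrefl {j}) (weightOf ms)

      Comp? : ∀ j l → Dec (Comp j l)
      Comp? j l = T? _

      |J|≤q : length J ≤ q
      |J|≤q = length-unique-< J-unique J<q

      -- As the nodes met by a member are connected, for a rooted part `us` with parent `p` these
      -- are the members all of whose nodes lie in `us`.
      Below : ℕ → List (Fin s) → ℕ → Set
      Below p us j = j ∈ J × ¬ Meets p j × Any (λ x → Meets (toℕ x) j) us

      -- The query may contain any independent choice, such as the one made at the parent's bag.
      -- Only the chosen members meeting both bags appear in the result, because the others cannot
      -- conflict with a member that lives below.
      record TabOK (p : ℕ) (v : Fin s) (us : List (Fin s)) (tab : ⟦ TabTy ⟧) : Set where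
        field
          lookupBest : ∀ {χ S} → (∀ {i} → i < q → T (chosen χ i) → i ∈ S) →
            (∀ {i} → i < q → i ∈ S → T (chosen χ i)) → Indep S →
            Best (Below p us) (λ l → l ∈ S × l ∈ J × Meets (toℕ v) l × Meets p l) (proj₁ (tab χ))
          lookupTime : ∀ χ → proj₂ (tab χ) ≤ 20 * suc q
      open TabOK

      data KidsOK (v : Fin s) : List (Fin s) → List ⟦ TabTy ⟧ → Set where
        []  : KidsOK v [] []
        kid : ∀ {k c us tab us′ tabs} → Rooted k (toℕ v) c us → Parent (toℕ v) c →
          TabOK (toℕ v) c us tab → (∀ {y} → y ∈ us′ → y ∉ us) → KidsOK v us′ tabs →
          KidsOK v (us ++ us′) (tab ∷ tabs)

      best-length : ∀ {U S v} → (∀ {j} → U j → j ∈ J) → Best U S v → length (proj₂ v) ≤ q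
      best-length f b = length-unique-< (indep⇒unique (indep b)) (All.map (λ u → All.lookup J<q (f u)) (inU b))

      module AtNode {k p : ℕ} {v : Fin s} {us : List (Fin s)} (R : Rooted k p v (v ∷ us)) (par : Parent p v)
        (tabs : List ⟦ TabTy ⟧) (F : ⟦ nat ⊗ nat ⇒ TabTy ⟧) (kidsOK : KidsOK v us tabs) where

        js ks : List ℕ
        js = filterᵇ (λ j → meets (toℕ v) j ∧ meets p j) J
        ks = filterᵇ (λ j → meets (toℕ v) j ∧ not (meets p j)) J

        Cand : ℕ → Set
        Cand j = j ∈ J × Meets (toℕ v) j

        open Enumerate q mat ms ks js (nth bags p []) (nth bags (toℕ v) []) tabs (toℕ v , p) F J cov i₀ acc₀ input
          hiding (Comp)
        open Theory (λ {j} {l} → Comp-sym {j} {l}) (λ {j} → Comp-irrefl {j}) Cand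
          (λ (j∈ , _) → All.lookup J<q j∈) kk (budget v)

        join : ⟦ TabTy ⟧ → ⟦ ValTy ⟧ → St → Timed ⟦ ValTy ⟧
        join t a st = eval joinT (t ∷ a ∷ st ∷ ρ₃)

        join-value : ∀ {t a st} → Val joinT (t ∷ a ∷ st ∷ ρ₃)
          (proj₁ (proj₁ (t st)) Data.Rational.+ proj₁ a , proj₂ (proj₁ (t st)) ++ proj₂ a)
        join-value {t} {a} {st} = e-let e-eval (e-pair e-eval
          (e-≡ (append (proj₂ (proj₁ (t st)))) (e-fold (λ x c → x ∷ c) e-eval e-eval (λ _ _ → e-eval))))
          where
          append : ∀ (xs : List ℕ) {ys} → foldr (λ x c → x ∷ c) ys xs ≡ xs ++ ys
          append []       = refl
          append (x ∷ xs) = cong (x ∷_) (append xs)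

        join-time : ∀ {t a st} → proj₂ (t st) ≤ 20 * suc q → length (proj₂ (proj₁ (t st))) ≤ q →
          proj₂ (join t a st) ≤ joinCost * suc q
        join-time {t} {a} {st} p l = bound C′
          where
          C′ : Cost q joinT (t ∷ a ∷ st ∷ ρ₃) joinCost
          C′ = c-≤ (c-let (c-app 20 c-flat c-flat p) (c-pair c-flat (c-fold {y = 0} 1 c-flat c-flat (λ _ _ → c-flat)
            (≤-trans (≤-reflexive (*-identityʳ _)) (≤-trans (m≤n⇒m≤1+n l) (≤-reflexive (sym (*-identityˡ (suc q)))))))))

        leafOf : List ⟦ TabTy ⟧ → St → Timed ⟦ ValTy ⟧
        leafOf ts st = foldrᵀ (λ t a → join t a st) (0ℚ , []) ts

        -- Once the choice `S` at the bag of `v` is fixed, the parts below different children no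
        -- longer interact, so their optima are joined one child at a time.
        leaf-best : ∀ {st S} → State st S → ∀ {us′ ts} → KidsOK v us′ ts →
          Best (Below (toℕ v) us′) (_∈ S) (proj₁ (leafOf ts st)) × proj₂ (leafOf ts st) ≤ length ts * (joinCost * suc q)
        leaf-best s [] = best-empty (λ { (_ , _ , ()) }) , z≤n
        leaf-best {st} {S} s@(r , i , c) (kid {c = x} {us₁} {t} {us₂} {ts} Rx parx ok disjoint rest) =
          subst Target (sym (value (join-value {t} {proj₁ (leafOf ts st)} {st}))) joined ,
          ≤-trans (+-mono-≤ (proj₂ rec) (join-time {t} {proj₁ (leafOf ts st)} {st} (lookupTime ok st) (best-length proj₁ first)))
            (≤-reflexive (+-comm (length ts * (joinCost * suc q)) (joinCost * suc q)))
          where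
          Target : ⟦ ValTy ⟧ → Set
          Target = Best (Below (toℕ v) (us₁ ++ us₂)) (_∈ S)

          S₁ : ℕ → Set
          S₁ l = l ∈ S × l ∈ J × Meets (toℕ x) l × Meets (toℕ v) l

          rec = leaf-best s rest
          first : Best (Below (toℕ v) us₁) S₁ (proj₁ (t st))
          first = lookupBest ok (chosen⇒ r) (chosen⇐ r) i

          v∉ : v ∉ us₁
          v∉ v∈ = rooted-off Rx parx v∈ refl

          confined : ∀ {j y} → Below (toℕ v) us₁ j → Meets (toℕ y) j → y ∈ us₁
          confined {j} {y} (j∈ , ¬mv , m) my = decidable-stable (Any.any? (y Fin.≟_) us₁) λ y∉ →
            let (z , z∈ , mz) = find m in ¬mv (proj₂ (separated Rx j∈ z∈ y∉ mz my))

          -- A chosen `l` in conflict with `j` shares a bag with it, and that bag lies below `x`.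
          -- Since `l` also meets the bag of `v`, it crosses the edge between `x` and `v`; hence it
          -- belongs to the interface and was taken into account.
          compatible-all : ∀ {j} → Below (toℕ v) us₁ j → CompatibleWith S₁ j → CompatibleWith (_∈ S) j
          compatible-all {j} b cj l l∈ = decidable-stable (Comp? l j) λ ¬lj →
            let (l∈J , mvl) = All.lookup c l∈
                (y , myl , myj) = covered l∈J (proj₁ b) ¬lj
                (mxl , _) = separated Rx l∈J (confined b myj) v∉ myl mvl
            in ¬lj (cj l (l∈ , l∈J , mxl , mvl))

          -- A conflict would give a common bag below `x`. As `l` also meets a bag below another
          -- child, it would have to pass through `v`, which it does not meet.
          cross : ∀ {j l} → Below (toℕ v) us₁ j → Below (toℕ v) us₂ l → Comp j l
          cross {j} {l} b (l∈ , ¬mv , m) = decidable-stable (Comp? j l) λ ¬jl →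
            let (y , myj , myl) = covered (proj₁ b) l∈ ¬jl
                (z , z∈ , mz) = find m
            in ¬mv (proj₂ (separated Rx l∈ (confined b myj) (disjoint z∈) myl mz))

          joined : Target (proj₁ (proj₁ (t st)) Data.Rational.+ proj₁ (proj₁ (leafOf ts st)) ,
                           proj₂ (proj₁ (t st)) ++ proj₂ (proj₁ (leafOf ts st)))
          joined = best-join (λ j → Any.any? (λ x → T? (meets (toℕ x) j)) us₁)
            (λ (a , b , m) → a , b , Any.++⁺ˡ m) (λ (a , b , m) → a , b , Any.++⁺ʳ us₁ m)
            (λ (a , b , _) m → a , b , m)
            (λ (a , b , m) ¬m → a , b , [ (λ m₁ → contradiction m₁ ¬m) , id ]′ (Any.++⁻ us₁ m))
            proj₁ compatible-all cross first (proj₁ rec)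

        leaf extend : ⟦ TabTy ⟧
        leaf st   = eval (foldList (` Fin.# 5) noVal joinT) (st ∷ ρ₃)
        extend    = enum bestT leaf ks

        const : ⟦ StTy ⇒ TabTy ⟧
        const st = eval holdT (st ∷ extend ∷ ρ₃)

        table : ⟦ TabTy ⟧
        table = proj₁ (enum trieT const js initSt)

        js-cand : All Cand js
        js-cand = All.tabulate λ j∈ →
          let (j∈J , m) = ∈-filter⁻ (T? ∘ (λ j → meets (toℕ v) j ∧ meets p j)) {xs = J} j∈
          in j∈J , proj₁ (Equivalence.to T-∧ m)

        ks-cand : All Cand ks
        ks-cand = All.tabulate λ j∈ →
          let (j∈J , m) = ∈-filter⁻ (T? ∘ (λ j → meets (toℕ v) j ∧ not (meets p j))) {xs = J} j∈
          in j∈J , proj₁ (Equivalence.to T-∧ m)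

        T-not : ∀ {b} → T (not b) → ¬ T b
        T-not {false} _ ()

        not-T : ∀ {b} → ¬ T b → T (not b)
        not-T {false} _ = _
        not-T {true}  p = p _

        initial-state : State initSt []
        initial-state = init-represents , [] , []

        const-best : ∀ {st S} χ → State st S →
          Best (λ j → j ∈ ks ⊎ Below (toℕ v) us j) (_∈ S) (proj₁ (proj₁ (const st) χ))
        const-best χ s = extend-best leaf (λ s → proj₁ (leaf-best s kidsOK)) ks-cand s

        table-best : ∀ {χ S} → (∀ {i} → i < q → T (chosen χ i) → i ∈ S) →
          (∀ {i} → i < q → i ∈ S → T (chosen χ i)) → Indep S →
          Best (Below p (v ∷ us)) (λ l → l ∈ S × l ∈ J × Meets (toℕ v) l × Meets p l) (proj₁ (table χ))
        table-best {χ} {S} c⇒ c⇐ indS = best-cong to from sTo sFrom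
          (lookup-best const const-best (Unique.filter⁺ (T? ∘ (λ j → meets (toℕ v) j ∧ meets p j)) J-unique) js-cand
            {χ = χ} {X = _∈ S} initial-state c⇒ c⇐ (pairwise (λ {j} {l} → Comp-sym {j} {l}) indS) (λ ()))
          where
          -- A member meeting a bag strictly below `v` and the bag of the parent crosses the edge to
          -- the parent and therefore meets the bag of `v`.
          ¬parent : ∀ {j} → Below (toℕ v) us j → ¬ Meets p j
          ¬parent {j} (j∈ , ¬mv , m) mp =
            let (z , z∈ , mz) = find m
                (y , y≡p) = isNode {p} {j} mp
            in ¬mv (proj₁ (separated R j∈ (there z∈) (λ y∈ → rooted-off R par y∈ y≡p) mz
                 (subst (λ a → Meets a j) (sym y≡p) mp)))

          to : ∀ {j} → j ∈ ks ⊎ Below (toℕ v) us j → Below p (v ∷ us) j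
          to {j} (inj₁ j∈) =
            let (j∈J , m) = ∈-filter⁻ (T? ∘ (λ j → meets (toℕ v) j ∧ not (meets p j))) {xs = J} j∈
                (mv , ¬mp) = Equivalence.to (T-∧ {meets (toℕ v) j}) m
            in j∈J , T-not ¬mp , here mv
          to (inj₂ b@(j∈ , _ , m)) = j∈ , ¬parent b , there m

          from : ∀ {j} → Below p (v ∷ us) j → j ∈ ks ⊎ Below (toℕ v) us j
          from {j} (j∈ , ¬mp , m) with T? (meets (toℕ v) j)
          ... | yes mv = inj₁ (∈-filter⁺ (T? ∘ (λ j → meets (toℕ v) j ∧ not (meets p j))) j∈
                  (Equivalence.from (T-∧ {meets (toℕ v) j}) (mv , not-T ¬mp)))
          ... | no ¬mv with m
          ... | here mv  = ⊥-elim (¬mv mv)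
          ... | there m′ = inj₂ (j∈ , ¬mv , m′)

          sTo : ∀ {j} → j ∈ [] ⊎ (j ∈ js × j ∈ S) → j ∈ S × j ∈ J × Meets (toℕ v) j × Meets p j
          sTo {j} (inj₂ (j∈js , j∈S)) =
            let (j∈J , m) = ∈-filter⁻ (T? ∘ (λ j → meets (toℕ v) j ∧ meets p j)) {xs = J} j∈js
            in j∈S , j∈J , Equivalence.to (T-∧ {meets (toℕ v) j}) m

          sFrom : ∀ {j} → j ∈ S × j ∈ J × Meets (toℕ v) j × Meets p j → j ∈ [] ⊎ (j ∈ js × j ∈ S)
          sFrom {j} (j∈S , j∈J , m) = inj₂
            (∈-filter⁺ (T? ∘ (λ j → meets (toℕ v) j ∧ meets p j)) j∈J (Equivalence.from (T-∧ {meets (toℕ v) j}) m) , j∈S)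

        d : ℕ
        d = length tabs

        -- The 5 is the cost of the fold without its iterations, followed by one join per child; the
        -- last summand is the surplus required by the invariant of `Enumeration`.
        B : ℕ
        B = 5 + d * (joinCost * suc q) + addCost * suc q

        leaf-time : ∀ {S st k} → State st S → kk ≤ length S + k →
          proj₂ (leaf st) + addCost * suc q ≤ Enumeration.total 60 (addCost * suc q) B 0 k
        leaf-time {st = st} s _ = ≤-trans (+-monoˡ-≤ (addCost * suc q) (+-monoʳ-≤ 5 (proj₂ (leaf-best s kidsOK))))
          (≤-reflexive (sym (*-identityʳ B)))

        -- The enumeration of `ks` is the base case of the enumeration of `js` and runs with
        -- whatever budget the latter has left. Taking `length ks` as the offset makes the two count
        -- as one enumeration. The 5 added to `B` is the overhead of `holdT`.
        const-time : ∀ {S st k} → State st S → kk ≤ length S + k →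
          proj₂ (const st) + addCost * suc q ≤ Enumeration.total 60 (addCost * suc q) (B + 5) (length ks) k
        const-time {S} {st} {k} s k≤ = begin
          proj₂ (const st) + b                            ≤⟨ +-monoˡ-≤ b (bound hold) ⟩
          suc (suc (1 + (1 + t)) + 1) * 1 + b             ≡⟨ lemma t b ⟩
          5 + (t + b)                                     ≤⟨ +-mono-≤ (m≤m*n 5 c {{>-nonZero′ (cnt≥1 (length ks) k)}}) ih ⟩
          5 * c + (60 * length ks + B) * c                ≡⟨ lemma′ c (length ks) B ⟩
          (60 * length ks + (B + 5)) * c                  ∎
          where
          open ≤-Reasoning
          open import Data.Nat.Base using () renaming (>-nonZero to >-nonZero′)
          b = addCost * suc q
          t = proj₂ (extend st)
          c = cnt (length ks) k
          ih : t + b ≤ (60 * length ks + B) * c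
          ih = subst (λ n → t + b ≤ Enumeration.total 60 b B n k) (+-identityʳ (length ks))
            (enum-time bestT _ (≤ᵇ⇒≤ (flatCost bestT) 45 _) leaf 0 B leaf-time ks-cand s k≤)
          hold : Cost 0 holdT (st ∷ extend ∷ ρ₃) (suc (suc (1 + (1 + t)) + 1))
          hold = c-let (c-app t c-flat c-flat (≤-reflexive (sym (*-identityʳ t)))) c-flat
          lemma : ∀ t b → suc (suc (1 + (1 + t)) + 1) * 1 + b ≡ 5 + (t + b)
          lemma = solve-∀
          lemma′ : ∀ c n B → 5 * c + (60 * n + B) * c ≡ (60 * n + (B + 5)) * c
          lemma′ = solve-∀

        |js|+|ks|≤q : length js + length ks ≤ q
        |js|+|ks|≤q = ≤-trans (length-disjoint-filters (meets (toℕ v)) (meets p) J) |J|≤q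

        table-time : proj₂ (enum trieT const js initSt) ≤ tabCost * (suc q * suc d * cnt q kk)
        table-time = begin
          proj₂ (enum trieT const js initSt)               ≤⟨ m≤m+n _ (addCost * suc q) ⟩
          proj₂ (enum trieT const js initSt) + addCost * suc q
            ≤⟨ enum-time trieT _ (≤ᵇ⇒≤ (flatCost trieT) 45 _) const (length ks)
                  (B + 5) const-time js-cand {k = kk} initial-state ≤-refl ⟩
          (60 * n + (B + 5)) * cnt n kk                    ≤⟨ *-mono-≤ (+-monoˡ-≤ (B + 5)
                (*-monoʳ-≤ 60 |js|+|ks|≤q)) (cnt-mono kk |js|+|ks|≤q) ⟩
          (60 * q + (B + 5)) * cnt q kk                    ≤⟨ *-monoˡ-≤ (cnt q kk) linear ⟩
          (tabCost * (suc q * suc d)) * cnt q kk           ≡⟨ *-assoc tabCost (suc q * suc d) (cnt q kk) ⟩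
          tabCost * (suc q * suc d * cnt q kk)             ∎
          where
          open ≤-Reasoning
          n = length js + length ks
          -- The second bracket is slack that completes the bound to a multiple of (q + 1)(d + 1).
          -- This determines `tabCost` = 170.
          lemma : ∀ q d → 60 * q + (5 + d * (100 * suc q) + 100 * suc q + 5) + (60 + 60 *
                (d * suc q) + 10 * q + 10 * (d * suc q) )
            ≡ 170 * (suc q * suc d)
          lemma = solve-∀
          linear : 60 * q + (B + 5) ≤ tabCost * (suc q * suc d)
          linear = subst (60 * q + (B + 5) ≤_) (lemma q d) (m≤m+n _ _)

        interface-value : Val interfaceT ρ₃ (enum trieT const js)
        interface-value = val (trans (enum-value trieT (proj₁ (eval constT ρ₃)) js)
          (cong (λ e → enum trieT (λ st → eval holdT (st ∷ e ∷ ρ₃)) js) (enum-value bestT leaf ks)))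

        init-value : Val initT ρ₃ initSt
        init-value = initT-value q

        table-value : Val tableT (tabs ∷ nodeEnv p v F) table
        table-value = e-let e-eval (e-let e-eval (e-let jsT-value (e-let ksT-value
          (e-app interface-value init-value))))

        tableOK : TabOK p v (v ∷ us) table
        tableOK = record
          { lookupBest = table-best
          ; lookupTime = λ χ → ≤-trans (lookup-time const (λ _ _ → s≤s z≤n) js initSt χ)
              (*-monoʳ-≤ 20 (s≤s (≤-trans (m≤m+n (length js) (length ks)) |js|+|ks|≤q)))
          }

        private
          Y : ℕ
          Y = suc q * suc d * cnt q kk

          X≤Y : suc q ≤ Y
          X≤Y = ≤-trans (m≤m*n (suc q) (suc d)) (m≤m*n (suc q * suc d) (cnt q kk) {{Data.Nat.>-nonZero (cnt≥1 q kk)}})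

          bounded : ∀ z → suc z ≡ Y → Cost z tableT (tabs ∷ nodeEnv p v F) (proj₁ (tableT-cost h tabCost))
          bounded z sz≡ = proj₂ (tableT-cost h tabCost) q jsT-value ksT-value small
            (≤-trans |J|≤q q≤) (s≤s⁻¹ X≤) (≤-trans (≤-trans (m≤m+n (length js) (length ks)) |js|+|ks|≤q) q≤)
            (≤-trans (≤-trans (m≤n+m (length ks) (length js)) |js|+|ks|≤q) q≤) spent
            where
            X≤ : suc q ≤ suc z
            X≤ = subst (suc q ≤_) (sym sz≡) X≤Y
            q≤ : q ≤ suc z
            q≤ = ≤-trans (n≤1+n q) X≤
            spent : proj₂ (proj₁ (eval interfaceT ρ₃) (proj₁ (eval initT ρ₃))) ≤ tabCost * suc z
            spent = subst₂ (λ f st → proj₂ (f st) ≤ tabCost * suc z) (sym (value interface-value)) (sym (value init-value))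
              (subst (λ n → proj₂ (enum trieT const js initSt) ≤ tabCost * n) (sym sz≡) table-time)

        evalOK : TabOK p v (v ∷ us) (proj₁ (eval tableT (tabs ∷ nodeEnv p v F)))
        evalOK = subst (TabOK p v (v ∷ us)) (sym (value table-value)) tableOK

        time-bound : proj₂ (eval tableT (tabs ∷ nodeEnv p v F)) ≤
          proj₁ (tableT-cost h tabCost) * (suc q * suc d * cnt q kk)
        time-bound = subst (λ n → proj₂ (eval tableT (tabs ∷ nodeEnv p v F)) ≤ proj₁ (tableT-cost h tabCost) * n)
          sz≡ (bound (bounded (pred Y) sz≡))
          where
          sz≡ : suc (pred Y) ≡ Y
          sz≡ = suc-pred Y {{Data.Nat.>-nonZero (≤-trans (s≤s z≤n) X≤Y)}}

      abstract
        K : ℕ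
        K = (40 + proj₁ (tableT-cost h tabCost)) * (suc q * cnt q kk)

        K-def : K ≡ (40 + proj₁ (tableT-cost h tabCost)) * (suc q * cnt q kk)
        K-def = refl

      -- `K` is the credit of `node-arith`: of the allowance `2 * K` per node, a subtree keeps one
      -- `K` for the node above it.
      NodeOK : ℕ → ⟦ nat ⊗ nat ⇒ TabTy ⟧ → Set
      NodeOK k F = ∀ {p v us} → Rooted k p v us → Parent p v →
        TabOK p v us (proj₁ (F (toℕ v , p))) × proj₂ (F (toℕ v , p)) + K ≤ 2 * K * length us

      TableOK : Tm (list TabTy ∷ Γ₀) TabTy → Set
      TableOK u = ∀ {k p v us} F {tabs} → Rooted (suc k) p v (v ∷ us) → Parent p v → KidsOK v us tabs →
        TabOK p v (v ∷ us) (proj₁ (eval u (tabs ∷ nodeEnv p v F))) ×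
        proj₂ (eval u (tabs ∷ nodeEnv p v F)) ≤ proj₁ (tableT-cost h tabCost) * (suc q * suc (length tabs) * cnt q kk)

      module Step {k : ℕ} (F : ⟦ nat ⊗ nat ⇒ TabTy ⟧) (nodeOK : NodeOK k F) (p : ℕ) (v : Fin s) where

        kid-value : ∀ {c acc} → Val kidT (c ∷ acc ∷ nodeEnv p v F) (if eqᵇ c p then acc else (proj₁ (F (c , toℕ v)) ∷ acc))
        kid-value = e-if (e-let e-eval (e-let e-eval eqT-value)) e-eval e-eval

        kid-test : ∀ {c acc} → Val isParentT (c ∷ acc ∷ nodeEnv p v F) (eqᵇ c p)
        kid-test = e-let e-eval (e-let e-eval eqT-value)

        kid-skip-time : ∀ {c acc} → c ≡ p → proj₂ (eval kidT (c ∷ acc ∷ nodeEnv p v F)) ≤ 25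
        kid-skip-time {c} {acc} refl = ≤-trans (bound cost′) (m≤m+n 15 10)
          where
          cost′ : Cost 0 kidT (c ∷ acc ∷ nodeEnv p v F) 15
          cost′ = c-if c-flat (λ _ → c-flat)
            (λ eq → ⊥-elim (subst T (trans (sym (eqᵇ-refl c)) (trans (sym (value (kid-test {c} {acc}))) eq)) _))

        kid-take-time : ∀ {c acc} → c ≢ p → proj₂ (eval kidT (c ∷ acc ∷ nodeEnv p v F)) ≤ 25 + proj₂ (F (c , toℕ v))
        kid-take-time {c} {acc} c≢p = ≤-trans (bound cost′) (≤-trans (≤-reflexive (*-identityʳ (22 + t)))
              (+-monoˡ-≤ t (m≤m+n 22 3)))
          where
          t = proj₂ (F (c , toℕ v))
          numeral : ∀ t → suc (13 + suc (suc (1 + (4 + t)) + 1)) ≡ 22 + t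
          numeral = solve-∀
          cost′ : Cost 0 kidT (c ∷ acc ∷ nodeEnv p v F) (22 + t)
          cost′ = subst (Cost 0 kidT (c ∷ acc ∷ nodeEnv p v F)) (numeral t) (c-if c-flat
            (λ eq → ⊥-elim (subst T (trans (sym eq) (trans (value (kid-test {c} {acc})) (eqᵇ-≢ c≢p))) _))
            (λ _ → c-cons (c-app t c-flat c-flat (≤-reflexive (sym (*-identityʳ t)))) c-flat))

        loop : List (Fin s) → Timed (List ⟦ TabTy ⟧)
        loop ns = foldrᵀ (λ c acc → eval kidT (c ∷ acc ∷ nodeEnv p v F)) [] (map toℕ ns)

        other? : (c : Fin s) → Dec (toℕ c ≢ p)
        other? c = ¬? (toℕ c ≟ p)

        LoopOK : List (Fin s) → List (Fin s) → List (Fin s) → Timed (List ⟦ TabTy ⟧) → Set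
        LoopOK ns cs us r = KidsOK v us (proj₁ r) × length (proj₁ r) ≡ length cs ×
          proj₂ r + K * length cs ≤ 25 * length ns + 2 * K * length us

        dec-case : ∀ {A B : Set} → Dec A → (A → B) → (¬ A → B) → B
        dec-case (yes a) f g = f a
        dec-case (no ¬a) f g = g ¬a

        loop-ok : ∀ ns {us} → Forest k (toℕ v) (filter other? ns) us → Unique us → All (Graph.Adj 𝑇 v) ns →
          LoopOK ns (filter other? ns) us (loop ns)
        loop-ok []       [] _ _ = [] , refl , ≤-reflexive (cong₂ _+_ {0} {0} refl (trans (*-zeroʳ K) (sym (*-zeroʳ (2 * K)))))
        loop-ok (n ∷ ns) {us} Fs u (vn ∷ vns) = dec-case (toℕ n ≟ p) skip take
          where
          rest : List ⟦ TabTy ⟧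
          rest = proj₁ (loop ns)

          skip : toℕ n ≡ p → LoopOK (n ∷ ns) (filter other? (n ∷ ns)) us (loop (n ∷ ns))
          skip n≡p = subst (λ cs → LoopOK (n ∷ ns) cs us (loop (n ∷ ns))) (sym reject)
            (subst (KidsOK v us) (sym same) ok₁ , trans (cong length same) ok₂ , (begin
              proj₂ (loop ns) + proj₂ (eval kidT (toℕ n ∷ rest ∷ nodeEnv p v F)) + K * m
                ≤⟨ +-monoˡ-≤ (K * m) (+-monoʳ-≤ (proj₂ (loop ns)) (kid-skip-time n≡p)) ⟩
              proj₂ (loop ns) + 25 + K * m                        ≡⟨ lemma (proj₂ (loop ns)) (K * m) ⟩
              25 + (proj₂ (loop ns) + K * m)                      ≤⟨ +-monoʳ-≤ 25 ok₃ ⟩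
              25 + (25 * length ns + 2 * K * length us)           ≡⟨ lemma′ (length ns) (2 * K * length us) ⟩
              25 * suc (length ns) + 2 * K * length us            ∎))
            where
            open ≤-Reasoning
            m = length (filter other? ns)
            reject : filter other? (n ∷ ns) ≡ filter other? ns
            reject = filter-reject other? (λ n≢p → n≢p n≡p)
            rec = loop-ok ns (subst (λ cs → Forest k (toℕ v) cs us) reject Fs) u vns
            ok₁ = proj₁ rec
            ok₂ = proj₁ (proj₂ rec)
            ok₃ = proj₂ (proj₂ rec)
            same : proj₁ (eval kidT (toℕ n ∷ rest ∷ nodeEnv p v F)) ≡ rest
            same = trans (value kid-value) (cong (λ b → if b then rest else (proj₁ (F (toℕ n , toℕ v)) ∷ rest))
              (subst (λ a → eqᵇ (toℕ n) a ≡ true) n≡p (eqᵇ-refl (toℕ n))))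
            lemma : ∀ a b → a + 25 + b ≡ 25 + (a + b)
            lemma = solve-∀
            lemma′ : ∀ a b → 25 + (25 * a + b) ≡ 25 * suc a + b
            lemma′ = solve-∀

          take′ : toℕ n ≢ p → ∀ {us} → Forest k (toℕ v) (n ∷ filter other? ns) us → Unique us →
            LoopOK (n ∷ ns) (n ∷ filter other? ns) us (loop (n ∷ ns))
          take′ n≢p (_∷_ {us = us₁} {us′ = us₂} R Fs′) u′ =
            subst (KidsOK v (us₁ ++ us₂)) (sym same) (kid R parent (proj₁ okn) (proj₂ (unique-++ us₁ u′)) ok₁) ,
            trans (cong length same) (cong suc ok₂) , (begin
              proj₂ (loop ns) + proj₂ (eval kidT (toℕ n ∷ rest ∷ nodeEnv p v F)) + K * suc m
                ≤⟨ +-monoˡ-≤ (K * suc m) (+-monoʳ-≤ (proj₂ (loop ns)) (kid-take-time n≢p)) ⟩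
              proj₂ (loop ns) + (25 + f) + K * suc m                      ≡⟨ lemma (proj₂ (loop ns)) f K m ⟩
              25 + ((proj₂ (loop ns) + K * m) + (f + K))                  ≤⟨ +-monoʳ-≤ 25 (+-mono-≤ ok₃ (proj₂ okn)) ⟩
              25 + ((25 * length ns + 2 * K * length us₂) + 2 * K * length us₁) ≡⟨ lemma′ (length ns) (2 * K)
                    (length us₁) (length us₂) ⟩
              25 * suc (length ns) + 2 * K * (length us₁ + length us₂)
                ≡⟨ cong (λ l → 25 * suc (length ns) + 2 * K * l) (length-++ us₁) ⟨
              25 * suc (length ns) + 2 * K * length (us₁ ++ us₂)          ∎)
            where
            open ≤-Reasoning
            m = length (filter other? ns)
            f = proj₂ (F (toℕ n , toℕ v))
            parent : Parent (toℕ v) n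
            parent y y≡v = subst (Graph.Adj 𝑇 n) (sym (Fin.toℕ-injective y≡v)) (Graph.sym 𝑇 vn)
            okn = nodeOK R parent
            rec = loop-ok ns Fs′ (proj₁ (unique-++ us₁ u′)) vns
            ok₁ = proj₁ rec
            ok₂ = proj₁ (proj₂ rec)
            ok₃ = proj₂ (proj₂ rec)
            same : proj₁ (eval kidT (toℕ n ∷ rest ∷ nodeEnv p v F)) ≡ proj₁ (F (toℕ n , toℕ v)) ∷ rest
            same = trans (value kid-value) (cong (λ b → if b then rest else (proj₁ (F (toℕ n , toℕ v)) ∷ rest)) (eqᵇ-≢ n≢p))
            lemma : ∀ a f K m → a + (25 + f) + K * suc m ≡ 25 + ((a + K * m) + (f + K))
            lemma = solve-∀
            lemma′ : ∀ l k a b → 25 + ((25 * l + k * b) + k * a) ≡ 25 * suc l + k * (a + b)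
            lemma′ = solve-∀

          take : toℕ n ≢ p → LoopOK (n ∷ ns) (filter other? (n ∷ ns)) us (loop (n ∷ ns))
          take n≢p = subst (λ cs → LoopOK (n ∷ ns) cs us (loop (n ∷ ns))) (sym accept)
            (take′ n≢p (subst (λ cs → Forest k (toℕ v) cs us) accept Fs) u)
            where
            accept : filter other? (n ∷ ns) ≡ n ∷ filter other? ns
            accept = filter-accept other? n≢p

        -- The parent is the only neighbour filtered out and occurs once, so the loop over the
        -- neighbours can be charged to the children and one more unit.
        nbrs-length : ∀ {ns} → Unique ns → length ns ≤ suc (length (filter other? ns))
        nbrs-length [] = z≤n
        nbrs-length {n ∷ ns} (n∉ ∷ u) = dec-case (toℕ n ≟ p)
          (λ n≡p → s≤s (≤-reflexive (cong length (sym (trans (filter-reject other? (λ n≢p → n≢p n≡p))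
            (filter-all other? (All.map (λ n≢m m≡p → n≢m (Fin.toℕ-injective (trans n≡p (sym m≡p)))) n∉)))))))
          (λ n≢p → subst (λ l → suc (length ns) ≤ suc (length l)) (sym (filter-accept other? n≢p)) (s≤s (nbrs-length u)))

        nbrs-encoded : nth (encodeLists 𝑇) (toℕ v) [] ≡ map toℕ (nbrs v)
        nbrs-encoded = nth-allFin (λ u → map toℕ (nbrs u)) v

        kids-encoded : foldrᵀ (λ c acc → eval kidT (c ∷ acc ∷ nodeEnv p v F)) [] (nth (encodeLists 𝑇) (toℕ v) []) ≡ loop (nbrs v)
        kids-encoded = cong (foldrᵀ (λ c acc → eval kidT (c ∷ acc ∷ nodeEnv p v F)) []) nbrs-encoded

        let-kids : ∀ {A} (u : Tm (list TabTy ∷ Γ₀) A) → eval (let′ kidsT u) (nodeEnv p v F) ≡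
          (proj₁ (eval u (proj₁ (loop (nbrs v)) ∷ nodeEnv p v F)) ,
           suc (9 + proj₂ (loop (nbrs v)) + proj₂ (eval u (proj₁ (loop (nbrs v)) ∷ nodeEnv p v F))))
        let-kids u = cong (λ r → proj₁ (eval u (proj₁ r ∷ nodeEnv p v F)) , suc (9 + proj₂ r + proj₂ (eval u
              (proj₁ r ∷ nodeEnv p v F)))) kids-encoded

        Good : List (Fin s) → Timed ⟦ TabTy ⟧ → Set
        Good us r = TabOK p v us (proj₁ r) × proj₂ r + K ≤ 2 * K * length us

        -- Stated for a variable u, because the evaluation of tableT would be normalised.
        let-ok : ∀ u → TableOK u → ∀ {us} → Rooted (suc k) p v us → Parent p v →
          Good us (eval (let′ kidsT u) (nodeEnv p v F))
        let-ok u ok R@(node {us = us} Fs) par = subst (Good (v ∷ us)) (sym (let-kids u))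
          (proj₁ (ok F R par ok₁) , arith (proj₂ (eval u (proj₁ (loop (nbrs v)) ∷ nodeEnv p v F))) (proj₂ (ok F R par ok₁)))
          where
          vs : All (Graph.Adj 𝑇 v) (nbrs v)
          vs = All.tabulate (λ n∈ → proj₂ (∈-filter⁻ (λ u → T? (Graph.adj 𝑇 v u)) {xs = allFin s} n∈))
          rec = loop-ok (nbrs v) Fs (AllPairs.tail (rooted-unique R)) vs
          ok₁ = proj₁ rec
          ok₂ = proj₁ (proj₂ rec)
          ok₃ = proj₂ (proj₂ rec)
          l = proj₂ (loop (nbrs v))
          d = length (filter other? (nbrs v))
          cT = proj₁ (tableT-cost h tabCost)
          arith : ∀ x → x ≤ cT * (suc q * suc (length (proj₁ (loop (nbrs v)))) * cnt q kk) →
            suc (9 + l + x) + K ≤ 2 * K * suc (length us)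
          arith x x≤ = node-arith cT (suc q) d (cnt q kk) (length us) l x K
            (*-mono-≤ (s≤s (z≤n {q})) (cnt≥1 q kk)) K-def
            (≤-trans ok₃ (+-monoˡ-≤ (2 * K * length us) (*-monoʳ-≤ 25 (nbrs-length nbrs-unique))))
            (subst (λ m → x ≤ cT * (suc q * suc m * cnt q kk)) ok₂ x≤)
            where
            nbrs-unique : Unique (nbrs v)
            nbrs-unique = Unique.filter⁺ (λ u → T? (Graph.adj 𝑇 v u)) (Unique.allFin⁺ s)

      tableOK : TableOK tableT
      tableOK F {tabs} R par ok = AtNode.evalOK R par tabs F ok , AtNode.time-bound R par tabs F ok

      iterate-ok : ∀ u → TableOK u → ∀ n {k F} → NodeOK k F →
        NodeOK (n + k) (proj₁ (iterateᵀ (λ F → eval (lam (let′ kidsT u))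
              (F ∷ J ∷ cov ∷ i₀ ∷ acc₀ ∷ mat ∷ upTo q ∷ ms ∷ input ∷ [])) n F))
      iterate-ok u t zero    ok = ok
      iterate-ok u t (suc n) {k} {F} ok {p} {v} {us} R = iterate-ok u t n {suc k}
        (λ {p} {v} → Step.let-ok F ok p v u t) (subst (λ m → Rooted m p v us) (sym (+-suc n k)) R)

      level0 : ⟦ nat ⊗ nat ⇒ TabTy ⟧
      level0 = proj₁ (eval startT (J ∷ cov ∷ i₀ ∷ acc₀ ∷ mat ∷ upTo q ∷ ms ∷ input ∷ []))

      -- There is no part of depth 0, as a single node already has depth 1. Hence any function may
      -- start the iteration.
      level0-ok : NodeOK 0 level0
      level0-ok ()

      solver : ⟦ nat ⊗ nat ⇒ TabTy ⟧
      solver = proj₁ (iterateᵀ (λ F → eval (lam (let′ kidsT tableT))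
            (F ∷ J ∷ cov ∷ i₀ ∷ acc₀ ∷ mat ∷ upTo q ∷ ms ∷ input ∷ [])) s level0)

      module Solve (membersOK : Val membersT (cov ∷ i₀ ∷ acc₀ ∷ mat ∷ upTo q ∷ ms ∷ input ∷ []) J) (root : Fin s)
            (root≡0 : toℕ root ≡ 0)
        (somewhere : ∀ {j} → j ∈ J → ∃ λ (x : Fin s) → Meets (toℕ x) j) where

        us : List (Fin s)
        us = proj₁ (build-root root)

        R : Rooted s s root us
        R = proj₂ (build-root root)

        rootOK : TabOK s root us (proj₁ (solver (0 , s))) × proj₂ (solver (0 , s)) + K ≤ 2 * K * length us
        rootOK = subst (λ a → TabOK s root us (proj₁ (solver (a , s))) × proj₂ (solver (a , s)) + K ≤ 2 * K * length us) root≡0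
          (iterate-ok tableT tableOK s level0-ok (subst (λ m → Rooted m s root us) (sym (+-identityʳ s)) R) (root-parent root))

        sizes : length (encodeLists 𝑇) ≡ s
        sizes = trans (length-map _ (allFin s)) (length-tabulate {n = s} id)

        solve-value : Val solveT (cov ∷ i₀ ∷ acc₀ ∷ mat ∷ upTo q ∷ ms ∷ input ∷ []) (proj₁ (proj₁ (solver (0 , s)) []))
        solve-value = e-let membersOK (e-let (e-≡ (cong (λ n → proj₁ (iterateᵀ (λ F → eval (lam (let′ kidsT tableT))
              (F ∷ J ∷ cov ∷ i₀ ∷ acc₀ ∷ mat ∷ upTo q ∷ ms ∷ input ∷ [])) n level0)) sizes) e-eval)
          (e-app (e-app e-eval (e-≡ (cong (0 ,_) sizes) e-eval)) e-eval))

        -- No bag is stored at the number `s` of the root's parent, so no member meets it. Hence all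
        -- of `J` counts as lying below, and the empty query imposes no constraint.
        solve-best : Best (_∈ J) (λ _ → ⊥) (proj₁ (eval solveT (cov ∷ i₀ ∷ acc₀ ∷ mat ∷ upTo q ∷ ms ∷ input ∷ [])))
        solve-best = subst (Best (_∈ J) (λ _ → ⊥)) (sym (value solve-value))
          (best-cong proj₁ (λ {j} j∈ → j∈ , outside , everywhere j∈) (λ { (() , _) }) (λ ())
            (lookupBest (proj₁ rootOK) {[]} {[]} (λ _ ()) (λ _ ()) []))
          where
          outside : ∀ {j} → ¬ Meets s j
          outside {j} m = let (y , y≡s) = isNode {s} {j} m in <-irrefl y≡s (Fin.toℕ<n y)
          everywhere : ∀ {j} → j ∈ J → Any (λ x → Meets (toℕ x) j) us
          everywhere j∈ = let (x , m) = somewhere j∈ in lose (rooted-all R x) m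

        solve-time : proj₂ (eval solveT (cov ∷ i₀ ∷ acc₀ ∷ mat ∷ upTo q ∷ ms ∷ input ∷ [])) ≤
          proj₁ (solveT-cost h (2 * (40 + proj₁ (tableT-cost h tabCost)))) * (suc q * cnt q kk * s)
        solve-time = subst (λ n → proj₂ (eval solveT (cov ∷ i₀ ∷ acc₀ ∷ mat ∷ upTo q ∷ ms ∷ input ∷ [])) ≤ proj₁
              (solveT-cost h a) * n) sz≡ (bound (bounded (pred Y) sz≡))
          where
          cT = proj₁ (tableT-cost h tabCost)
          a = 2 * (40 + cT)
          Z = suc q * cnt q kk
          Y = Z * s
          s≥1 : 1 ≤ s
          s≥1 = ≤-trans (s≤s z≤n) (Fin.toℕ<n root)
          X≤Z : suc q ≤ Z
          X≤Z = m≤m*n (suc q) (cnt q kk) {{Data.Nat.>-nonZero (cnt≥1 q kk)}}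
          X≤Y : suc q ≤ Y
          X≤Y = ≤-trans X≤Z (m≤m*n Z s {{Data.Nat.>-nonZero s≥1}})
          sz≡ : suc (pred Y) ≡ Y
          sz≡ = suc-pred Y {{Data.Nat.>-nonZero (≤-trans (s≤s z≤n) X≤Y)}}
          bounded : ∀ z → suc z ≡ Y → Cost z solveT (cov ∷ i₀ ∷ acc₀ ∷ mat ∷ upTo q ∷ ms ∷ input ∷ []) (proj₁ (solveT-cost h a))
          bounded z sz≡ = proj₂ (solveT-cost h a) q membersOK small (s≤s⁻¹ (subst (suc q ≤_) (sym sz≡) X≤Y))
            (subst₂ _≤_ (sym sizes) (sym sz≡) (m≤n*m s Z {{Data.Nat.>-nonZero (≤-trans (s≤s z≤n) X≤Z)}}))
            (subst (λ n → proj₂ (proj₁ (iterateᵀ (λ F → eval (lam (let′ kidsT tableT))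
                  (F ∷ J ∷ cov ∷ i₀ ∷ acc₀ ∷ mat ∷ upTo q ∷ ms ∷ input ∷ [])) n level0) (0 , n)) ≤ a * suc z) (sym sizes) spent)
            (subst (λ n → proj₂ (proj₁ (proj₁ (iterateᵀ (λ F → eval (lam (let′ kidsT tableT))
                  (F ∷ J ∷ cov ∷ i₀ ∷ acc₀ ∷ mat ∷ upTo q ∷ ms ∷ input ∷ [])) n level0) (0 , n)) []) ≤ 20 * suc z) (sym sizes)
              (≤-trans (lookupTime (proj₁ rootOK) []) (*-monoʳ-≤ 20 (subst (suc q ≤_) (sym sz≡) X≤Y))))
            where
            open ≤-Reasoning
            lemma : ∀ c z s → 2 * ((40 + c) * z) * s ≡ 2 * (40 + c) * (z * s)
            lemma = solve-∀
            spent : proj₂ (solver (0 , s)) ≤ a * suc z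
            spent = begin
              proj₂ (solver (0 , s))       ≤⟨ m≤m+n _ K ⟩
              proj₂ (solver (0 , s)) + K   ≤⟨ proj₂ rootOK ⟩
              2 * K * length us            ≤⟨ *-monoʳ-≤ (2 * K) (length-unique-Fin (rooted-unique R)) ⟩
              2 * K * s                    ≡⟨ cong (λ K → 2 * K * s) K-def ⟩
              2 * ((40 + cT) * Z) * s      ≡⟨ lemma cT Z s ⟩
              a * Y                        ≡⟨ cong (a *_) sz≡ ⟨
              a * suc z                    ∎

-- The encoded graph, subgraphs and tree decompositions.

module Encoding where
  open Programs
  open CostCalculus
  open Fragments
  open UniqueLists
  open Trees
  open Costs
  open import Data.Fin using (Fin; toℕ; fromℕ<; zero; suc)
  import Data.Fin as Fin
  open import Data.Fin.Subset using (Subset; inside; outside; ∣_∣; _∩_) renaming (_∈_ to _∈ₛ_; _⊆_ to _⊆ₛ_)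
  open import Data.Fin.Subset.Properties using (_∈?_; ∈⊤; x∈p∩q⁺; x∈p∩q⁻; nonempty?; drop-there)
  open import Data.List.Properties using (length-upTo; length-map; length-tabulate)
  open import Data.List.Membership.Propositional.Properties
  open import Data.Nat using (ℕ; zero; suc; _≤_; _<_; z≤n)
  open import Data.Nat.Properties
  open import Data.Rational using (ℚ)
  import Data.Vec as Vec
  import Data.Vec.Properties as Vec
  open import Relation.Binary.Construct.Closure.ReflexiveTransitive as Star using (Star; ε; _◅_; _◅◅_)
  open import Relation.Nullary.Decidable using (dec-true)

  T-does⁻ : ∀ {A : Set} (a? : Dec A) → T (does a?) → A
  T-does⁻ (yes a) _ = a

  T-does⁺ : ∀ {A : Set} (a? : Dec A) → A → T (does a?)
  T-does⁺ (yes _) _ = _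
  T-does⁺ (no ¬a) a = ¬a a

  bit⇒∈ : ∀ {n} (X : Subset n) (u : Fin n) → T (nth (encodeSubset X) (toℕ u) false) → u ∈ₛ X
  bit⇒∈ X u p = Vec.lookup⇒[]= u X (T⇒≡ (subst T (nth-toList X u) p))
    where
    T⇒≡ : ∀ {b} → T b → b ≡ true
    T⇒≡ {true} _ = refl

  ∈⇒bit : ∀ {n} (X : Subset n) (u : Fin n) → u ∈ₛ X → T (nth (encodeSubset X) (toℕ u) false)
  ∈⇒bit X u u∈ = subst T (sym (trans (nth-toList X u) (Vec.[]=⇒lookup u∈))) _

  ∈-elements⁺ : ∀ {n} {X : Subset n} {u} → u ∈ₛ X → u ∈ elements X
  ∈-elements⁺ {X = X} {u} = ∈-filter⁺ (_∈? X) (∈-allFin u)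

  ∈-elements⁻ : ∀ {n} {X : Subset n} {u} → u ∈ elements X → u ∈ₛ X
  ∈-elements⁻ {n} {X} u∈ = proj₂ (∈-filter⁻ (_∈? X) {xs = allFin n} u∈)

  elements-unique : ∀ {n} (X : Subset n) → Unique (elements X)
  elements-unique {n} X = Unique.filter⁺ (_∈? X) (Unique.allFin⁺ n)

  length-elements : ∀ {n} (X : Subset n) → length (elements X) ≡ ∣ X ∣
  length-elements X = count X X id (λ _ → id) (λ _ → id)
    where
    -- The second vector `Y` is what remains of `X`, seen along `g`: the induction consumes `Y`,
    -- while membership is still tested in the whole of `X`.
    count : ∀ {m n} (X : Subset n) (Y : Subset m) (g : Fin m → Fin n) →
      (∀ i → i ∈ₛ Y → g i ∈ₛ X) → (∀ i → g i ∈ₛ X → i ∈ₛ Y) → length (filter (_∈? X) (tabulate g)) ≡ ∣ Y ∣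
    count X Vec.[]      g to from = refl
    count X (b Vec.∷ Y) g to from with g zero ∈? X
    count X (true Vec.∷ Y)  g to from | yes _ =
      cong suc (count X Y (g ∘ suc) (λ i → to (suc i) ∘ Vec.there) (λ i → drop-there ∘ from (suc i)))
    count X (false Vec.∷ Y) g to from | yes p with () ← from zero p
    count X (true Vec.∷ Y)  g to from | no ¬p = ⊥-elim (¬p (to zero Vec.here))
    count X (false Vec.∷ Y) g to from | no _ =
      count X Y (g ∘ suc) (λ i → to (suc i) ∘ Vec.there) (λ i → drop-there ∘ from (suc i))

  fromList : ∀ {n} → List (Fin n) → Subset n
  fromList xs = Vec.tabulate (λ u → does (Any.any? (u Fin.≟_) xs))

  tabulate⁻ : ∀ {n} {P : Fin n → Set} (P? : ∀ u → Dec (P u)) {u} → u ∈ₛ Vec.tabulate (does ∘ P?) → P u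
  tabulate⁻ P? {u} u∈ = T-does⁻ (P? u) (subst T (trans (sym (Vec.[]=⇒lookup u∈)) (Vec.lookup∘tabulate (does ∘ P?) u)) _)

  tabulate⁺ : ∀ {n} {P : Fin n → Set} (P? : ∀ u → Dec (P u)) {u} → P u → u ∈ₛ Vec.tabulate (does ∘ P?)
  tabulate⁺ P? {u} p = Vec.lookup⇒[]= u _ (trans (Vec.lookup∘tabulate (does ∘ P?) u) (dec-true (P? u) p))

  ∈-fromList⁻ : ∀ {n} (xs : List (Fin n)) {u} → u ∈ₛ fromList xs → u ∈ xs
  ∈-fromList⁻ xs = tabulate⁻ (λ u → Any.any? (u Fin.≟_) xs)

  ∈-fromList⁺ : ∀ {n} (xs : List (Fin n)) {u} → u ∈ xs → u ∈ₛ fromList xs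
  ∈-fromList⁺ xs = tabulate⁺ (λ u → Any.any? (u Fin.≟_) xs)

  length≤∣fromList∣ : ∀ {n} {xs : List (Fin n)} → Unique xs → length xs ≤ ∣ fromList xs ∣
  length≤∣fromList∣ {xs = xs} u = ≤-trans (unique-length u (∈-elements⁺ ∘ ∈-fromList⁺ xs))
    (≤-reflexive (length-elements (fromList xs)))

  ∈-subsets : ∀ {n} (X : Subset n) → X ∈ subsets n
  ∈-subsets Vec.[]            = here refl
  ∈-subsets (true Vec.∷ X)    = ∈-++⁺ˡ (∈-map⁺ (inside Vec.∷_) (∈-subsets X))
  ∈-subsets {suc n} (false Vec.∷ X) = ∈-++⁺ʳ (map (inside Vec.∷_) (subsets n)) (∈-map⁺ (outside Vec.∷_) (∈-subsets X))

  ∣∣≤α : ∀ {n} {G : Graph n} (K : Subgraph G) {X} → IsIndependentSet K X → ∣ X ∣ ≤ α K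
  ∣∣≤α {n} K {X} i = All.lookup (MaxNat.xs≤max 0 (map ∣_∣ (filter (isIndependentSet? K) (subsets n))))
    (∈-map⁺ ∣_∣ (∈-filter⁺ (isIndependentSet? K) (∈-subsets X) i))

  ≤maxOver : ∀ {m} (g : Fin m → ℕ) i → g i ≤ maxOver g
  ≤maxOver {m} g i = All.lookup (MaxNat.xs≤max 0 (map g (allFin m))) (∈-map⁺ g (∈-allFin i))

  induced-edge⁺ : ∀ {n} {G : Graph n} {X : Subset n} {u v} → Graph.Adj G u v → u ∈ₛ X → v ∈ₛ X →
    Subgraph.Edge (induced G X) u v
  induced-edge⁺ {X = X} {u} {v} uv u∈ v∈ =
    Equivalence.from T-∧ (uv , Equivalence.from T-∧ (T-does⁺ (u ∈? X) u∈ , T-does⁺ (v ∈? X) v∈))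

  induced-edge⁻ : ∀ {n} {G : Graph n} {X : Subset n} {u v} → Subgraph.Edge (induced G X) u v →
    Graph.Adj G u v × v ∈ₛ X
  induced-edge⁻ {G = G} {X} {u} {v} e =
    let (uv , p) = Equivalence.to (T-∧ {Graph.adj G u v}) e
    in uv , T-does⁻ (v ∈? X) (proj₂ (Equivalence.to (T-∧ {does (u ∈? X)}) p))

  ∈-induced⁺ : ∀ {n} {G : Graph n} {X : Subset n} {u} → u ∈ₛ X → u ∈ₛ Subgraph.V (induced G X)
  ∈-induced⁺ u∈ = x∈p∩q⁺ (∈⊤ , u∈)

  module Family {n q : ℕ} (G : Graph n) (H : Fin q → Subgraph G) (w : Fin q → ℚ)
    (connected : ∀ j → Connected (H j)) (nonNull : ∀ j → NonNull (H j))
    (h : ℕ) (order≤ : ∀ j → order (H j) ≤ h) where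

    V : Fin q → Subset n
    V j = Subgraph.V (H j)

    ms : List ⟦ MemberTy ⟧
    ms = map (λ j → encodeMember (H j) (w j)) (allFin q)

    member-encoded : ∀ j → member ms (toℕ j) ≡ encodeMember (H j) (w j)
    member-encoded j = nth-allFin (λ j → encodeMember (H j) (w j)) j

    vertices-encoded : ∀ j → vertices ms (toℕ j) ≡ map toℕ (elements (V j))
    vertices-encoded j = cong proj₁ (member-encoded j)

    weight-encoded : ∀ j → weightOf ms (toℕ j) ≡ w j
    weight-encoded j = cong (proj₂ ∘ proj₂) (member-encoded j)

    small : ∀ j → length (vertices ms j) ≤ h
    small j = nth-All {P = λ m → length (proj₁ m) ≤ h} ms j (All.map⁺ (All.tabulate (λ {j} _ →
      ≤-trans (≤-reflexive (trans (length-map toℕ (elements (V j))) (length-elements (V j)))) (order≤ j)))) z≤n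

    Independent : Fin q → Fin q → Set
    Independent a b = VertexDisjoint H a b × NoEdgeBetween H a b

    independent-sym : ∀ {a b} → Independent a b → Independent b a
    independent-sym (d , e) = (λ (u , u∈) → d (u , x∈p∩q⁺ (let (x , y) = x∈p∩q⁻ _ _ u∈ in y , x))) ,
      λ u u∈ v v∈ uv → e v v∈ u u∈ (Graph.sym G uv)

    independent-irrefl : ∀ {a} → ¬ Independent a a
    independent-irrefl {a} (d , _) = let (u , u∈) = nonNull a in d (u , x∈p∩q⁺ (u∈ , u∈))

    conflict : ∀ {a b} → ¬ Independent a b →
      (∃ λ u → u ∈ₛ V a × u ∈ₛ V b) ⊎ (∃ λ u → ∃ λ v → u ∈ₛ V a × v ∈ₛ V b × Graph.Adj G u v)
    conflict {a} {b} ¬i with nonempty? (V a ∩ V b)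
    ... | yes (u , u∈) = inj₁ (u , x∈p∩q⁻ (V a) (V b) u∈)
    ... | no d with Fin.any? (λ u → Fin.any? (λ v → (u ∈? V a) ×-dec (v ∈? V b) ×-dec T? (Graph.adj G u v)))
    ... | yes e = inj₂ e
    ... | no ¬e = ⊥-elim (¬i (d , λ u u∈ v v∈ uv → ¬e (u , v , u∈ , v∈ , uv)))

    module Compatibility (input : ⟦ InputTy ⟧) (matrix : proj₁ (proj₂ input) ≡ encodeMatrix G) where

      adj-encoded : ∀ u v → nth (nth (proj₁ (proj₂ input)) (toℕ u) []) (toℕ v) false ≡ Graph.adj G u v
      adj-encoded u v = trans (cong (λ A → nth (nth A (toℕ u) []) (toℕ v) false) matrix)
        (trans (cong (λ row → nth row (toℕ v) false) (nth-allFin (λ u → map (Graph.adj G u) (allFin n)) u))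
          (nth-allFin (Graph.adj G u) v))

      compatible⇒ : ∀ a b → T (compatible input ms (toℕ a) (toℕ b)) → Independent a b
      compatible⇒ a b p = (λ (u , u∈) → let (x , y) = x∈p∩q⁻ _ _ u∈ in proj₁ (apart x y) refl) ,
        λ u u∈ v v∈ uv → proj₂ (apart u∈ v∈) (subst T (sym (adj-encoded u v)) uv)
        where
        apart : ∀ {u v} → u ∈ₛ V a → v ∈ₛ V b → Apart (proj₁ (proj₂ input)) (toℕ u) (toℕ v)
        apart u∈ v∈ = All.lookup (All.lookup (apartᵇ⇒ (proj₁ (proj₂ input)) _ _ (subst₂ (λ us vs → T (apartᵇ (proj₁
              (proj₂ input)) us vs))
          (vertices-encoded a) (vertices-encoded b) p)) (∈-map⁺ toℕ (∈-elements⁺ u∈))) (∈-map⁺ toℕ (∈-elements⁺ v∈))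

      compatible⇐ : ∀ a b → Independent a b → T (compatible input ms (toℕ a) (toℕ b))
      compatible⇐ a b (d , e) = subst₂ (λ us vs → T (apartᵇ (proj₁ (proj₂ input)) us vs))
        (sym (vertices-encoded a)) (sym (vertices-encoded b))
        (apartᵇ⇐ (proj₁ (proj₂ input)) (All.map⁺ (All.tabulate λ {u} u∈ → All.map⁺ (All.tabulate λ {v} v∈ →
          (λ u≡v → d (u , x∈p∩q⁺ (∈-elements⁻ u∈ , subst (_∈ₛ V b) (sym (Fin.toℕ-injective u≡v)) (∈-elements⁻ v∈)))) ,
          (λ uv → e u (∈-elements⁻ u∈) v (∈-elements⁻ v∈) (subst T (adj-encoded u v) uv))))))

      mat : ⟦ MatTy ⟧
      mat = map (λ j → map (compatible input ms j) (upTo q)) (upTo q)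

      Comp : ℕ → ℕ → Set
      Comp j l = T (nth (nth mat j []) l false)

      mat-encoded : ∀ {j l} → j < q → l < q → nth (nth mat j []) l false ≡ compatible input ms j l
      mat-encoded {j} {l} j< l< = trans (cong (λ row → nth row l false) (nth-upTo _ j<)) (nth-upTo _ l<)

      -- Outside the matrix the default `false` is read. Symmetry and irreflexivity on all numbers
      -- thus reduce to genuine indices.
      Comp-range : ∀ {j l} → Comp j l → j < q × l < q
      Comp-range {j} {l} c with j <? q
      ... | no j≮ = ⊥-elim (subst T (cong (λ row → nth row l false)
        (nth-overflow mat j (≤-trans (≤-reflexive (trans (length-map _ (upTo q)) (length-upTo q))) (≮⇒≥ j≮)))) c)
      ... | yes j< with l <? q
      ... | yes l< = j< , l<
      ... | no l≮ = ⊥-elim (subst T (trans (cong (λ row → nth row l false) (nth-upTo _ j<))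
        (nth-overflow (map (compatible input ms j) (upTo q)) l
          (≤-trans (≤-reflexive (trans (length-map _ (upTo q)) (length-upTo q))) (≮⇒≥ l≮)))) c)

      Comp⁺ : ∀ {a b} → Independent a b → Comp (toℕ a) (toℕ b)
      Comp⁺ {a} {b} i = subst T (sym (mat-encoded (Fin.toℕ<n a) (Fin.toℕ<n b))) (compatible⇐ a b i)

      Comp⁻ : ∀ {a b} → Comp (toℕ a) (toℕ b) → Independent a b
      Comp⁻ {a} {b} c = compatible⇒ a b (subst T (mat-encoded (Fin.toℕ<n a) (Fin.toℕ<n b)) c)

      toIndex : ∀ {j} → j < q → ∃ λ (a : Fin q) → j ≡ toℕ a
      toIndex j< = fromℕ< j< , sym (Fin.toℕ-fromℕ< j<)

      Comp-sym : ∀ {j l} → Comp j l → Comp l j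
      Comp-sym {j} {l} c with toIndex (proj₁ (Comp-range {j} {l} c)) | toIndex (proj₂ (Comp-range {j} {l} c))
      ... | a , refl | b , refl = Comp⁺ (independent-sym (Comp⁻ c))

      Comp-irrefl : ∀ {j} → ¬ Comp j j
      Comp-irrefl {j} c with toIndex (proj₁ (Comp-range {j} {j} c))
      ... | a , refl = independent-irrefl (Comp⁻ {a} c)

      module Decomposed (C : Subset n) (𝒯 : TreeDecomposition (induced G C)) (kk : ℕ) (α≤ : αᵀ 𝒯 ≤ kk) where
        open TreeDecomposition 𝒯
        open RootedTree tree isTree

        bags : List (List Bool)
        bags = map (λ t → encodeSubset (bag t)) (allFin size)

        Meets : ℕ → ℕ → Set
        Meets a j = T (meetsᵇ (nth bags a []) (vertices ms j))

        J : List ℕ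
        J = filterᵇ (λ j → insideᵇ (encodeSubset C) (vertices ms j)) (upTo q)

        bag-encoded : ∀ x → nth bags (toℕ x) [] ≡ encodeSubset (bag x)
        bag-encoded x = nth-allFin (λ t → encodeSubset (bag t)) x

        meets⁺ : ∀ {x a u} → u ∈ₛ V a → u ∈ₛ bag x → Meets (toℕ x) (toℕ a)
        meets⁺ {x} {a} {u} u∈ u∈x = subst₂ (λ X vs → T (meetsᵇ X vs)) (sym (bag-encoded x)) (sym (vertices-encoded a))
          (meetsᵇ⇐ (encodeSubset (bag x)) (lose (∈-map⁺ toℕ (∈-elements⁺ u∈)) (∈⇒bit (bag x) u u∈x)))

        meets⁻ : ∀ {x a} → Meets (toℕ x) (toℕ a) → ∃ λ u → u ∈ₛ V a × u ∈ₛ bag x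
        meets⁻ {x} {a} m =
          let (_ , i∈ , b) = find (meetsᵇ⇒ (encodeSubset (bag x)) _
                (subst₂ (λ X vs → T (meetsᵇ X vs)) (bag-encoded x) (vertices-encoded a) m))
              (u , u∈ , i≡u) = ∈-map⁻ toℕ i∈
          in u , ∈-elements⁻ u∈ , bit⇒∈ (bag x) u (subst (λ i → T (nth (encodeSubset (bag x)) i false)) i≡u b)

        isNode : ∀ {p j} → Meets p j → ∃ λ (y : Fin size) → toℕ y ≡ p
        isNode {p} {j} m with p <? size
        ... | yes p< = fromℕ< p< , Fin.toℕ-fromℕ< p<
        ... | no p≮ = ⊥-elim (none (meetsᵇ⇒ [] (vertices ms j) (subst (λ X → T (meetsᵇ X (vertices ms j)))
            (nth-overflow bags p (≤-trans (≤-reflexive (trans (length-map _ (allFin size))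
                  (length-tabulate {n = size} id))) (≮⇒≥ p≮))) m)))
          where
          none : ∀ {vs} → ¬ Any (λ u → T (nth [] u false)) vs
          none (there p) = none p

        ∈J⁻ : ∀ {j} → j ∈ J → ∃ λ (a : Fin q) → j ≡ toℕ a × V a ⊆ₛ C
        ∈J⁻ {j} j∈ with ∈-filter⁻ (T? ∘ (λ j → insideᵇ (encodeSubset C) (vertices ms j))) {xs = upTo q} j∈
        ... | j∈′ , i with toIndex (∈-upTo⁻ j∈′)
        ... | a , refl = a , refl , λ {u} u∈ → bit⇒∈ C u (All.lookup (insideᵇ⇒ (encodeSubset C) _
                (subst (λ vs → T (insideᵇ (encodeSubset C) vs)) (vertices-encoded a) i)) (∈-map⁺ toℕ (∈-elements⁺ u∈)))

        ∈J⁺ : ∀ {a} → V a ⊆ₛ C → toℕ a ∈ J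
        ∈J⁺ {a} a⊆ = ∈-filter⁺ (T? ∘ (λ j → insideᵇ (encodeSubset C) (vertices ms j))) (∈-upTo⁺ (Fin.toℕ<n a))
          (subst (λ vs → T (insideᵇ (encodeSubset C) vs)) (sym (vertices-encoded a))
            (insideᵇ⇐ (encodeSubset C) (All.map⁺ (All.tabulate λ {u} u∈ → ∈⇒bit C u (a⊆ (∈-elements⁻ u∈))))))

        J<q : All (_< q) J
        J<q = All.tabulate λ j∈ → ∈-upTo⁻ (proj₁ (∈-filter⁻ (T? ∘ (λ j → insideᵇ (encodeSubset C)
              (vertices ms j))) {xs = upTo q} j∈))

        J-unique : Unique J
        J-unique = Unique.filter⁺ (T? ∘ (λ j → insideᵇ (encodeSubset C) (vertices ms j))) (Unique.upTo⁺ q)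

        somewhere : ∀ {j} → j ∈ J → ∃ λ (x : Fin size) → Meets (toℕ x) j
        somewhere j∈ with ∈J⁻ j∈
        ... | a , refl , a⊆ = let (u , u∈) = nonNull a
                                  (x , u∈x) = vertexCover (∈-induced⁺ {G = G} (a⊆ u∈))
                              in x , meets⁺ u∈ u∈x

        -- Two conflicting members share a vertex or are joined by an edge, and the corresponding
        -- covering axiom puts that vertex or edge into one bag.
        covered : ∀ {j l} → j ∈ J → l ∈ J → ¬ Comp j l → ∃ λ (x : Fin size) → Meets (toℕ x) j × Meets (toℕ x) l
        covered j∈ l∈ ¬c with ∈J⁻ j∈ | ∈J⁻ l∈
        ... | a , refl , a⊆ | b , refl , b⊆ with conflict (λ i → ¬c (Comp⁺ i))
        ... | inj₁ (u , u∈a , u∈b) =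
          let (x , u∈x) = vertexCover (∈-induced⁺ {G = G} (a⊆ u∈a)) in x , meets⁺ u∈a u∈x , meets⁺ u∈b u∈x
        ... | inj₂ (u , v , u∈a , v∈b , uv) =
          let (x , u∈x , v∈x) = edgeCover (induced-edge⁺ {G = G} uv (a⊆ u∈a) (b⊆ v∈b)) in x , meets⁺ u∈a u∈x , meets⁺ v∈b v∈x

        module _ {a : Fin q} (a⊆ : V a ⊆ₛ C) where

          Touches : Fin size → Set
          Touches x = Meets (toℕ x) (toℕ a)

          Trace : Fin size → Fin size → Set
          Trace x y = Graph.Adj tree x y × Touches y

          vertex-trace : ∀ {u x y} → u ∈ₛ V a → u ∈ₛ bag x → u ∈ₛ bag y → Star Trace x y
          vertex-trace {u} u∈ u∈x u∈y = Star.map step′ (subtree (∈-induced⁺ {G = G} (a⊆ u∈)) (member∈ u∈x) (member∈ u∈y))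
            where
            member∈ : ∀ {x} → u ∈ₛ bag x → x ∈ₛ Subgraph.V (induced tree (nodesOf u))
            member∈ u∈x = ∈-induced⁺ {G = tree} (tabulate⁺ (λ t → u ∈? bag t) u∈x)
            step′ : ∀ {x y} → Subgraph.Edge (induced tree (nodesOf u)) x y → Trace x y
            step′ {x} {y} e = let (xy , y∈) = induced-edge⁻ {G = tree} {nodesOf u} {x} {y} e
                              in xy , meets⁺ u∈ (tabulate⁻ (λ t → u ∈? bag t) y∈)

          -- Consecutive vertices of a walk in the subgraph have a common bag, so the subtrees of
          -- its vertices overlap one after the other and can be chained.
          walk-trace : ∀ {u u′ x y} → u ∈ₛ V a → u ∈ₛ bag x → Star (Subgraph.Edge (H a)) u u′ → u′ ∈ₛ bag y → Star Trace x y
          walk-trace u∈ u∈x ε        u′∈y = vertex-trace u∈ u∈x u′∈y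
          walk-trace u∈ u∈x (e ◅ es) u′∈y =
            let (_ , v∈) = Subgraph.ends (H a) e
                (z , u∈z , v∈z) = edgeCover (induced-edge⁺ {G = G} (Subgraph.sub (H a) e) (a⊆ u∈) (a⊆ v∈))
            in vertex-trace u∈ u∈x u∈z ◅◅ walk-trace v∈ v∈z es u′∈y

          trace : ∀ {x y} → Touches x → Touches y → Star Trace x y
          trace mx my = let (u , u∈ , u∈x) = meets⁻ mx
                            (v , v∈ , v∈y) = meets⁻ my
                        in walk-trace u∈ u∈x (connected a u∈ v∈) v∈y

        separated : ∀ {k p v us} → Rooted k p v us → ∀ {j x y} → j ∈ J → x ∈ us → y ∉ us →
          Meets (toℕ x) j → Meets (toℕ y) j → Meets (toℕ v) j × Meets p j
        separated R j∈ x∈ y∉ mx my with ∈J⁻ j∈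
        ... | a , refl , a⊆ with crossing R (Touches a⊆) x∈ y∉ mx (trace a⊆ mx my)
        ... | mv , z , refl , mz = mv , mz

        -- One vertex of the bag from each member gives an independent set of the bag.
        budget : ∀ (v : Fin size) {S} → AllPairs Comp S → All (λ j → j ∈ J × Meets (toℕ v) j) S → length S ≤ kk
        budget v {S} i c = let (us , len , u , ok) = pick i c in
          ≤-trans (≤-reflexive len) (≤-trans (length≤∣fromList∣ (AllPairs.map proj₁ u)) (≤-trans (∣∣≤α
                (induced G C ↾ bag v) (independent us u ok))
            (≤-trans (≤maxOver (λ t → α (induced G C ↾ bag t)) v) α≤)))
          where
          From : List ℕ → Fin n → Set
          From S u = Any (λ j → ∃ λ a → j ≡ toℕ a × V a ⊆ₛ C × u ∈ₛ V a) S × u ∈ₛ bag v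

          Apart′ : Fin n → Fin n → Set
          Apart′ u u′ = u ≢ u′ × ¬ Graph.Adj G u u′

          pick : ∀ {S} → AllPairs Comp S → All (λ j → j ∈ J × Meets (toℕ v) j) S →
            ∃ λ us → length S ≡ length us × AllPairs Apart′ us × All (From S) us
          pick [] [] = [] , refl , [] , []
          pick {j ∷ S} (cj ∷ i) ((j∈ , m) ∷ c) with ∈J⁻ j∈ | pick i c
          ... | a , refl , a⊆ | us , len , ap , ok with meets⁻ {a = a} m
          ... | u , u∈ , u∈v = u ∷ us , cong suc len , All.map apart ok ∷ ap ,
              (here (a , refl , a⊆ , u∈) , u∈v) ∷ All.map (λ (p , q) → there p , q) ok
            where
            apart : ∀ {u′} → From S u′ → Apart′ u u′
            apart (p , _) with find p
            ... | l , l∈ , b , refl , _ , u′∈ =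
              let (d , e) = Comp⁻ {a} {b} (All.lookup cj l∈)
              in (λ { refl → d (u , x∈p∩q⁺ (u∈ , u′∈)) }) , e u u∈ _ u′∈

          independent : ∀ us → AllPairs Apart′ us → All (From S) us → IsIndependentSet (induced G C ↾ bag v) (fromList us)
          independent us ap ok =
            (λ u∈ → let (p , u∈v) = All.lookup ok (∈-fromList⁻ us u∈)
                        (_ , _ , _ , _ , a⊆ , u∈a) = find p
                    in x∈p∩q⁺ (∈-induced⁺ {G = G} (a⊆ u∈a) , u∈v)) ,
            λ u u∈ u′ u′∈ e → nonadjacent ap (∈-fromList⁻ us u∈) (∈-fromList⁻ us u′∈)
              (Subgraph.sub (induced G C ↾ bag v) {u} {u′} e)
            where
            nonadjacent : ∀ {us} → AllPairs Apart′ us → ∀ {u u′} → u ∈ us → u′ ∈ us → ¬ Graph.Adj G u u′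
            nonadjacent _        (here refl) (here refl) = Graph.irrefl G
            nonadjacent (a ∷ _)  (here refl) (there u′∈) = proj₂ (All.lookup a u′∈)
            nonadjacent (a ∷ _)  (there u∈)  (here refl) = proj₂ (All.lookup a u∈) ∘ Graph.sym G
            nonadjacent (_ ∷ ap) (there u∈)  (there u′∈) = nonadjacent ap u∈ u′∈

        root : ∃ λ (x : Fin size) → toℕ x ≡ 0
        root = first (proj₁ (IsTree.nonNull isTree))
          where
          first : ∀ {s} → Fin s → ∃ λ (x : Fin s) → toℕ x ≡ 0
          first {suc s} _ = zero , refl

-- The number of distinct subgraphs of bounded order.

module FamilySize where
  open Fragments
  open UniqueLists
  open Encoding
  open import Data.Fin using (Fin; toℕ; fromℕ<; zero; suc; combine; funToFin; finToFun; remQuot)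
  open import Data.Fin.Subset using (Subset; ∣_∣) renaming (_∈_ to _∈ₛ_; _⊆_ to _⊆ₛ_)
  open import Data.Fin.Subset.Properties using (⊆-antisym; _∈?_)
  open import Data.Nat using (zero; suc; _*_; _^_; _≤_; _<_; z≤n; s≤s)
  open import Data.Nat.Properties

  funToFin-injective : ∀ {m n} {f g : Fin m → Fin n} → funToFin f ≡ funToFin g → f ≗ g
  funToFin-injective {f = f} {g} eq i =
    trans (sym (Fin.finToFun-funToFin f i)) (trans (cong (λ c → finToFun c i) eq) (Fin.finToFun-funToFin g i))

  ∈⇒nth : ∀ {A : Set} {xs : List A} {x d} → x ∈ xs → ∃ λ i → i < length xs × nth xs i d ≡ x
  ∈⇒nth (here refl) = 0 , s≤s z≤n , refl
  ∈⇒nth (there x∈)  = let (i , i< , eq) = ∈⇒nth x∈ in suc i , s≤s i< , eq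

  -- A subgraph with at most h vertices is determined by an enumeration of its
  -- vertices (with repetitions) and the edges between the positions.
  family-bound : ∀ {n q h} {G : Graph n} (H : Fin q → Subgraph G) → Distinct H →
    (∀ j → NonNull (H j)) → (∀ j → order (H j) ≤ h) → q ≤ n ^ h * 2 ^ (h * h)
  family-bound {n} {q} {h} {G} H distinct nonNull order≤ = Fin.injective⇒≤ {f = code} code-injective
    where
    V : Fin q → Subset n
    V j = Subgraph.V (H j)

    -- If there are fewer than `h` vertices, the remaining positions repeat the witness of
    -- `nonNull`, so every position names a vertex of the member.
    enum : Fin q → Fin h → Fin n
    enum j i = nth (elements (V j)) (toℕ i) (proj₁ (nonNull j))

    enum∈ : ∀ j i → enum j i ∈ₛ V j
    enum∈ j i = nth-All (elements (V j)) (toℕ i) (All.tabulate ∈-elements⁻) (proj₂ (nonNull j))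

    position : ∀ j {u} → u ∈ₛ V j → ∃ λ i → enum j i ≡ u
    position j {u} u∈ =
      let (i , i< , eq) = ∈⇒nth {d = proj₁ (nonNull j)} (∈-elements⁺ u∈)
          i<h = ≤-trans i< (≤-trans (≤-reflexive (length-elements (V j))) (order≤ j))
      in fromℕ< i<h , trans (cong (λ i → nth (elements (V j)) i (proj₁ (nonNull j))) (Fin.toℕ-fromℕ< i<h)) eq

    bit : Bool → Fin 2
    bit false = zero
    bit true  = suc zero

    bit-injective : ∀ {a b} → bit a ≡ bit b → a ≡ b
    bit-injective {false} {false} _ = refl
    bit-injective {true}  {true}  _ = refl

    edges : Fin q → Fin (h * h) → Fin 2
    edges j p = let (a , b) = remQuot h p in bit (Subgraph.edge (H j) (enum j a) (enum j b))

    code : Fin q → Fin (n ^ h * 2 ^ (h * h))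
    code j = combine (funToFin (enum j)) (funToFin (edges j))

    code-injective : ∀ {i j} → code i ≡ code j → i ≡ j
    code-injective {i} {j} eq = distinct i j
      (⊆-antisym (V⊆ i j same-enum) (V⊆ j i (sym ∘ same-enum)) , same-edge)
      where
      same-enum : enum i ≗ enum j
      same-enum = funToFin-injective (Fin.combine-injectiveˡ _ (funToFin (edges i)) _ (funToFin (edges j)) eq)

      V⊆ : ∀ i j → enum i ≗ enum j → V i ⊆ₛ V j
      V⊆ i j same u∈ = let (p , eq) = position i u∈ in subst (_∈ₛ V j) (trans (sym (same p)) eq) (enum∈ j p)

      same-edges : edges i ≗ edges j
      same-edges = funToFin-injective (Fin.combine-injectiveʳ (funToFin (enum i)) _ (funToFin (enum j)) _ eq)

      absent : ∀ {j u v} → ¬ (u ∈ₛ V j × v ∈ₛ V j) → Subgraph.edge (H j) u v ≡ false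
      absent {j} {u} {v} ¬∈ with Subgraph.edge (H j) u v in e
      ... | false = refl
      ... | true  = ⊥-elim (¬∈ (Subgraph.ends (H j) (subst T (sym e) _)))

      same-edge : ∀ u v → Subgraph.edge (H i) u v ≡ Subgraph.edge (H j) u v
      same-edge u v with u ∈? V i | v ∈? V i
      ... | yes u∈ | yes v∈ with position i u∈ | position i v∈
      ... | a , refl | b , refl = trans (bit-injective (subst (λ p → bit (Subgraph.edge (H i) (enum i (proj₁ p))
            (enum i (proj₂ p)))
              ≡ bit (Subgraph.edge (H j) (enum j (proj₁ p)) (enum j (proj₂ p)))) (Fin.remQuot-combine a b)
                    (same-edges (combine a b))))
            (cong₂ (Subgraph.edge (H j)) (sym (same-enum a)) (sym (same-enum b)))
      same-edge u v | no u∉ | _ = trans (absent (u∉ ∘ proj₁)) (sym (absent (u∉ ∘ V⊆ j i (sym ∘ same-enum) ∘ proj₁)))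
      same-edge u v | yes _ | no v∉ = trans (absent (v∉ ∘ proj₂)) (sym (absent (v∉ ∘ V⊆ j i (sym ∘ same-enum) ∘ proj₂)))

-- Averaging over a general cover.

module Averages where
  open Optima
  open import Data.Fin using (Fin)
  open import Data.Fin.Subset using (Subset) renaming (_∈_ to _∈ₛ_)
  open import Data.Fin.Subset.Properties using (_∈?_)
  open import Data.Integer using (+_)
  import Data.Integer as ℤ
  import Data.Integer.Properties as ℤ
  open import Data.List.Properties using (length-tabulate; filter-all)
  open import Data.Nat as ℕ using (ℕ; suc; z≤n; s≤s)
  import Data.Nat.Properties as ℕ
  open import Data.Rational
  open import Data.Rational.Properties
  open import Data.Rational.Solver using (module +-*-Solver)
  open import Data.Rational.Unnormalised using (mkℚᵘ; *≡*)
  import Data.Rational.Unnormalised as ℚᵘ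
  import Data.Rational.Unnormalised.Properties as ℚᵘ
  open import Relation.Unary using (Decidable)

  ι : ℕ → ℚ
  ι k = + k / 1

  private
    ι-toℚᵘ : ∀ k → toℚᵘ (ι k) ℚᵘ.≃ mkℚᵘ (+ k) 0
    ι-toℚᵘ k = toℚᵘ-fromℚᵘ (mkℚᵘ (+ k) 0)

  ι-+ : ∀ a b → ι (a ℕ.+ b) ≡ ι a + ι b
  ι-+ a b = toℚᵘ-injective (begin
    toℚᵘ (ι (a ℕ.+ b))                    ≈⟨ ι-toℚᵘ (a ℕ.+ b) ⟩
    mkℚᵘ (+ (a ℕ.+ b)) 0                  ≈⟨ *≡* (cong (ℤ._* + 1) (sym (cong₂ ℤ._+_ (ℤ.*-identityʳ (+ a))
          (ℤ.*-identityʳ (+ b))))) ⟩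
    mkℚᵘ (+ a) 0 ℚᵘ.+ mkℚᵘ (+ b) 0        ≈⟨ ℚᵘ.+-cong (ι-toℚᵘ a) (ι-toℚᵘ b) ⟨
    toℚᵘ (ι a) ℚᵘ.+ toℚᵘ (ι b)            ≈⟨ toℚᵘ-homo-+ (ι a) (ι b) ⟨
    toℚᵘ (ι a + ι b)                      ∎)
    where open ℚᵘ.≃-Reasoning

  /-ι : ∀ h r → + h / suc r ≡ ι h * (+ 1 / suc r)
  /-ι h r = toℚᵘ-injective (begin
    toℚᵘ (+ h / suc r)                    ≈⟨ toℚᵘ-fromℚᵘ (mkℚᵘ (+ h) r) ⟩
    mkℚᵘ (+ h) r                          ≈⟨ *≡* (cong₂ ℤ._*_ (sym (ℤ.*-identityʳ (+ h))) (cong (+_ ∘ suc) (ℕ.+-identityʳ r))) ⟩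
    mkℚᵘ (+ h) 0 ℚᵘ.* mkℚᵘ (+ 1) r        ≈⟨ ℚᵘ.*-cong (ι-toℚᵘ h) (toℚᵘ-fromℚᵘ (mkℚᵘ (+ 1) r)) ⟨
    toℚᵘ (ι h) ℚᵘ.* toℚᵘ (+ 1 / suc r)    ≈⟨ toℚᵘ-homo-* (ι h) (+ 1 / suc r) ⟨
    toℚᵘ (ι h * (+ 1 / suc r))            ∎)
    where open ℚᵘ.≃-Reasoning

  ι-nonNeg : ∀ k → NonNegative (ι k)
  ι-nonNeg k = normalize-nonNeg k 1

  ι-mono : ∀ {a b} → a ℕ.≤ b → ι a ≤ ι b
  ι-mono {a} {b} a≤b = subst (λ c → ι a ≤ ι c) (ℕ.m+[n∸m]≡n a≤b)
    (subst₂ _≤_ (+-identityʳ (ι a)) (sym (ι-+ a (b ℕ.∸ a)))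
      (+-monoʳ-≤ (ι a) (nonNegative⁻¹ (ι (b ℕ.∸ a)) {{ι-nonNeg (b ℕ.∸ a)}})))

  -- Inclusion and exclusion: an entry counted twice on the left satisfies `R` and is counted twice
  -- on the right too.
  length-filter-both : ∀ {A : Set} {P Q : A → Set} (P? : Decidable P) (Q? : Decidable Q) {R : A → Set} (R? : Decidable R) →
    (∀ {a} → P a → Q a → R a) → ∀ xs →
    length (filter P? xs) ℕ.+ length (filter Q? xs) ℕ.≤ length (filter R? xs) ℕ.+ length xs
  length-filter-both P? Q? R? f [] = z≤n
  length-filter-both P? Q? R? f (x ∷ xs) with ih ← length-filter-both P? Q? R? f xs | P? x | Q? x | R? x
  ... | yes p | yes q | yes r = s≤s (subst₂ ℕ._≤_ (sym (ℕ.+-suc _ _)) (sym (ℕ.+-suc _ _)) (s≤s ih))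
  ... | yes p | yes q | no ¬r = ⊥-elim (¬r (f p q))
  ... | yes _ | no _  | yes _ = s≤s (ℕ.≤-trans ih (ℕ.+-monoʳ-≤ _ (ℕ.n≤1+n _)))
  ... | yes _ | no _  | no _  = ℕ.≤-trans (s≤s ih) (ℕ.≤-reflexive (sym (ℕ.+-suc _ _)))
  ... | no _  | yes _ | yes _ = subst₂ ℕ._≤_ (sym (ℕ.+-suc _ _)) refl (s≤s (ℕ.≤-trans ih (ℕ.+-monoʳ-≤ _ (ℕ.n≤1+n _))))
  ... | no _  | yes _ | no _  = subst₂ ℕ._≤_ (sym (ℕ.+-suc _ _)) (sym (ℕ.+-suc _ _)) (s≤s ih)
  ... | no _  | no _  | yes _ = ℕ.≤-trans ih (ℕ.≤-trans (ℕ.+-monoʳ-≤ _ (ℕ.n≤1+n _)) (ℕ.n≤1+n _))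
  ... | no _  | no _  | no _  = ℕ.≤-trans ih (ℕ.+-monoʳ-≤ _ (ℕ.n≤1+n _))

  module Averaging {n m : ℕ} (C : Fin m → Subset n) (x : ℚ) .{{_ : NonNegative x}}
    (cover : ∀ v → (1ℚ - x) * ι m ≤ ι (length (filter (λ i → v ∈? C i) (allFin m)))) where

    inside? : ∀ vs i → Dec (All (_∈ₛ C i) vs)
    inside? vs i = All.all? (_∈? C i) vs

    hits : List (Fin n) → ℕ
    hits vs = length (filter (inside? vs) (allFin m))

    -- Union bound: each vertex of vs is missed by at most x m elements of the cover.
    hits-bound : ∀ vs → (1ℚ - ι (length vs) * x) * ι m ≤ ι (hits vs)
    hits-bound [] = ≤-reflexive (trans (solve 2 (λ x m → (con 1ℚ :- con 0ℚ :* x) :* m := m) refl x (ι m))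
      (cong ι (sym all-hit)))
      where
      open +-*-Solver
      all-hit : hits [] ≡ m
      all-hit = trans (cong length (filter-all (inside? []) {xs = allFin m} (All.tabulate (λ _ → []))))
            (length-tabulate {n = m} id)
    hits-bound (v ∷ vs) = begin
      (1ℚ - ι (suc k) * x) * M                          ≡⟨ cong (λ y → (1ℚ - y * x) * M) (ι-+ 1 k) ⟩
      (1ℚ - (1ℚ + ι k) * x) * M                         ≡⟨ rearrange (ι k) x M ⟩
      (1ℚ - ι k * x) * M + (1ℚ - x) * M - M             ≤⟨ +-monoˡ-≤ (- M) (+-mono-≤ (hits-bound vs) (cover v)) ⟩
      ι (hits vs) + ι c - M                             ≡⟨ cong (_- M) (ι-+ (hits vs) c) ⟨
      ι (hits vs ℕ.+ c) - M                             ≤⟨ +-monoˡ-≤ (- M) (ι-mono both) ⟩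
      ι (hits (v ∷ vs) ℕ.+ m) - M                       ≡⟨ cong (_- M) (ι-+ (hits (v ∷ vs)) m) ⟩
      ι (hits (v ∷ vs)) + M - M                         ≡⟨ solve 2 (λ a b → a :+ b :- b := a) refl (ι (hits (v ∷ vs))) M ⟩
      ι (hits (v ∷ vs))                                 ∎
      where
      open ≤-Reasoning
      open +-*-Solver
      k = length vs
      M = ι m
      c = length (filter (λ i → v ∈? C i) (allFin m))
      rearrange : ∀ k x M → (1ℚ - (1ℚ + k) * x) * M ≡ (1ℚ - k * x) * M + (1ℚ - x) * M - M
      rearrange = solve 3 (λ k x M → (con 1ℚ :- (con 1ℚ :+ k) :* x) :* M :=
        (con 1ℚ :- k :* x) :* M :+ (con 1ℚ :- x) :* M :- M) refl
      both : hits vs ℕ.+ c ℕ.≤ hits (v ∷ vs) ℕ.+ m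
      both = subst (λ l → hits vs ℕ.+ c ℕ.≤ hits (v ∷ vs) ℕ.+ l) (length-tabulate {n = m} id)
        (length-filter-both (inside? vs) (λ i → v ∈? C i) (inside? (v ∷ vs)) (λ a b → b ∷ a) (allFin m))

    module _ {A : Set} (vs : A → List (Fin n)) (w : A → ℚ) (w≥0 : ∀ a → 0ℚ ≤ w a)
      (h : ℕ) (short : ∀ a → length (vs a) ℕ.≤ h) where

      part : List A → Fin m → ℚ
      part L i = sumOf w (filter (λ a → inside? (vs a) i) L)

      private
        D M : ℚ
        D = 1ℚ - ι h * x
        M = ι m

        count-part : ∀ a L is → sumOf (part (a ∷ L)) is ≡ ι (length (filter (inside? (vs a)) is)) * w a + sumOf (part L) is
        count-part a L [] = sym (trans (+-identityʳ _) (*-zeroˡ (w a)))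
        count-part a L (i ∷ is) with inside? (vs a) i
        ... | yes _ = begin
          w a + part L i + sumOf (part (a ∷ L)) is                      ≡⟨ cong (λ y → w a + part L i + y) (count-part a L is) ⟩
          w a + part L i + (ι c * w a + sumOf (part L) is)              ≡⟨ rearrange (w a) (part L i) (ι c) (sumOf (part L) is) ⟩
          (1ℚ + ι c) * w a + (part L i + sumOf (part L) is)             ≡⟨ cong (λ y → y * w a + (part L i + sumOf
                (part L) is)) (ι-+ 1 c) ⟨
          ι (suc c) * w a + (part L i + sumOf (part L) is)              ∎
          where
          open ≡-Reasoning
          open +-*-Solver
          c = length (filter (inside? (vs a)) is)
          rearrange : ∀ w p c s → w + p + (c * w + s) ≡ (1ℚ + c) * w + (p + s)
          rearrange = solve 4 (λ w p c s → w :+ p :+ (c :* w :+ s) := (con 1ℚ :+ c) :* w :+ (p :+ s)) refl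
        ... | no _ = begin
          part L i + sumOf (part (a ∷ L)) is                      ≡⟨ cong (λ y → part L i + y) (count-part a L is) ⟩
          part L i + (ι c * w a + sumOf (part L) is)              ≡⟨ rearrange (part L i) (ι c * w a) (sumOf (part L) is) ⟩
          ι c * w a + (part L i + sumOf (part L) is)              ∎
          where
          open ≡-Reasoning
          open +-*-Solver
          c = length (filter (inside? (vs a)) is)
          rearrange : ∀ p c s → p + (c + s) ≡ c + (p + s)
          rearrange = solve 3 (λ p c s → p :+ (c :+ s) := c :+ (p :+ s)) refl

        many-hits : ∀ a → D * M ≤ ι (hits (vs a))
        many-hits a = ≤-trans (*-monoʳ-≤-nonNeg M {{ι-nonNeg m}} (+-monoʳ-≤ 1ℚ (neg-antimono-≤
          (*-monoʳ-≤-nonNeg x (ι-mono (short a)))))) (hits-bound (vs a))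

        -- One side of a double count of the pairs of a member of `L` and an element of the cover
        -- containing it. Here the weight is summed member by member; `above` sums it by the
        -- elements of the cover.
        below : ∀ L → D * M * sumOf w L ≤ sumOf (part L) (allFin m)
        below [] = ≤-reflexive (trans (*-zeroʳ (D * M)) (sym (zeros (allFin m))))
          where
          zeros : ∀ is → sumOf (part []) is ≡ 0ℚ
          zeros []       = refl
          zeros (_ ∷ is) = trans (+-identityˡ _) (zeros is)
        below (a ∷ L) = begin
          D * M * (w a + sumOf w L)                              ≡⟨ *-distribˡ-+ (D * M) (w a) (sumOf w L) ⟩
          D * M * w a + D * M * sumOf w L                        ≤⟨ +-mono-≤ (*-monoʳ-≤-nonNeg (w a) {{nonNegative
                (w≥0 a)}} (many-hits a)) (below L) ⟩
          ι (hits (vs a)) * w a + sumOf (part L) (allFin m)      ≡⟨ count-part a L (allFin m) ⟨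
          sumOf (part (a ∷ L)) (allFin m)                        ∎
          where open ≤-Reasoning

        above : ∀ {B} L → (∀ i → part L i ≤ B) → ∀ is → sumOf (part L) is ≤ ι (length is) * B
        above {B} L p [] = ≤-reflexive (sym (*-zeroˡ B))
        above {B} L p (i ∷ is) = begin
          part L i + sumOf (part L) is       ≤⟨ +-mono-≤ (p i) (above L p is) ⟩
          B + ι (length is) * B              ≡⟨ solve 2 (λ B k → B :+ k :* B := (con 1ℚ :+ k) :* B) refl B (ι (length is)) ⟩
          (1ℚ + ι (length is)) * B           ≡⟨ cong (_* B) (ι-+ 1 (length is)) ⟨
          ι (suc (length is)) * B            ∎
          where
          open ≤-Reasoning
          open +-*-Solver

      average : 0 ℕ.< m → ∀ {B} L → (∀ i → part L i ≤ B) → (1ℚ - ι h * x) * sumOf w L ≤ B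
      average 0<m {B} L p = *-cancelˡ-≤-pos M {{M>0}} (begin
        M * (D * sumOf w L)             ≡⟨ solve 3 (λ M D W → M :* (D :* W) := D :* M :* W) refl M D (sumOf w L) ⟩
        D * M * sumOf w L               ≤⟨ below L ⟩
        sumOf (part L) (allFin m)       ≤⟨ above L p (allFin m) ⟩
        ι (length (allFin m)) * B       ≡⟨ cong (λ k → ι k * B) (length-tabulate {n = m} id) ⟩
        M * B                           ∎)
        where
        open ≤-Reasoning
        open +-*-Solver
        M>0 : Positive M
        M>0 = normalize-pos m 1 {{_}} {{ℕ.>-nonZero 0<m}}

-- Correctness and running time of the search over the cover.

module Approximation where
  open Programs
  open CostCalculus
  open Fragments
  open UniqueLists
  open Trees
  open Costs
  open Counting
  open Optima
  open Enumerations
  open TreeDP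
  open Encoding
  open FamilySize
  open Averages
  open import Data.Fin using (Fin; toℕ; zero; suc)
  open import Data.Fin.Subset using (Subset; ∣_∣) renaming (_∈_ to _∈ₛ_; _⊆_ to _⊆ₛ_)
  open import Data.Fin.Subset.Properties using (_∈?_; x∈p∩q⁺)
  open import Data.Integer using (+_)
  open import Data.List.Properties using (length-map; length-tabulate; map-tabulate)
  open import Data.List.Membership.Propositional.Properties
  open import Data.List.Relation.Binary.Permutation.Propositional using (_↭_)
  open import Data.Nat using (ℕ; zero; suc; pred; _+_; _*_; _^_; _≤_; _<_; z≤n; s≤s; s≤s⁻¹; NonZero; >-nonZero; >-nonZero⁻¹)
  open import Data.Nat.Properties
  open import Data.Nat.Tactic.RingSolver using (solve-∀)
  open import Data.Rational using (ℚ; 0ℚ; 1ℚ; _/_)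
  import Data.Rational as ℚ
  import Data.Rational.Properties as ℚ
  open import Data.Rational.Unnormalised using (mkℚᵘ)
  import Data.Rational.Unnormalised as ℚᵘ
  import Data.Rational.Unnormalised.Properties as ℚᵘ
  import Data.Integer as ℤ
  import Data.Vec as Vec

  upTo-toℕ : ∀ m → upTo m ≡ map toℕ (allFin m)
  upTo-toℕ m = trans (go id m) (sym (map-tabulate id toℕ))
    where
    go : ∀ (f : ℕ → ℕ) m → applyUpTo f m ≡ tabulate {n = m} (f ∘ toℕ)
    go f zero    = refl
    go f (suc m) = cong (f 0 ∷_) (go (f ∘ suc) m)

  module Packing (h kk r : ℕ) {n m q : ℕ} (G : Graph n) (C : Fin m → Subset n)
    (𝒯 : ∀ i → TreeDecomposition (induced G (C i))) (α≤ : ∀ i → αᵀ (𝒯 i) ≤ kk)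
    (H : Fin q → Subgraph G) (connected : ∀ j → Connected (H j)) (nonNull : ∀ j → NonNull (H j))
    (order≤ : ∀ j → order (H j) ≤ h) (w : Fin q → ℚ) where

    input : ⟦ InputTy ⟧
    input = encodeInput r G C 𝒯 H w

    open Family G H w connected nonNull h order≤
    open Compatibility input refl

    open Optimum Comp (λ {j} {l} → Comp-sym {j} {l}) (λ {j} → Comp-irrefl {j}) (weightOf ms)

    module D (i : Fin m) = Decomposed (C i) (𝒯 i) kk (α≤ i)

    covers : List ⟦ CoverTy ⟧
    covers = map (λ i → encodeCover (C i) (𝒯 i)) (allFin m)

    cover-encoded : ∀ i → nth covers (toℕ i) ([] , [] , []) ≡ encodeCover (C i) (𝒯 i)
    cover-encoded i = nth-allFin (λ i → encodeCover (C i) (𝒯 i)) i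

    solveCost : ℕ
    solveCost = proj₁ (solveT-cost h (2 * (40 + proj₁ (tableT-cost h tabCost))))

    solveEnv : Fin m → ⟦ ValTy ⟧ → Env ΓC
    solveEnv i acc = encodeCover (C i) (𝒯 i) ∷ toℕ i ∷ acc ∷ mat ∷ upTo q ∷ ms ∷ input ∷ []

    -- The environments are compared first, so that the evaluations need not be.
    solve-best : ∀ i acc → Best (_∈ D.J i) (λ _ → ⊥) (proj₁ (eval solveT (solveEnv i acc)))
    solve-best i acc = subst (λ ρ → Best (_∈ D.J i) (λ _ → ⊥) (proj₁ (eval solveT ρ)))
      {x = DP.cov h q mat ms input (toℕ i) acc (encodeSubset (C i)) (D.bags i) (D.J i)
        (TreeDecomposition.tree (𝒯 i)) (TreeDecomposition.isTree (𝒯 i)) ∷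
        toℕ i ∷ acc ∷ mat ∷ upTo q ∷ ms ∷ input ∷ []} {solveEnv i acc} refl
      (DP.Correct.Solve.solve-best h q mat ms input (toℕ i) acc (encodeSubset (C i)) (D.bags i) (D.J i)
        (TreeDecomposition.tree (𝒯 i)) (TreeDecomposition.isTree (𝒯 i))
        small (D.J<q i) (D.J-unique i) (λ {j} {l} → Comp-sym {j} {l}) (λ {j} → Comp-irrefl {j}) kk
        (D.budget i) (D.separated i) (D.covered i) (λ {p} {j} → D.isNode i {p} {j})
        membersT-value (proj₁ (D.root i)) (proj₂ (D.root i)) (D.somewhere i))

    solve-time : ∀ i acc → proj₂ (eval solveT (solveEnv i acc)) ≤
      solveCost * (suc q * cnt q kk * TreeDecomposition.size (𝒯 i))
    solve-time i acc = subst (λ ρ → proj₂ (eval solveT ρ) ≤ solveCost * (suc q * cnt q kk * TreeDecomposition.size (𝒯 i)))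
      {x = DP.cov h q mat ms input (toℕ i) acc (encodeSubset (C i)) (D.bags i) (D.J i)
        (TreeDecomposition.tree (𝒯 i)) (TreeDecomposition.isTree (𝒯 i)) ∷
        toℕ i ∷ acc ∷ mat ∷ upTo q ∷ ms ∷ input ∷ []} {solveEnv i acc} refl
      (DP.Correct.Solve.solve-time h q mat ms input (toℕ i) acc (encodeSubset (C i)) (D.bags i) (D.J i)
        (TreeDecomposition.tree (𝒯 i)) (TreeDecomposition.isTree (𝒯 i))
        small (D.J<q i) (D.J-unique i) (λ {j} {l} → Comp-sym {j} {l}) (λ {j} → Comp-irrefl {j}) kk
        (D.budget i) (D.separated i) (D.covered i) (λ {p} {j} → D.isNode i {p} {j})
        membersT-value (proj₁ (D.root i)) (proj₂ (D.root i)) (D.somewhere i))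

    improve-value : ∀ u i acc → Val (improveT u) (toℕ i ∷ acc ∷ mat ∷ upTo q ∷ ms ∷ input ∷ [])
      (better acc (proj₁ (eval u (solveEnv i acc))))
    improve-value u i acc = e-let (e-≡ (cover-encoded i) e-eval) (e-let e-eval (e-if e-eval e-eval e-eval))

    Valid : ⟦ ValTy ⟧ → Set
    Valid v = Indep (proj₂ v) × All (_< q) (proj₂ v) × proj₁ v ≡ sumOf (weightOf ms) (proj₂ v)

    Dominates : ⟦ ValTy ⟧ → Fin m → Set
    Dominates v i = ∀ {Q} → Indep Q → All (_∈ D.J i) Q → sumOf (weightOf ms) Q ℚ.≤ proj₁ v

    better-≥ˡ : ∀ v v′ → proj₁ v ℚ.≤ proj₁ (better v v′)
    better-≥ˡ v v′ with proj₁ v ℚ.≤ᵇ proj₁ v′ in eq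
    ... | true  = ℚ.≤ᵇ⇒≤ (subst T (sym eq) _)
    ... | false = ℚ.≤-refl

    better-≥ʳ : ∀ v v′ → proj₁ v′ ℚ.≤ proj₁ (better v v′)
    better-≥ʳ v v′ with proj₁ v ℚ.≤ᵇ proj₁ v′ in eq
    ... | true  = ℚ.≤-refl
    ... | false = ℚ.<⇒≤ (ℚ.≰⇒> (λ p → subst T eq (ℚ.≤⇒≤ᵇ p)))

    better-either : ∀ {P : ⟦ ValTy ⟧ → Set} v v′ → P v → P v′ → P (better v v′)
    better-either v v′ p p′ with proj₁ v ℚ.≤ᵇ proj₁ v′
    ... | true  = p′
    ... | false = p

    loop : Tm ΓC ValTy → List (Fin m) → Timed ⟦ ValTy ⟧
    loop u is = foldrᵀ (λ i acc → eval (improveT u) (i ∷ acc ∷ mat ∷ upTo q ∷ ms ∷ input ∷ [])) (0ℚ , []) (map toℕ is)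

    loop-ok : ∀ u → (∀ i acc → Best (_∈ D.J i) (λ _ → ⊥) (proj₁ (eval u (solveEnv i acc)))) →
      ∀ is → Valid (proj₁ (loop u is)) × All (Dominates (proj₁ (loop u is))) is
    loop-ok u u-best [] = ([] , [] , refl) , []
    loop-ok u u-best (i ∷ is) = subst (λ v → Valid v × All (Dominates v) (i ∷ is)) (sym (value (improve-value u i acc)))
      (improve (proj₁ (eval u (solveEnv i acc))) (u-best i acc))
      where
      acc = proj₁ (loop u is)
      ih = loop-ok u u-best is
      improve : ∀ v → Best (_∈ D.J i) (λ _ → ⊥) v → Valid (better acc v) × All (Dominates (better acc v)) (i ∷ is)
      improve v b =
        better-either acc v (proj₁ ih) (indep b , All.map (All.lookup (D.J<q i)) (inU b) , weighs b) ,
        (λ ind q∈ → ℚ.≤-trans (opt b ind q∈ (All.tabulate (λ _ _ ()))) (better-≥ʳ acc v)) ∷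
        All.map (λ dom {Q} ind q∈ → ℚ.≤-trans (dom {Q} ind q∈) (better-≥ˡ acc v)) (proj₂ ih)

    length-ms : length ms ≡ q
    length-ms = trans (length-map _ (allFin q)) (length-tabulate {n = q} id)

    length-covers : length covers ≡ m
    length-covers = trans (length-map _ (allFin m)) (length-tabulate {n = m} id)

    search-value : ∀ u → Val (searchT u) (input ∷ []) (proj₂ (proj₁ (loop u (allFin m))))
    search-value u = e-let e-eval (e-let (e-let (e-≡ length-ms e-eval) (upToT-value q)) (e-let (matT-value q ms input)
      (e-snd (e-foldᵀ (e-let (e-≡ length-covers e-eval) (e-≡ (upTo-toℕ m) (upToT-value m))) e-eval))))

    search-output : ∀ u → output (searchT u) input ≡ proj₂ (proj₁ (loop u (allFin m)))
    search-output u = value (search-value u)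

    module Output (best : ⟦ ValTy ⟧) (best-valid : Valid best) (best-dominates : ∀ i → Dominates best i) where

      ∈best? : ∀ (a : Fin q) → Dec (toℕ a ∈ proj₂ best)
      ∈best? a = Any.any? (toℕ a ≟_) (proj₂ best)

      I : Subset q
      I = Vec.tabulate (does ∘ ∈best?)

      best↭ : proj₂ best ↭ encodeOutput I
      best↭ = unique-↭ (indep⇒unique (proj₁ best-valid)) (Unique.map⁺ Fin.toℕ-injective (elements-unique I)) to from
        where
        to : ∀ {j} → j ∈ proj₂ best → j ∈ map toℕ (elements I)
        to {j} j∈ = let j< = All.lookup (proj₁ (proj₂ best-valid)) j∈
                        eq = Fin.toℕ-fromℕ< j<
                    in subst (_∈ map toℕ (elements I)) eq (∈-map⁺ toℕ (∈-elements⁺ (tabulate⁺ ∈best? (subst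
                          (_∈ proj₂ best) (sym eq) j∈))))
        from : ∀ {j} → j ∈ map toℕ (elements I) → j ∈ proj₂ best
        from j∈ with ∈-map⁻ toℕ j∈
        ... | a , a∈ , refl = tabulate⁻ ∈best? (∈-elements⁻ a∈)

      packing-ok : IsIndependentPacking H I
      packing-ok a a∈ b b∈ a≢b = Comp⁻ (pairwise (λ {j} {l} → Comp-sym {j} {l}) (proj₁ best-valid)
            (tabulate⁻ ∈best? a∈) (tabulate⁻ ∈best? b∈) (a≢b ∘ Fin.toℕ-injective))

      sumOf-encoded : ∀ xs → sumOf (weightOf ms) (map toℕ xs) ≡ sumOf w xs
      sumOf-encoded []       = refl
      sumOf-encoded (a ∷ xs) = cong₂ ℚ._+_ (weight-encoded a) (sumOf-encoded xs)

      weight-ok : proj₁ best ≡ weight w I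
      weight-ok = trans (proj₂ (proj₂ best-valid)) (trans (sumOf-↭ (weightOf ms) best↭) (sumOf-encoded (elements I)))

      module Ratio (w≥0 : ∀ j → 0ℚ ℚ.≤ w j) (0<m : 0 < m) (x : ℚ) .{{_ : ℚ.NonNegative x}}
        (cover : ∀ v → (1ℚ ℚ.- x) ℚ.* ι m ℚ.≤ ι (length (filter (λ i → v ∈? C i) (allFin m)))) where
        open Averaging C x cover

        -- The subgraphs of a packing that fit into one element of the cover are a competitor in the
        -- subproblem of that element, whose optimum is dominated by `best`.
        packing-part : ∀ {K} → IsIndependentPacking H K → ∀ i →
          sumOf w (filter (λ a → inside? (elements (V a)) i) (elements K)) ℚ.≤ proj₁ best
        packing-part {K} ind i = subst (ℚ._≤ proj₁ best) (sumOf-encoded xs)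
          (best-dominates i (AllPairs.map⁺ (independent unique (All.tabulate within)))
            (All.map⁺ (All.tabulate (λ {a} a∈ → D.∈J⁺ i {a} (λ {u} u∈ → All.lookup
              (proj₂ (∈-filter⁻ (λ a → inside? (elements (V a)) i) {xs = elements K} a∈)) (∈-elements⁺ u∈))))))
          where
          xs = filter (λ a → inside? (elements (V a)) i) (elements K)
          unique : Unique xs
          unique = Unique.filter⁺ (λ a → inside? (elements (V a)) i) (elements-unique K)
          within : ∀ {a} → a ∈ xs → a ∈ₛ K
          within a∈ = ∈-elements⁻ (proj₁ (∈-filter⁻ (λ a → inside? (elements (V a)) i) {xs = elements K} a∈))
          independent : ∀ {xs} → Unique xs → All (_∈ₛ K) xs → AllPairs (λ a b → Comp (toℕ a) (toℕ b)) xs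
          independent []       []       = []
          independent (a∉ ∷ u) (a∈ ∷ p) = All.zipWith (λ (a≢b , b∈) → Comp⁺ (ind _ a∈ _ b∈ a≢b)) (a∉ , p) ∷ independent u p

        ratio-packing : ∀ {K} → IsIndependentPacking H K → (1ℚ ℚ.- ι h ℚ.* x) ℚ.* weight w K ℚ.≤ proj₁ best
        ratio-packing {K} ind = average (λ a → elements (V a)) w w≥0 h
          (λ a → ≤-trans (≤-reflexive (length-elements (V a))) (order≤ a)) 0<m (elements K) (packing-part ind)

        best≥0 : 0ℚ ℚ.≤ proj₁ best
        best≥0 = subst (0ℚ ℚ.≤_) (sym weight-ok) (nonneg (elements I))
          where
          nonneg : ∀ xs → 0ℚ ℚ.≤ sumOf w xs
          nonneg []       = ℚ.≤-refl
          nonneg (a ∷ xs) = ℚ.+-mono-≤ (w≥0 a) (nonneg xs)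

        ratio : (1ℚ ℚ.- ι h ℚ.* x) ℚ.* maxPackingWeight H w ℚ.≤ weight w I
        ratio with MaxRat.argmax-sel id 0ℚ (map (weight w) (filter (isIndependentPacking? H) (subsets q)))
        -- The maximum is the default 0, so nonnegativity of the result is enough.
        ... | inj₁ eq = subst₂ ℚ._≤_ (trans (sym (ℚ.*-zeroʳ D′)) (cong (D′ ℚ.*_) (sym eq))) weight-ok best≥0
          where D′ = 1ℚ ℚ.- ι h ℚ.* x
        ... | inj₂ max∈ with ∈-map⁻ (weight w) max∈
        ... | K , K∈ , eq = subst₂ ℚ._≤_ (cong ((1ℚ ℚ.- ι h ℚ.* x) ℚ.*_) (sym eq)) weight-ok
          (ratio-packing (proj₂ (∈-filter⁻ (isIndependentPacking? H) {xs = subsets q} K∈)))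

    searchCost : ℕ
    searchCost = proj₁ (searchT-cost h solveCost)

    search-time : 0 < m → ∀ u → (∀ i acc → proj₂ (eval u (solveEnv i acc)) ≤
        solveCost * (suc q * cnt q kk * TreeDecomposition.size (𝒯 i))) →
      time (searchT u) input ≤ searchCost *
        (m * (maxOver (λ i → TreeDecomposition.size (𝒯 i)) * (suc q * cnt q kk + suc q * suc q)))
    search-time 0<m u u-time = subst (λ N → time (searchT u) input ≤ searchCost * N) (suc-pred (m *
          (t * W)) {{N≢0}}) (bound total)
      where
      t = maxOver (λ i → TreeDecomposition.size (𝒯 i))
      -- The first summand is the scale of the dynamic program per node. The second is the scale of
      -- the compatibility matrix; it is charged to every node, although the matrix is computed
      -- once.
      W = suc q * cnt q kk + suc q * suc q

      first : ∀ {m} → 0 < m → Fin m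
      first {suc m} _ = zero

      1≤t : 1 ≤ t
      1≤t = ≤-trans (≤-trans (s≤s z≤n) (Fin.toℕ<n (proj₁ (D.root (first 0<m)))))
        (≤maxOver (λ i → TreeDecomposition.size (𝒯 i)) (first 0<m))

      X²≤W : suc q * suc q ≤ W
      X²≤W = m≤n+m (suc q * suc q) (suc q * cnt q kk)

      W≤tW : W ≤ t * W
      W≤tW = m≤n*m W t {{>-nonZero 1≤t}}

      tW≤N : t * W ≤ m * (t * W)
      tW≤N = m≤n*m (t * W) m {{>-nonZero 0<m}}

      tW≢0 : NonZero (t * W)
      tW≢0 = >-nonZero (≤-trans (s≤s z≤n) (≤-trans X²≤W W≤tW))

      N≢0 : NonZero (m * (t * W))
      N≢0 = >-nonZero (≤-trans (s≤s z≤n) (≤-trans X²≤W (≤-trans W≤tW tW≤N)))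

      y x : ℕ
      y = pred (t * W)
      x = pred (m * (t * W))

      sy≡ : suc y ≡ t * W
      sy≡ = suc-pred (t * W) {{tW≢0}}

      sx≡ : suc x ≡ m * (t * W)
      sx≡ = suc-pred (m * (t * W)) {{N≢0}}

      solving : ∀ i acc → Cost y u (solveEnv i acc) solveCost
      solving i acc = cost (≤-trans (u-time i acc) (*-monoʳ-≤ solveCost (≤-trans
        (*-mono-≤ (m≤m+n (suc q * cnt q kk) (suc q * suc q)) (≤maxOver (λ i → TreeDecomposition.size (𝒯 i)) i))
        (≤-reflexive (trans (*-comm W t) (sym sy≡))))))

      total : Cost x (searchT u) (input ∷ []) searchCost
      total = proj₂ (searchT-cost h solveCost) u input q m length-ms length-covers small
        (s≤s⁻¹ (≤-trans (≤-trans X²≤W (≤-trans W≤tW tW≤N)) (≤-reflexive (sym sx≡))))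
        (≤-trans (m≤m*n m (t * W) {{tW≢0}}) (≤-reflexive (sym sx≡)))
        (≤-reflexive (trans (cong (m *_) sy≡) (trans (sym sx≡) (sym (*-identityˡ (suc x))))))
        (λ {i} acc i∈ → within acc (∈-map⁻ toℕ (subst (i ∈_) (upTo-toℕ m) i∈)))
        where
        within : ∀ {i} acc → (∃ λ a → a ∈ allFin m × i ≡ toℕ a) →
          Cost y u (nth covers i ([] , [] , []) ∷ i ∷ acc ∷ mat ∷ upTo q ∷ ms ∷ input ∷ []) solveCost
        within acc (a , _ , refl) = subst (λ c → Cost y u (c ∷ toℕ a ∷ acc ∷ mat ∷ upTo q ∷ ms ∷ input ∷ []) solveCost)
          (sym (cover-encoded a)) (solving a acc)

    Result : ℚ → Set
    Result ρ = Σ[ I ∈ Subset q ] (output (searchT solveT) input ↭ encodeOutput I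
      × IsIndependentPacking H I × ρ ℚ.* maxPackingWeight H w ℚ.≤ weight w I)

    result : (∀ j → 0ℚ ℚ.≤ w j) → 0 < m → ∀ x .{{_ : ℚ.NonNegative x}} → IsGeneralCover (1ℚ ℚ.- x) C →
      Result (1ℚ ℚ.- ι h ℚ.* x)
    result w≥0 0<m x cover = package (proj₁ (loop solveT (allFin m))) (loop-ok solveT solve-best (allFin m))
          (search-output solveT)
      where
      package : ∀ best → Valid best × All (Dominates best) (allFin m) → output (searchT solveT) input ≡ proj₂ best →
        Result (1ℚ ℚ.- ι h ℚ.* x)
      package best (valid , dominates) out = O.I , subst (_↭ encodeOutput O.I) (sym out) O.best↭ , O.packing-ok ,
        O.Ratio.ratio w≥0 0<m x cover
        where module O = Output best valid (λ i {Q} → All.lookup dominates (∈-allFin i) {Q})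

  1≤α : ∀ {n} {G : Graph n} {C : Subset n} (𝒯 : TreeDecomposition (induced G C)) {v} → v ∈ₛ C → 1 ≤ αᵀ 𝒯
  1≤α {G = G} {C} 𝒯 {v} v∈ = ≤-trans (length≤∣fromList∣ {xs = v ∷ []} ([] ∷ []))
    (≤-trans (∣∣≤α (induced G C ↾ bag t) (contained , nonadjacent)) (≤maxOver (λ t → α (induced G C ↾ bag t)) t))
    where
    open TreeDecomposition 𝒯
    t = proj₁ (vertexCover (∈-induced⁺ {G = G} v∈))
    v∈t = proj₂ (vertexCover (∈-induced⁺ {G = G} v∈))
    single : ∀ {u} → u ∈ₛ fromList (v ∷ []) → u ≡ v
    single u∈ with ∈-fromList⁻ (v ∷ []) u∈
    ... | here eq = eq
    contained : fromList (v ∷ []) ⊆ₛ Subgraph.V (induced G C ↾ bag t)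
    contained u∈ = subst (_∈ₛ Subgraph.V (induced G C ↾ bag t)) (sym (single u∈)) (x∈p∩q⁺ (∈-induced⁺ {G = G} v∈ , v∈t))
    nonadjacent : ∀ a → a ∈ₛ fromList (v ∷ []) → ∀ b → b ∈ₛ fromList (v ∷ []) → ¬ Subgraph.Edge (induced G C ↾ bag t) a b
    nonadjacent a a∈ b b∈ e = Graph.irrefl G
      (subst₂ (Graph.Adj G) (single a∈) (single b∈) (Subgraph.sub (induced G C ↾ bag t) {a} {b} e))

  -- For r ≥ 2 the factor 1 - 1/r is positive, so the number of elements containing `v` cannot be 0.
  cover-nonempty : ∀ {n m} (C : Fin m → Subset n) r → 0 < m → IsGeneralCover (1ℚ ℚ.- + 1 / suc (suc r)) C →
    ∀ v → ∃ λ i → v ∈ₛ C i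
  cover-nonempty {n} {m} C r 0<m cover v = go (filter (λ i → v ∈? C i) (allFin m)) refl
    where
    go : ∀ l → filter (λ i → v ∈? C i) (allFin m) ≡ l → ∃ λ i → v ∈ₛ C i
    go (i ∷ _) eq = i , proj₂ (∈-filter⁻ (λ i → v ∈? C i) {xs = allFin m} (subst (i ∈_) (sym eq) (here refl)))
    go []      eq = ⊥-elim (ℚ.<-irrefl refl (ℚ.<-≤-trans positive (subst (λ l → (1ℚ ℚ.- x) ℚ.* ι m ℚ.≤ ι
          (length l)) eq (cover v))))
      where
      x = + 1 / suc (suc r)
      x<1 : x ℚ.< 1ℚ
      x<1 = ℚ.toℚᵘ-cancel-< (ℚᵘ.<-respˡ-≃ (ℚᵘ.≃-sym (ℚ.toℚᵘ-fromℚᵘ (mkℚᵘ (+ 1) (suc r))))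
        (ℚᵘ.*<* (ℤ.+<+ (s≤s (s≤s z≤n)))))
      1-x>0 : 0ℚ ℚ.< 1ℚ ℚ.- x
      1-x>0 = subst (ℚ._< 1ℚ ℚ.- x) (ℚ.+-inverseʳ x) (ℚ.+-monoˡ-< (ℚ.- x) x<1)
      positive : 0ℚ ℚ.< (1ℚ ℚ.- x) ℚ.* ι m
      positive = ℚ.positive⁻¹ _ {{ℚ.pos*pos⇒pos (1ℚ ℚ.- x) {{ℚ.positive 1-x>0}}
            (ι m) {{ℚ.normalize-pos m 1 {{_}} {{>-nonZero 0<m}}}}}}

  -- The first summand is handled by `cnt-bound`, which supplies 8^c, together with q + 1 ≤ (c + 1)
  -- x. The assumption on x^2 is there for the compatibility matrix.
  scale-bound : ∀ q x k c .{{_ : NonZero x}} → q ≤ x * c → x * x ≤ x ^ (k + 1) →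
    suc q * cnt q k + suc q * suc q ≤ (suc c * 8 ^ c + suc c * suc c) * x ^ (k + 1)
  scale-bound q x k c q≤ x²≤ = begin
    suc q * cnt q k + suc q * suc q
      ≤⟨ +-mono-≤ (*-mono-≤ X≤ (cnt-bound x c k (≤-trans q≤ (≤-reflexive (*-comm x c))))) (*-mono-≤ X≤ X≤) ⟩
    (suc c * x) * (8 ^ c * x ^ k) + (suc c * x) * (suc c * x)       ≡⟨ lemma (suc c) x (8 ^ c) (x ^ k) ⟩
    suc c * 8 ^ c * (x * x ^ k) + suc c * suc c * (x * x)
      ≤⟨ +-mono-≤ (≤-reflexive (cong (λ e → suc c * 8 ^ c * x ^ e) (+-comm 1 k))) (*-monoʳ-≤ (suc c * suc c) x²≤) ⟩
    suc c * 8 ^ c * x ^ (k + 1) + suc c * suc c * x ^ (k + 1)       ≡⟨ *-distribʳ-+ (x ^ (k + 1)) (suc c * 8 ^ c)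
          (suc c * suc c) ⟨
    (suc c * 8 ^ c + suc c * suc c) * x ^ (k + 1)                   ∎
    where
    open ≤-Reasoning
    X≤ : suc q ≤ suc c * x
    X≤ = +-mono-≤ (>-nonZero⁻¹ x) (≤-trans q≤ (≤-reflexive (*-comm x c)))
    lemma : ∀ c x e p → (c * x) * (e * p) + (c * x) * (c * x) ≡ c * e * (x * p) + c * c * (x * x)
    lemma = solve-∀

  -- The first factor counts steps per unit of scale. The second comes from `scale-bound` with c =
  -- 2^(h h), the number of edge patterns on h positions in `family-bound`.
  constant : ℕ → ℕ
  constant h = proj₁ (searchT-cost h (proj₁ (solveT-cost h (2 * (40 + proj₁ (tableT-cost h tabCost)))))) *
    (suc c * 8 ^ c + suc c * suc c)
    where c = 2 ^ (h * h)

  module _ (h : ℕ) (f : ℕ → ℕ) (r : ℕ) .{{_ : NonZero r}} (h<r : h < r) (n : ℕ) (G : Graph n) (m : ℕ) (0<m : 0 < m)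
    (C : Fin m → Subset n) (cover : IsGeneralCover (1ℚ ℚ.- + 1 / r) C)
    (𝒯 : (i : Fin m) → TreeDecomposition (induced G (C i))) (α≤ : ∀ i → αᵀ (𝒯 i) ≤ f r)
    (q : ℕ) (H : Fin q → Subgraph G) (props : ∀ j → Connected (H j) × NonNull (H j) × order (H j) ≤ h)
    (distinct : Distinct H) (0<n : 0 < n) where

    private
      x = n ^ h
      k = f r
      t = maxOver (λ i → TreeDecomposition.size (𝒯 i))

      1≤k : 1 ≤ h → 1 ≤ k
      1≤k 1≤h = positive r h<r cover 1≤h α≤ 0<n
        where
        positive : ∀ r .{{_ : NonZero r}} → h < r → IsGeneralCover (1ℚ ℚ.- + 1 / r) C → 1 ≤ h →
          (∀ i → αᵀ (𝒯 i) ≤ k) → 0 < n → 1 ≤ k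
        -- For r = 1 the assumptions h < r and 1 ≤ h contradict each other; what remains is r ≥ 2,
        -- where `cover-nonempty` applies.
        positive (suc zero)    (s≤s z≤n) _     ()
        positive (suc (suc r)) _         cover _  α≤ 0<n =
          let (i , v∈) = cover-nonempty C r 0<m cover (Data.Fin.fromℕ< 0<n) in ≤-trans (1≤α (𝒯 i) v∈) (α≤ i)

      x≢0 : NonZero x
      x≢0 = m^n≢0 n h {{>-nonZero 0<n}}

      -- For h = 0 both sides are 1; otherwise k ≥ 1 makes the exponent k + 1 at least 2.
      square : ∀ h → (1 ≤ h → 1 ≤ k) → n ^ h * n ^ h ≤ (n ^ h) ^ (k + 1)
      square zero    _ = ≤-reflexive (sym (^-zeroˡ (k + 1)))
      square (suc h) p = ≤-trans (≤-reflexive (cong (y *_) (sym (*-identityʳ y))))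
        (^-monoʳ-≤ y {{m^n≢0 n (suc h) {{>-nonZero 0<n}}}} {2} {k + 1} (+-monoˡ-≤ 1 (p (s≤s z≤n))))
        where y = n ^ suc h

    within-time : ∀ T → T ≤ proj₁ (searchT-cost h (proj₁ (solveT-cost h (2 * (40 + proj₁ (tableT-cost h tabCost)))))) *
        (m * (t * (suc q * cnt q k + suc q * suc q))) →
      T ≤ m * (constant h * (n ^ (h * (f r + 1)) * t))
    within-time T T≤ = begin
      T                                                     ≤⟨ T≤ ⟩
      s * (m * (t * (suc q * cnt q k + suc q * suc q)))
        ≤⟨ *-monoʳ-≤ s (*-monoʳ-≤ m (*-monoʳ-≤ t (scale-bound q x k c {{x≢0}} q≤ (square h 1≤k)))) ⟩
      s * (m * (t * (d * x ^ (k + 1))))                     ≡⟨ cong (λ e → s * (m * (t * (d * e)))) (^-*-assoc n h (k + 1)) ⟩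
      s * (m * (t * (d * n ^ (h * (k + 1)))))               ≡⟨ lemma s m t d (n ^ (h * (k + 1))) ⟩
      m * (s * d * (n ^ (h * (k + 1)) * t))                 ∎
      where
      open ≤-Reasoning
      c = 2 ^ (h * h)
      d = suc c * 8 ^ c + suc c * suc c
      s = proj₁ (searchT-cost h (proj₁ (solveT-cost h (2 * (40 + proj₁ (tableT-cost h tabCost))))))
      q≤ : q ≤ x * c
      q≤ = family-bound H distinct (λ j → proj₁ (proj₂ (props j))) (λ j → proj₂ (proj₂ (props j)))
      lemma : ∀ s m t d e → s * (m * (t * (d * e))) ≡ m * (s * d * (e * t))
      lemma = solve-∀

open import Data.Fin using (Fin)
open import Data.Fin.Subset using (Subset)
open import Data.Integer using (+_)
open import Data.List.Relation.Binary.Permutation.Propositional using (_↭_)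
open import Data.Nat using (ℕ; zero; suc; _+_; _*_; _^_; _≤_; _<_; NonZero)
open import Data.Rational using (ℚ; 0ℚ; 1ℚ; _/_)
import Data.Rational as ℚ
import Data.Rational.Properties as ℚ
open Programs using (searchT; solveT)
open Averages using (/-ι)
open Approximation using (constant; within-time; module Packing)

theorem7p4 :
    (h : ℕ) (f : ℕ → ℕ) →
    Σ[ P ∈ Program InputTy OutputTy ] Σ[ c ∈ ℕ ]
      ((r : ℕ) .{{_ : NonZero r}} → h < r →
       (n : ℕ) (G : Graph n) →
       (m : ℕ) → 0 < m →
       (C : Fin m → Subset n) → IsGeneralCover (1ℚ ℚ.- + 1 / r) C →
       (𝒯 : (i : Fin m) → TreeDecomposition (induced G (C i))) →
       (∀ i → αᵀ (𝒯 i) ≤ f r) →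
       (q : ℕ) (H : Fin q → Subgraph G) →
       (∀ j → Connected (H j) × NonNull (H j) × order (H j) ≤ h) →
       (w : Fin q → ℚ) → (∀ j → 0ℚ ℚ.≤ w j) →
       let input = encodeInput r G C 𝒯 H w
           t     = maxOver (λ i → TreeDecomposition.size (𝒯 i))
       in
       (Σ[ I ∈ Subset q ] (output P input ↭ encodeOutput I
              × IsIndependentPacking H I
              × (1ℚ ℚ.- + h / r) ℚ.* maxPackingWeight H w ℚ.≤ weight w I))
       × (0 < n → Distinct H →
          time P input ≤ m * (c * (n ^ (h * (f r + 1)) * t))))
theorem7p4 h f = searchT solveT , constant h , λ
  { zero    ()
  ; (suc r) h<r n G m 0<m C cover 𝒯 α≤ q H props w w≥0 →
      let module P = Packing h (f (suc r)) (suc r) G C 𝒯 α≤ H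
            (λ j → proj₁ (props j)) (λ j → proj₁ (proj₂ (props j))) (λ j → proj₂ (proj₂ (props j))) w
      -- The averaging argument produces h times 1/r, which has to be identified with the fraction
      -- h/r.
      in subst P.Result (cong (λ y → 1ℚ ℚ.- y) (sym (/-ι h r)))
           (P.result w≥0 0<m (+ 1 / suc r) {{ℚ.normalize-nonNeg 1 (suc r)}} cover) ,
         λ 0<n distinct → within-time h f (suc r) h<r n G m 0<m C cover 𝒯 α≤ q H props distinct 0<n
           (time (searchT solveT) (encodeInput (suc r) G C 𝒯 H w))
           (P.search-time 0<m solveT P.solve-time) }
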